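{- Let $k\in\mathbb Z_{>0}$ and $m_1,m_2\in\mathbb Z$. Then $$\begin{aligned}\Sigma(2^k,-2^k;m_1,m_2)=2^k\delta_{2|k}\Big(&\delta_{2^k|m_1}2^k+\delta_{2^k|m_2}2^k-\delta_{2^{k-1}|m_1}2^{k-1}\\&+\sum_{i=1}^{k-1}(-1)^ig(2^2,m_1,2^{k-i})g(2^2,m_2,2^i)+\sum_{i=1}^{k-1}\delta_{2^{i-1}|m_2}2^{i-1}g(2^2,m_1,2^{k-i})\Big).\end{aligned}$$
   Context: $\delta_P$ is $1$ if the statement $P$ holds and $0$ otherwise. $(\frac{\cdot}{\cdot})$ is the Kronecker symbol; for nonzero reals $(x,y)_{\mathbb R}=-1$ if $x,y<0$ and $1$ otherwise. $g(d,m,n)=\sum_{x\in(\mathbb Z/n\mathbb Z)^\times}(\frac{x}{d})e^{2\pi i mx/n}$; in particular $g(2^2,m,2^n)=\sum_{x\in(\mathbb Z/2^n\mathbb Z)^\times}e^{2\pi imx/2^n}$ for $n\ge1$. $\Gamma=\Gamma_1(4)$ is the group of $\gamma\in\mathrm{SL}(3,\mathbb Z)$ congruent mod $4$ to an upper triangular unipotent matrix, and $\Gamma_\infty$ is the group of upper triangular unipotent matrices in $\mathrm{SL}(3,\mathbb Z)$. The Plücker coordinates of a matrix with second row $(d,e,f)$ and third row $(g,h,i)$ are $(-g,-h,-i,-(dh-eg),di-fg,-(ei-fh))$; for $\gamma\in\Gamma$ they are written $(4A_1,4B_1,C_1,4A_2,4B_2,C_2)$ with integers $A_i,B_i,C_i$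 (they satisfy $A_1C_2+4B_1B_2+C_1A_2=0$, $\gcd(A_i,B_i,C_i)=1$, $C_i\equiv-1$ mod $4$, and such tuples parametrize $\Gamma_\infty\backslash\Gamma$). Splitting: $s:\Gamma\to\{\pm1\}$ is the function such that $\gamma\mapsto(\gamma,s(\gamma))$ is Miller's splitting homomorphism of $\Gamma$ into the double cover of $\mathrm{SL}(3,\mathbb R)$; it is left and right $\Gamma_\infty$-invariant and for $A_1,A_2\neq0$ it is determined as follows. If $A_1>0$ and $A_2/D$ is odd, with $D=\gcd(A_1,A_2)$, $D_1=\gcd(D,B_1)$, $D_2=D/D_1$, $\epsilon=(\frac{ -1}{B_1/D_1})$, then $$s(\gamma)=\Big(\tfrac{\epsilon}{ -A_1A_2}\Big)\Big(\tfrac{A_1/D}{A_2/D}\Big)\Big(\tfrac{B_1/D_1}{A_1/D}\Big)\Big(\tfrac{4B_2/D_2}{|A_2|/D}\Big)\Big(\tfrac{D_1}{C_1}\Big)\Big(\tfrac{D_2}{C_2}\Big);$$ the remaining cases follow from $s(S_3\gamma S_3)=s(\gamma)$ with $S_3=\mathrm{diag}(1,1,-1)$, and $s(w_\ell{}^\intercal\gamma^{ -1}w_\ell^{ -1})=(-A_1,-A_2)_{\mathbb R}s(\gamma)$ with $w_\ell=\begin{pmatrix}0&0&1\\0&-1&0\\1&0&0\end{pmatrix}$. (Conventions: $(\frac{0}{1})=(\frac{ -1}{0})=1$.) Exponential sums: for nonzero integers $A_1,A_2$, $\mathbb S(A_1,A_2)$ is the set of $\gamma\in\Gamma$ with Plücker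 coordinates $(4A_1,*,*,4A_2,*,*)$, and $\Sigma(A_1,A_2;m_1,m_2)=\sum_{\gamma\in\Gamma_\infty\backslash\mathbb S(A_1,A_2)/\Gamma_\infty}s(\gamma)e^{2\pi i(m_1\frac{B_1}{A_1}+m_2\frac{B_2}{A_2})}$ for $m_1,m_2\in\mathbb Z$. -}

module Defs where

open import Algebra.Bundles using (CommutativeRing)
open import Data.Bool.Base using (if_then_else_; _∧_)
open import Data.Fin.Base using (Fin; toℕ)
open import Data.Fin.Properties using (any?)
open import Data.Integer.Base as ℤ
  using (ℤ; +_; +[1+_]; -[1+_]; 0ℤ; 1ℤ; -1ℤ; ∣_∣; sign; _◃_;
         _+_; _*_; _-_; -_; _/_; _/ℕ_; _%ℕ_)
open import Data.Integer.Divisibility.Signed using (_∣_; _∣?_)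
open import Data.Integer.GCD using (gcd)
import Data.Integer.Properties as ℤ
open import Data.List.Base using (List; map; filter; foldr; upTo)
open import Data.List.Relation.Unary.All using (All)
open import Data.List.Relation.Unary.AllPairs using (AllPairs)
open import Data.List.Relation.Unary.Any using (Any)
open import Data.Nat.Base as ℕ using (ℕ; suc; _^_)
import Data.Nat.Properties as ℕ
open import Data.Nat.Coprimality using (coprime?)
open import Data.Nat.Primality.Factorisation using (factorise; factors)
open import Data.Product.Base using (_×_; ∃-syntax)
open import Data.Rational.Base as ℚ using (ℚ; 1ℚ; ½)
open import Level using (_⊔_)
open import Relation.Binary.PropositionalEquality.Core using (_≡_)
open import Relation.Nullary.Decidable.Core using (Dec; does)
open import Relation.Nullary.Negation.Core using (¬_)

2^n≢0 : ∀ n → ℕ.NonZero (2 ^ n)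
2^n≢0 n = ℕ.m^n≢0 2 n

-2^n≢0 : ∀ n → ℤ.NonZero (- (+ (2 ^ n)))
-2^n≢0 n with suc _ ← 2 ^ n | _ ← 2^n≢0 n = _

-- (a/p) for a prime p.
kroneckerAtPrime : ℤ → ℕ → ℤ
kroneckerAtPrime a 2 =
  if does (+ 2 ∣? a) then 0ℤ
  else if does (a %ℕ 8 ℕ.≟ 1) then 1ℤ
  else if does (a %ℕ 8 ℕ.≟ 7) then 1ℤ
  else -1ℤ
kroneckerAtPrime a p =
  if does (+ p ∣? a) then 0ℤ
  else if does (any? λ (x : Fin p) → + p ∣? + toℕ x * + toℕ x - a) then 1ℤ
  else -1ℤ

kroneckerℕ : ℤ → (n : ℕ) → .{{ℕ.NonZero n}} → ℤ
kroneckerℕ a n = foldr _*_ 1ℤ (map (kroneckerAtPrime a) (factors (factorise n)))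

kroneckerAt-1 : ℤ → ℤ
kroneckerAt-1 a = if does (a ℤ.<? 0ℤ) then -1ℤ else 1ℤ

kronecker : ℤ → ℤ → ℤ
kronecker a (+ 0)      = if does (∣ a ∣ ℕ.≟ 1) then 1ℤ else 0ℤ
kronecker a +[1+ n ]   = kroneckerℕ a (suc n)
kronecker a (-[1+ n ]) = kroneckerAt-1 a * kroneckerℕ a (suc n)

hilbertℝ : ℤ → ℤ → ℤ
hilbertℝ x y = if does (x ℤ.<? 0ℤ) ∧ does (y ℤ.<? 0ℤ) then -1ℤ else 1ℤ

-- Rows (a b c), (d e f), (g h i).
record Matrix : Set where
  constructor mat
  field
    a b c d e f g h i : ℤ

infixl 7 _·_

_·_ : Matrix → Matrix → Matrix
mat a b c d e f g h i · mat a′ b′ c′ d′ e′ f′ g′ h′ i′ = mat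
  (a * a′ + b * d′ + c * g′) (a * b′ + b * e′ + c * h′) (a * c′ + b * f′ + c * i′)
  (d * a′ + e * d′ + f * g′) (d * b′ + e * e′ + f * h′) (d * c′ + e * f′ + f * i′)
  (g * a′ + h * d′ + i * g′) (g * b′ + h * e′ + i * h′) (g * c′ + h * f′ + i * i′)

det : Matrix → ℤ
det (mat a b c d e f g h i) =
  a * (e * i - f * h) - b * (d * i - f * g) + c * (d * h - e * g)

transpose : Matrix → Matrix
transpose (mat a b c d e f g h i) = mat a d g b e h c f i

-- The adjugate, which is the inverse of a matrix of determinant 1.
inv : Matrix → Matrix
inv (mat a b c d e f g h i) = mat
  (e * i - f * h) (c * h - b * i) (b * f - c * e)
  (f * g - d * i) (a * i - c * g) (c * d - a * f)
  (d * h - e * g) (b * g - a * h) (a * e - b * d)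

record Γ∞ (γ : Matrix) : Set where
  open Matrix γ
  field
    a≡1 : a ≡ 1ℤ
    e≡1 : e ≡ 1ℤ
    i≡1 : i ≡ 1ℤ
    d≡0 : d ≡ 0ℤ
    g≡0 : g ≡ 0ℤ
    h≡0 : h ≡ 0ℤ

-- Γ₁(4)
record Γ (γ : Matrix) : Set where
  open Matrix γ
  field
    det≡1 : det γ ≡ 1ℤ
    a≡1[4] : + 4 ∣ a - 1ℤ
    e≡1[4] : + 4 ∣ e - 1ℤ
    i≡1[4] : + 4 ∣ i - 1ℤ
    d≡0[4] : + 4 ∣ d
    g≡0[4] : + 4 ∣ g
    h≡0[4] : + 4 ∣ h

-- The Plücker coordinates of γ are (4A₁, 4B₁, C₁, 4A₂, 4B₂, C₂); on Γ the
-- divisions by 4 are exact.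
A₁ B₁ C₁ A₂ B₂ C₂ : Matrix → ℤ
A₁ (mat _ _ _ d e f g h i) = (- g) /ℕ 4
B₁ (mat _ _ _ d e f g h i) = (- h) /ℕ 4
C₁ (mat _ _ _ d e f g h i) = - i
A₂ (mat _ _ _ d e f g h i) = (- (d * h - e * g)) /ℕ 4
B₂ (mat _ _ _ d e f g h i) = (d * i - f * g) /ℕ 4
C₂ (mat _ _ _ d e f g h i) = - (e * i - f * h)

-- Only used for exact division by a nonzero integer; division by 0 is a
-- dummy value, reached only when A₁ = A₂ = 0.
infixl 7 _quot_

_quot_ : ℤ → ℤ → ℤ
x quot (+ 0)        = 0ℤ
x quot d@(+[1+ _ ]) = x / d
x quot d@(-[1+ _ ]) = x / d

S₃ wℓ : Matrix
S₃ = mat 1ℤ 0ℤ 0ℤ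
         0ℤ 1ℤ 0ℤ
         0ℤ 0ℤ -1ℤ
wℓ = mat 0ℤ 0ℤ  1ℤ
         0ℤ -1ℤ 0ℤ
         1ℤ 0ℤ  0ℤ

-- The value of s when A₁ > 0 and A₂/D is odd.
s-formula : Matrix → ℤ
s-formula γ =
    kronecker ε (- (A₁ γ * A₂ γ))
  * kronecker (A₁ γ quot D) (A₂ γ quot D)
  * kronecker (B₁ γ quot D₁) (A₁ γ quot D)
  * kronecker ((+ 4 * B₂ γ) quot D₂) (+ ∣ A₂ γ ∣ quot D)
  * kronecker D₁ (C₁ γ)
  * kronecker D₂ (C₂ γ)
  where
  D D₁ D₂ ε : ℤ
  D  = gcd (A₁ γ) (A₂ γ)
  D₁ = gcd D (B₁ γ)
  D₂ = D quot D₁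
  ε  = kronecker -1ℤ (B₁ γ quot D₁)

-- The value of s when A₁, A₂ ≠ 0 and A₂/D is odd, using s(S₃γS₃) = s(γ) to make A₁ positive.
s-odd : Matrix → ℤ
s-odd γ = if does (0ℤ ℤ.<? A₁ γ) then s-formula γ else s-formula (S₃ · γ · S₃)

-- The splitting on elements of Γ with A₁, A₂ ≠ 0; other values are dummies.
-- wℓ ᵗγ⁻¹ wℓ⁻¹ has A₁ and A₂ exchanged.  They cannot both be even after
-- division by D, so one of the two cases below always reduces to s-odd.
s : Matrix → ℤ
s γ =
  if does (+ 2 ∣? A₂ γ quot gcd (A₁ γ) (A₂ γ))
  then hilbertℝ (- A₁ γ) (- A₂ γ) * s-odd (wℓ · transpose (inv γ) · inv wℓ)
  else s-odd γ

record 𝕊 (a₁ a₂ : ℤ) (γ : Matrix) : Set where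
  field
    γ∈Γ  : Γ γ
    A₁≡a₁ : A₁ γ ≡ a₁
    A₂≡a₂ : A₂ γ ≡ a₂

_∼_ : Matrix → Matrix → Set
γ ∼ γ′ = ∃[ u ] ∃[ v ] Γ∞ u × Γ∞ v × γ′ ≡ u · γ · v

-- A finite list of matrices representing each double coset exactly once.
record Representatives (a₁ a₂ : ℤ) (γs : List Matrix) : Set where
  field
    sound       : All (𝕊 a₁ a₂) γs
    complete    : ∀ γ → 𝕊 a₁ a₂ γ → Any (_∼ γ) γs
    irredundant : AllPairs (λ γ γ′ → ¬ γ ∼ γ′) γs

infixl 7 _÷_

_÷_ : ℤ → (d : ℤ) → .{{ℤ.NonZero d}} → ℚ
n ÷ d = ((sign d ◃ 1) * n) ℚ./ ∣ d ∣

-- The algebraic properties of e(x) = exp(2πix) on ℚ; the intended instance is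
-- R = ℂ with this e.
record Exponential {c ℓ} (R : CommutativeRing c ℓ) : Set (c ⊔ ℓ) where
  open CommutativeRing R
    using (Carrier; _≈_; 1#) renaming (_*_ to _*ᴿ_; -_ to -ᴿ_)
  field
    e   : ℚ → Carrier
    e-+ : ∀ x y → e (x ℚ.+ y) ≈ e x *ᴿ e y
    e-1 : e 1ℚ ≈ 1#
    e-½ : e ½ ≈ -ᴿ 1#

module ExponentialSums {c ℓ} {R : CommutativeRing c ℓ} (E : Exponential R) where
  open CommutativeRing R
    using (Carrier; _≈_; 0#; 1#; +-rawMonoid)
    renaming (_+_ to _+ᴿ_; _*_ to _*ᴿ_; -_ to -ᴿ_)
  open import Algebra.Definitions.RawMonoid +-rawMonoid
    using () renaming (_×_ to _×ᴿ_)
  open Exponential E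

  -- The canonical map ℤ → R.
  ι : ℤ → Carrier
  ι (+ n)    = n ×ᴿ 1#
  ι -[1+ n ] = -ᴿ (suc n ×ᴿ 1#)

  δ : ∀ {p} {P : Set p} → Dec P → Carrier
  δ P? = if does P? then 1# else 0#

  sumOver : ∀ {a} {A : Set a} → List A → (A → Carrier) → Carrier
  sumOver xs f = foldr _+ᴿ_ 0# (map f xs)

  ∑₁ : ℕ → (ℕ → Carrier) → Carrier
  ∑₁ n = sumOver (map suc (upTo n))

  -- (ℤ/nℤ)ˣ is represented by the x in {0, …, n-1} coprime to n.
  g : ℤ → ℤ → (n : ℕ) → .{{ℕ.NonZero n}} → Carrier
  g d m n = sumOver (filter (λ x → coprime? x n) (upTo n)) λ x →
    ι (kronecker (+ x) d) *ᴿ e ((m * + x) ℚ./ n)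

  g₂ : ℤ → ℕ → Carrier
  g₂ m n = g (+ (2 ^ 2)) m (2 ^ n) {{2^n≢0 n}}

  module _ (a₁ a₂ : ℤ) .{{_ : ℤ.NonZero a₁}} .{{_ : ℤ.NonZero a₂}} (m₁ m₂ : ℤ) where

    Σ-term : Matrix → Carrier
    Σ-term γ =
      ι (s γ) *ᴿ e ((m₁ ℚ./ 1) ℚ.* (B₁ γ ÷ a₁) ℚ.+ (m₂ ℚ./ 1) ℚ.* (B₂ γ ÷ a₂))

    -- The sum Σ(a₁,a₂;m₁,m₂) is defined and has the value v: there are finitely
    -- many double cosets, and every choice of representatives gives v.
    Σ-HasValue : Carrier → Set ℓ
    Σ-HasValue v =
      (∃[ γs ] Representatives a₁ a₂ γs) ×
      (∀ γs → Representatives a₁ a₂ γs → sumOver γs Σ-term ≈ v)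

{-# OPTIONS --safe #-}

-- A double coset in 𝕊(2ᵏ, -2ᵏ) is determined by B₁ and B₂ modulo 2ᵏ with 2ᵏ | B₁B₂ and by
-- C₁ = 4c - 1 with c modulo 2ᵏ, since C₂ = C₁ - 4B₁B₂/2ᵏ.  If gcd(2ᵏ, B₁) = 2ᵃ, all factors of
-- the formula for s except the last two are 1, and the second supplementary law gives
-- s = (2/C₁)ᵃ (2/C₂)ᵏ⁻ᵃ = (-1)^(ck + (k - a)B₁B₂/2ᵏ).  The sum over c therefore vanishes for
-- odd k and is 2ᵏ for even k.  Writing B₁ = 2ᵃu with u odd and B₂ = 2ᵏ⁻ᵃt, the sum over u is
-- g(4, m₁, 2ᵏ⁻ᵃ), while the even t and the odd t yield the two sums over i = a; the terms with
-- B₁ = 0 and with B₁ odd give the first three summands.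

module Submission where

import Data.Integer.Properties as ℤ
import Data.Nat.Properties as ℕ

-- The values lie in an arbitrary commutative ring, possibly with zero divisors, so a complete
-- exponential sum cannot be shown to vanish by cancelling 1 - ζ. Such sums are halved instead: the
-- odd half is e(m/2ʲ⁺¹) times the even half, and this factor is -1 in the critical case.
--
-- Every list of representatives must give the same value. Each matrix therefore receives a `key`, a
-- triple of residues that is a complete invariant of its double coset. Any list of representatives
-- is carried by `key` to a permutation of one fixed list of triples, and the summand is a function
-- of the key. As C₁ alone is not invariant modulo 2ᵏ⁺², the key corrects it, and the sign has to be
-- shown to survive this correction.
--
-- The Kronecker symbol is defined through factorisation and a search for square roots, so (2/p) has
-- to be determined. That 2 is a residue for p ≡ ±1 mod 8 follows by computing 2^((p-1)/2) and
-- comparing with Euler's criterion. That it is a nonresidue for p ≡ ±3 follows by descent, which is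
-- run over all moduli n ≡ ±3 mod 8 because the cofactors it produces need not be prime.

module Arithmetic where

  open import Algebra.Properties.AbelianGroup ℤ.+-0-abelianGroup using () renaming (∙-cancelˡ to +-cancelˡ)
  open import Data.Bool.Base using (true; false; if_then_else_)
  open import Data.Fin.Base using (Fin; toℕ; fromℕ<)
  open import Data.Fin.Properties using (toℕ-fromℕ<; all?; any?)
  open import Data.Integer.Base as ℤ
    using (ℤ; +_; -[1+_]; 0ℤ; 1ℤ; -1ℤ; ∣_∣; _+_; _*_; _-_; -_; _^_; _/ℕ_; _%ℕ_)
  open import Data.Integer.Divisibility.Signed
  open import Data.Integer.DivMod using (div-pos-is-/ℕ; n%ℕd<d; a≡a%ℕn+[a/ℕn]*n)
  open import Data.Integer.GCD using (gcd)
  open import Data.Integer.Tactic.RingSolver using (solve-∀)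
  open import Data.List.Base
    using (List; []; _∷_; _++_; length; map; foldr; filter; applyDownFrom; upTo; cartesianProduct)
  open import Data.List.Membership.Propositional using (_∈_; lose; find)
  open import Data.List.Membership.Propositional.Properties
    using ( ∈-∃++; ∈-applyDownFrom⁺; ∈-applyDownFrom⁻; ∈-filter⁺; ∈-filter⁻; ∈-upTo⁺; ∈-upTo⁻
          ; ∈-cartesianProduct⁺; ∈-cartesianProduct⁻; ∈-map⁺; ∈-map⁻ )
  open import Data.List.Membership.Propositional.Properties.WithK using (unique∧set⇒bag)
  open import Data.List.Properties using (length-applyDownFrom)
  open import Data.List.Relation.Binary.BagAndSetEquality using (∼bag⇒↭)
  open import Data.List.Relation.Binary.Permutation.Propositional using (_↭_; prep; ↭-sym; ↭⇒↭ₛ)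
  open import Data.List.Relation.Binary.Permutation.Propositional.Properties
    using (∈-resp-↭; ↭-length; shift)
  import Data.List.Relation.Binary.Permutation.Setoid.Properties as Permutationₛ
  open import Data.List.Relation.Unary.All as All using (All; []; _∷_; lookup)
  import Data.List.Relation.Unary.All.Properties as All
  open import Data.List.Relation.Unary.AllPairs using (AllPairs; []; _∷_)
  import Data.List.Relation.Unary.AllPairs.Properties as AllPairs
  open import Data.List.Relation.Unary.Any using (here; there)
  import Data.List.Relation.Unary.Any.Properties as Any
  open import Data.List.Relation.Unary.Unique.Propositional using (Unique)
  import Data.List.Relation.Unary.Unique.Propositional.Properties as Unique
  open import Data.Nat.Base as ℕ using (ℕ; zero; suc; s≤s; z≤n; _!; _%_)
  open import Data.Nat.Coprimality as Coprimality
    using (Coprime; coprime-divisor; prime⇒coprime; coprime-Bézout)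
  import Data.Nat.Divisibility as ℕ∣
  open import Data.Nat.DivMod
    using (m%n<n; %-distribˡ-*; %-distribˡ-+; m≡m%n+[m/n]*n; [m+n]%n≡m%n; m*[n/m]≡n)
  open import Data.Nat.GCD as ℕ using (module Bézout)
  open import Data.Nat.Induction using (<-rec)
  open import Data.Nat.ListAction using (product)
  open import Data.Nat.ListAction.Properties using (product-↭)
  open import Data.Nat.Primality
    using (Prime; prime?; euclidsLemma; prime⇒nonZero; prime⇒nonTrivial; prime⇒irreducible)
  open import Data.Nat.Primality.Factorisation using (factorise; factors; module PrimeFactorisation)
  import Data.Nat.Tactic.RingSolver as ℕ-Solver
  open import Data.Product.Base using (∃-syntax; _×_; _,_; proj₁; proj₂)
  open import Data.Sum.Base using (_⊎_; inj₁; inj₂)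
  open import Defs
  open import Function.Base using (_∘_)
  open import Function.Bundles using (mk⇔)
  open import Relation.Binary.Definitions using (tri<; tri≈; tri>)
  open import Relation.Binary.PropositionalEquality
  open import Relation.Nullary.Decidable
    using (Dec; yes; no; does; dec-true; dec-false; decidable-stable; _→-dec_; _⊎-dec_; from-yes)
  open import Relation.Nullary.Negation using (¬_; contradiction)

  -- Congruences

  infix 4 _≡_[mod_]

  -- A record instead of a synonym for `+ n ∣ a - b`, since unification cannot recover `a` and `b`
  -- from their difference.
  record _≡_[mod_] (a b : ℤ) (n : ℕ) : Set where
    constructor congruent
    field
      difference : + n ∣ a - b

  open _≡_[mod_] public

  module _ {n : ℕ} where

    ≡-mod : ∀ {a b} → a ≡ b → a ≡ b [mod n ]
    ≡-mod {a} refl = congruent (divides 0ℤ (ℤ.+-inverseʳ a))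

    mod-refl : ∀ {a} → a ≡ a [mod n ]
    mod-refl = ≡-mod refl

    mod-sym : ∀ {a b} → a ≡ b [mod n ] → b ≡ a [mod n ]
    mod-sym {a} {b} (congruent h) = congruent (subst (+ n ∣_) (lemma a b) (∣m⇒∣-m h))
      where lemma : ∀ a b → - (a - b) ≡ b - a
            lemma = solve-∀

    mod-trans : ∀ {a b c} → a ≡ b [mod n ] → b ≡ c [mod n ] → a ≡ c [mod n ]
    mod-trans {a} {b} {c} (congruent h₁) (congruent h₂) =
      congruent (subst (+ n ∣_) (lemma a b c) (∣m∣n⇒∣m+n h₁ h₂))
      where lemma : ∀ a b c → (a - b) + (b - c) ≡ a - c
            lemma = solve-∀

    mod-* : ∀ {a b c d} → a ≡ b [mod n ] → c ≡ d [mod n ] → a * c ≡ b * d [mod n ]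
    mod-* {a} {b} {c} {d} (congruent h₁) (congruent h₂) =
      congruent (subst (+ n ∣_) (lemma a b c d) (∣m∣n⇒∣m+n (∣m⇒∣m*n c h₁) (∣n⇒∣m*n b h₂)))
      where lemma : ∀ a b c d → (a - b) * c + b * (c - d) ≡ a * c - b * d
            lemma = solve-∀

    mod-*ˡ : ∀ a {b c} → b ≡ c [mod n ] → a * b ≡ a * c [mod n ]
    mod-*ˡ a = mod-* (mod-refl {a})

    mod-+ : ∀ {a b c d} → a ≡ b [mod n ] → c ≡ d [mod n ] → a + c ≡ b + d [mod n ]
    mod-+ {a} {b} {c} {d} (congruent h₁) (congruent h₂) =
      congruent (subst (+ n ∣_) (lemma a b c d) (∣m∣n⇒∣m+n h₁ h₂))
      where lemma : ∀ a b c d → (a - b) + (c - d) ≡ a + c - (b + d)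
            lemma = solve-∀

    mod-^ : ∀ {a b} m → a ≡ b [mod n ] → a ^ m ≡ b ^ m [mod n ]
    mod-^ zero    h = mod-refl
    mod-^ (suc m) h = mod-* h (mod-^ m h)

    ∣⇒≡0 : ∀ {a} → + n ∣ a → a ≡ 0ℤ [mod n ]
    ∣⇒≡0 {a} h = congruent (subst (+ n ∣_) (sym (ℤ.+-identityʳ a)) h)

    ≡0⇒∣ : ∀ {a} → a ≡ 0ℤ [mod n ] → + n ∣ a
    ≡0⇒∣ {a} (congruent h) = subst (+ n ∣_) (ℤ.+-identityʳ a) h

    %ℕ-mod : .{{_ : ℕ.NonZero n}} → ∀ a → + (a %ℕ n) ≡ a [mod n ]
    %ℕ-mod a = congruent (divides (- (a ℤ./ℕ n))
      (trans (cong (_-_ (+ (a %ℕ n))) (a≡a%ℕn+[a/ℕn]*n a n)) (lemma (+ (a %ℕ n)) (a ℤ./ℕ n) (+ n))))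
      where lemma : ∀ r q m → r - (r + q * m) ≡ - q * m
            lemma = solve-∀

    positive⇒≢0 : ∀ {x} → 0 ℕ.< x → x ℕ.< n → ¬ + x ≡ 0ℤ [mod n ]
    positive⇒≢0 {suc x} _ x<n h = ℕ∣.>⇒∤ x<n (∣⇒∣ᵤ (≡0⇒∣ h))

    mod-injective-≤ : ∀ {x y} → y ℕ.< n → x ℕ.≤ y → + x ≡ + y [mod n ] → x ≡ y
    mod-injective-≤ {x} {y} y<n x≤y h with ℕ.m≤n⇒∃[o]m+o≡n x≤y
    ... | zero , refl = sym (ℕ.+-identityʳ x)
    ... | suc o , refl = contradiction
      (∣⇒≡0 (subst (+ n ∣_) (lemma (+ x) (+ suc o)) (difference (mod-sym h))))
      (positive⇒≢0 (s≤s z≤n) (ℕ.≤-<-trans (ℕ.m≤n+m (suc o) x) y<n))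
      where lemma : ∀ a b → (a + b) - a ≡ b
            lemma = solve-∀

    mod-injective : ∀ {x y} → x ℕ.< n → y ℕ.< n → + x ≡ + y [mod n ] → x ≡ y
    mod-injective {x} {y} x<n y<n h with ℕ.≤-total x y
    ... | inj₁ x≤y = mod-injective-≤ y<n x≤y h
    ... | inj₂ y≤x = sym (mod-injective-≤ x<n y≤x (mod-sym h))

  module _ {p : ℕ} (pr : Prime p) where

    private instance
      _ = prime⇒nonZero pr

    abstract

      mod-integral : ∀ a b → a * b ≡ 0ℤ [mod p ] → a ≡ 0ℤ [mod p ] ⊎ b ≡ 0ℤ [mod p ]
      mod-integral a b h
        with euclidsLemma ∣ a ∣ ∣ b ∣ pr (subst (p ℕ∣.∣_) (ℤ.abs-* a b) (∣⇒∣ᵤ (≡0⇒∣ h)))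
      ... | inj₁ p∣a = inj₁ (∣⇒≡0 (∣ᵤ⇒∣ p∣a))
      ... | inj₂ p∣b = inj₂ (∣⇒≡0 (∣ᵤ⇒∣ p∣b))

      mod-cancelˡ : ∀ a {b c} → ¬ a ≡ 0ℤ [mod p ] → a * b ≡ a * c [mod p ] → b ≡ c [mod p ]
      mod-cancelˡ a {b} {c} a≢0 (congruent h)
        with mod-integral a (b - c) (∣⇒≡0 (subst (+ p ∣_) (lemma a b c) h))
        where lemma : ∀ a b c → a * b - a * c ≡ a * (b - c)
              lemma = solve-∀
      ... | inj₁ a≡0 = contradiction a≡0 a≢0
      ... | inj₂ b≡c = congruent (≡0⇒∣ b≡c)

      mod-inverse : ∀ {x} → 0 ℕ.< x → x ℕ.< p → ∃[ u ] + x * u ≡ 1ℤ [mod p ]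
      mod-inverse {suc x} _ x<p with coprime-Bézout (prime⇒coprime pr x<p)
      -- Bézout over ℕ comes in two sign cases: 1 + jx = ip here, and 1 + ip = jx below.
      ... | Bézout.+- i j eq = - + j , congruent (divides (- + i)
        (trans (lemma (+ suc x) (+ j))
          (trans (cong -_ (trans (cong (_+_ 1ℤ) (sym (ℤ.pos-* j (suc x)))) (trans (cong +_ eq) (ℤ.pos-* i p))))
            (ℤ.neg-distribˡ-* (+ i) (+ p)))))
        where lemma : ∀ x j → x * - j - 1ℤ ≡ - (1ℤ + j * x)
              lemma = solve-∀
      ... | Bézout.-+ i j eq = + j , congruent (divides (+ i)
        (trans (cong (_- 1ℤ) (trans (sym (ℤ.pos-* (suc x) j)) (cong +_ (trans (ℕ.*-comm (suc x) j) (sym eq)))))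
          (trans (cong (λ z → 1ℤ + z - 1ℤ) (ℤ.pos-* i p)) (lemma (+ i * + p)))))
        where lemma : ∀ z → 1ℤ + z - 1ℤ ≡ z
              lemma = solve-∀

      mod-divide : ∀ {x} → 0 ℕ.< x → x ℕ.< p → ∀ a → ∃[ y ] y ℕ.< p × + x * + y ≡ a [mod p ]
      mod-divide {x} 0<x x<p a with u , xu≡1 ← mod-inverse 0<x x<p =
        (u * a) %ℕ p , n%ℕd<d (u * a) p ,
        mod-trans (mod-*ˡ (+ x) (%ℕ-mod (u * a)))
          (mod-trans (≡-mod (sym (ℤ.*-assoc (+ x) u a)))
            (mod-trans (mod-* xu≡1 mod-refl) (≡-mod (ℤ.*-identityˡ a))))

  -- Removing the pairs {x, a / x} one after the other contributes a factor a each time.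
  product-of-pairs :
    ∀ {n a} h {xs} → Unique xs → length xs ≡ h ℕ.+ h →
    (∀ {x} → x ∈ xs → ∃[ y ] y ∈ xs × y ≢ x × + x * + y ≡ a [mod n ]) →
    (∀ {x y z} → x ∈ xs → y ∈ xs → z ∈ xs →
      + x * + y ≡ a [mod n ] → + x * + z ≡ a [mod n ] → y ≡ z) →
    + product xs ≡ a ^ h [mod n ]
  product-of-pairs zero    {[]}     _ _ _ _ = mod-refl
  product-of-pairs zero    {x ∷ xs} _ () _ _
  product-of-pairs (suc h) {[]}     _ () _ _
  product-of-pairs {n} {a} (suc h) {x ∷ xs} unique len pair cancel
    with pair (here refl)
  ... | y , here refl , y≢x , _ = contradiction refl y≢x
  ... | y , there y∈xs , y≢x , xy≡a with ∈-∃++ y∈xs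
  ... | us , vs , refl =
    mod-trans (≡-mod product≡) (mod-* xy≡a (product-of-pairs h unique′ len′ pair′ cancel′))
    where
    ws = us ++ vs
    perm : x ∷ us ++ y ∷ vs ↭ x ∷ y ∷ ws
    perm = prep x (shift y us vs)
    product≡ : + product (x ∷ us ++ y ∷ vs) ≡ + x * + y * + product ws
    product≡ = trans (cong +_ (trans (product-↭ perm) (sym (ℕ.*-assoc x y (product ws)))))
      (trans (ℤ.pos-* (x ℕ.* y) (product ws)) (cong (_* + product ws) (ℤ.pos-* x y)))
    unique₂ : Unique (x ∷ y ∷ ws)
    unique₂ = Permutationₛ.Unique-resp-↭ (setoid ℕ) (↭⇒↭ₛ perm) unique
    unique′ : Unique ws
    unique′ with _ ∷ (_ ∷ u) ← unique₂ = u
    len′ : length ws ≡ h ℕ.+ h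
    len′ = ℕ.suc-injective (ℕ.suc-injective
      (trans (sym (↭-length perm)) (trans len (cong suc (ℕ.+-suc h h)))))
    ∈ws⇒∈ : ∀ {z} → z ∈ ws → z ∈ x ∷ us ++ y ∷ vs
    ∈ws⇒∈ z∈ws = ∈-resp-↭ (↭-sym perm) (there (there z∈ws))
    swap : ∀ u v → + u * + v ≡ a [mod n ] → + v * + u ≡ a [mod n ]
    swap u v = mod-trans (≡-mod (ℤ.*-comm (+ v) (+ u)))
    pair′ : ∀ {z} → z ∈ ws → ∃[ w ] w ∈ ws × w ≢ z × + z * + w ≡ a [mod n ]
    pair′ {z} z∈ws with pair (∈ws⇒∈ z∈ws)
    ... | w , w∈ , w≢z , zw≡a with ∈-resp-↭ perm w∈
    ... | there (there w∈ws) = w , w∈ws , w≢z , zw≡a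
    -- If the partner of `z` were `x` or `y`, cancellation would identify `z` with the other of the
    -- two, which uniqueness excludes.
    ... | here refl = contradiction
      (cancel (here refl) (there y∈xs) (∈ws⇒∈ z∈ws) xy≡a (swap z x zw≡a))
      (lookup (y∉ unique₂) z∈ws)
      where y∉ : ∀ {x y ws} → Unique (x ∷ y ∷ ws) → _
            y∉ (_ ∷ (q ∷ _)) = q
    ... | there (here refl) = contradiction
      (cancel (there y∈xs) (here refl) (∈ws⇒∈ z∈ws) (swap x y xy≡a) (swap z y zw≡a))
      (lookup (x∉ unique₂) (there z∈ws))
      where x∉ : ∀ {x ws} → Unique (x ∷ ws) → _
            x∉ (q ∷ _) = q
    cancel′ : ∀ {u v w} → u ∈ ws → v ∈ ws → w ∈ ws →
      + u * + v ≡ a [mod n ] → + u * + w ≡ a [mod n ] → v ≡ w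
    cancel′ u v w = cancel (∈ws⇒∈ u) (∈ws⇒∈ v) (∈ws⇒∈ w)

  -- Euler's criterion

  ∈-range⁺ : ∀ {j n} c → c ℕ.≤ j → j ℕ.< c ℕ.+ n → j ∈ applyDownFrom (c ℕ.+_) n
  ∈-range⁺ c c≤j j<c+n with ℕ.m≤n⇒∃[o]m+o≡n c≤j
  ... | o , refl = ∈-applyDownFrom⁺ (c ℕ.+_) (ℕ.+-cancelˡ-< c _ _ j<c+n)

  ∈-range⁻ : ∀ {j n} c → j ∈ applyDownFrom (c ℕ.+_) n → c ℕ.≤ j × j ℕ.< c ℕ.+ n
  ∈-range⁻ c j∈ with i , i<n , refl ← ∈-applyDownFrom⁻ (c ℕ.+_) j∈ =
    ℕ.m≤m+n c i , ℕ.+-monoʳ-< c i<n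

  range-unique : ∀ c n → Unique (applyDownFrom (c ℕ.+_) n)
  range-unique c n = Unique.applyDownFrom⁺₁ (c ℕ.+_) n λ j<i _ eq → ℕ.<⇒≢ j<i (sym (ℕ.+-cancelˡ-≡ c _ _ eq))

  product-range₁ : ∀ n → product (applyDownFrom (1 ℕ.+_) n) ≡ n !
  product-range₁ zero    = refl
  product-range₁ (suc n) = cong (suc n ℕ.*_) (product-range₁ n)

  product-range₂ : ∀ n → product (applyDownFrom (2 ℕ.+_) n) ≡ suc n !
  product-range₂ zero    = refl
  product-range₂ (suc n) = cong (suc (suc n) ℕ.*_) (product-range₂ n)

  1^n≡1 : ∀ n → 1ℤ ^ n ≡ 1ℤ
  1^n≡1 zero    = refl
  1^n≡1 (suc n) = trans (ℤ.*-identityˡ (1ℤ ^ n)) (1^n≡1 n)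

  -- Modulo a prime, x² = 1 forces x = ±1, so 2, ..., p - 2 fall into `h` pairs of distinct mutual
  -- inverses. Only the factor p - 1 ≡ -1 of the factorial remains.
  wilson : ∀ {p} (pr : Prime p) h → p ≡ 3 ℕ.+ (h ℕ.+ h) → + ((p ℕ.∸ 1) !) ≡ -1ℤ [mod p ]
  wilson {p} pr h refl = result
    where
    n = h ℕ.+ h
    xs = applyDownFrom (2 ℕ.+_) n
    2+n≡-1 : + (2 ℕ.+ n) ≡ -1ℤ [mod p ]
    2+n≡-1 = congruent (subst (+ p ∣_) (trans (cong +_ (ℕ.+-comm 1 (2 ℕ.+ n))) (ℤ.pos-+ (2 ℕ.+ n) 1)) ∣-refl)
    <p : ∀ {x} → x ∈ xs → x ℕ.< p
    <p x∈ = ℕ.m<n⇒m<1+n (proj₂ (∈-range⁻ 2 x∈))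
    pos : ∀ {x} → x ∈ xs → 0 ℕ.< x
    pos x∈ = ℕ.<-trans (s≤s z≤n) (proj₁ (∈-range⁻ 2 x∈))
    x≢±1 : ∀ {x} → x ∈ xs → ¬ + x ≡ 1ℤ [mod p ] × ¬ + x ≡ -1ℤ [mod p ]
    x≢±1 {x} x∈ =
      (λ x≡1 → ℕ.<⇒≢ (proj₁ (∈-range⁻ 2 x∈)) (sym (mod-injective (<p x∈) (s≤s (s≤s z≤n)) x≡1))) ,
      (λ x≡-1 → ℕ.<⇒≢ (proj₂ (∈-range⁻ 2 x∈))
        (mod-injective (<p x∈) ℕ.≤-refl (mod-trans x≡-1 (mod-sym 2+n≡-1))))
    pair : ∀ {x} → x ∈ xs → ∃[ y ] y ∈ xs × y ≢ x × + x * + y ≡ 1ℤ [mod p ]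
    pair {x} x∈ with mod-divide pr (pos x∈) (<p x∈) 1ℤ
    ... | 0 , _ , x0≡1 = contradiction (mod-trans (≡-mod (sym (ℤ.*-zeroʳ (+ x)))) x0≡1)
      (positive⇒≢0 {x = 1} (s≤s z≤n) (s≤s (s≤s z≤n)) ∘ mod-sym)
    ... | 1 , _ , x1≡1 =
      contradiction (mod-trans (≡-mod (sym (ℤ.*-identityʳ (+ x)))) x1≡1) (proj₁ (x≢±1 x∈))
    ... | y@(suc (suc _)) , y<p , xy≡1 = y , ∈-range⁺ 2 (s≤s (s≤s z≤n)) y<2+n , y≢x , xy≡1
      where
      y<2+n : y ℕ.< 2 ℕ.+ n
      y<2+n = ℕ.≤∧≢⇒< (ℕ.≤-pred y<p) λ y≡2+n → proj₂ (x≢±1 x∈)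
        (mod-trans (≡-mod (lemma (+ x)))
          (mod-* {c = -1ℤ} (mod-trans (mod-*ˡ (+ x) (mod-trans (mod-sym 2+n≡-1) (≡-mod (cong +_ (sym y≡2+n))))) xy≡1)
            mod-refl))
        where lemma : ∀ x → x ≡ x * -1ℤ * -1ℤ
              lemma = solve-∀
      y≢x : y ≢ x
      y≢x refl with mod-integral pr (+ x - 1ℤ) (+ x + 1ℤ)
                      (mod-trans (≡-mod (lemma (+ x))) (mod-trans (mod-+ xy≡1 (mod-refl {a = -1ℤ})) mod-refl))
        where lemma : ∀ x → (x - 1ℤ) * (x + 1ℤ) ≡ x * x + -1ℤ
              lemma = solve-∀
      ... | inj₁ h = proj₁ (x≢±1 x∈) (congruent (≡0⇒∣ h))
      ... | inj₂ h = proj₂ (x≢±1 x∈) (congruent (≡0⇒∣ h))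
    cancel : ∀ {x y z} → x ∈ xs → y ∈ xs → z ∈ xs →
      + x * + y ≡ 1ℤ [mod p ] → + x * + z ≡ 1ℤ [mod p ] → y ≡ z
    cancel {x} x∈ y∈ z∈ xy≡1 xz≡1 = mod-injective (<p y∈) (<p z∈)
      (mod-cancelˡ pr (+ x) (positive⇒≢0 (pos x∈) (<p x∈)) (mod-trans xy≡1 (mod-sym xz≡1)))
    [1+n]!≡1 : + (suc n !) ≡ 1ℤ [mod p ]
    [1+n]!≡1 = mod-trans (≡-mod (cong +_ (sym (product-range₂ n))))
      (mod-trans (product-of-pairs h (range-unique 2 n) (length-applyDownFrom _ n) pair cancel)
        (≡-mod (1^n≡1 h)))
    result : + ((2 ℕ.+ n) !) ≡ -1ℤ [mod p ]
    result = mod-trans (≡-mod (ℤ.pos-* (2 ℕ.+ n) (suc n !))) (mod-* 2+n≡-1 [1+n]!≡1)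

  -- No x equals a/x when `a` is a nonresidue, so 1, ..., p - 1 fall into (p - 1)/2 = `suc h` pairs
  -- with product `a`. Their total product is (p - 1)!, which Wilson's theorem evaluates.
  euler : ∀ {p} (pr : Prime p) h → p ≡ 3 ℕ.+ (h ℕ.+ h) → ∀ {a} → ¬ a ≡ 0ℤ [mod p ] →
    (∀ x → x ℕ.< p → ¬ + x * + x ≡ a [mod p ]) → a ^ suc h ≡ -1ℤ [mod p ]
  euler {p} pr h refl {a} a≢0 nonresidue = mod-trans
    (mod-sym (product-of-pairs (suc h) (range-unique 1 n)
      (trans (length-applyDownFrom _ n) (cong suc (sym (ℕ.+-suc h h)))) pair cancel))
    (mod-trans (≡-mod (cong +_ (product-range₁ n))) (wilson pr h refl))
    where
    n = 2 ℕ.+ (h ℕ.+ h)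
    xs = applyDownFrom (1 ℕ.+_) n
    <p : ∀ {x} → x ∈ xs → x ℕ.< p
    <p x∈ = proj₂ (∈-range⁻ 1 x∈)
    pos : ∀ {x} → x ∈ xs → 0 ℕ.< x
    pos x∈ = proj₁ (∈-range⁻ 1 x∈)
    pair : ∀ {x} → x ∈ xs → ∃[ y ] y ∈ xs × y ≢ x × + x * + y ≡ a [mod p ]
    pair {x} x∈ with mod-divide pr (pos x∈) (<p x∈) a
    ... | zero , _ , x0≡a =
      contradiction (mod-trans (mod-sym x0≡a) (≡-mod (ℤ.*-zeroʳ (+ x)))) a≢0
    ... | y@(suc _) , y<p , xy≡a =
      y , ∈-range⁺ 1 (s≤s z≤n) y<p , (λ { refl → nonresidue x y<p xy≡a }) , xy≡a
    cancel : ∀ {x y z} → x ∈ xs → y ∈ xs → z ∈ xs →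
      + x * + y ≡ a [mod p ] → + x * + z ≡ a [mod p ] → y ≡ z
    cancel {x} x∈ y∈ z∈ xy≡a xz≡a = mod-injective (<p y∈) (<p z∈)
      (mod-cancelˡ pr (+ x) (positive⇒≢0 (pos x∈) (<p x∈)) (mod-trans xy≡a (mod-sym xz≡a)))

  -- Double factorials and the power 2^((p-1)/2) modulo p

  evens odds : ℕ → ℤ
  evens zero    = 1ℤ
  evens (suc n) = evens n * (+ 2 * + suc n)
  odds zero    = 1ℤ
  odds (suc n) = odds n * (1ℤ + + 2 * + n)

  factorial : ∀ n → + (suc n !) ≡ + suc n * + (n !)
  factorial n = ℤ.pos-* (suc n) (n !)

  evens≡2^n*n! : ∀ n → evens n ≡ (+ 2) ^ n * + (n !)
  evens≡2^n*n! zero    = refl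
  evens≡2^n*n! (suc n) = trans (cong (_* (+ 2 * + suc n)) (evens≡2^n*n! n))
    (trans (lemma (+ 2) ((+ 2) ^ n) (+ (n !)) (+ suc n))
      (cong ((+ 2) ^ suc n *_) (sym (factorial n))))
    where lemma : ∀ a b c d → b * c * (a * d) ≡ a * b * (d * c)
          lemma = solve-∀

  evens*odds : ∀ n → evens n * odds n ≡ + ((n ℕ.+ n) !)
  evens*odds zero    = refl
  evens*odds (suc n) = trans (lemma (evens n) (odds n) (+ n))
    (trans (cong (λ z → (1ℤ + (1ℤ + (+ n + + n))) * ((1ℤ + (+ n + + n)) * z)) (evens*odds n))
      (trans (cong ((1ℤ + (1ℤ + (+ n + + n))) *_) (sym (factorial (n ℕ.+ n))))
        (trans (sym (factorial (suc (n ℕ.+ n)))) (cong (λ m → + (suc m !)) (sym (ℕ.+-suc n n))))))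
    where lemma : ∀ e o n → e * (+ 2 * (1ℤ + n)) * (o * (1ℤ + + 2 * n)) ≡
                    (1ℤ + (1ℤ + (n + n))) * ((1ℤ + (n + n)) * (e * o))
          lemma = solve-∀

  evens*odds⁺ : ∀ n → evens n * odds (suc n) ≡ + (suc (n ℕ.+ n) !)
  evens*odds⁺ n = trans (lemma (evens n) (odds n) (+ n))
    (trans (cong ((1ℤ + (+ n + + n)) *_) (evens*odds n)) (sym (factorial (n ℕ.+ n))))
    where lemma : ∀ e o n → e * (o * (1ℤ + + 2 * n)) ≡ (1ℤ + (n + n)) * (e * o)
          lemma = solve-∀

  -- The even numbers 2i above p/2 are, up to sign, the odd numbers p - 2i below it.
  evens-reflect : ∀ {p} n j → + p ≡ 1ℤ + + 2 * (+ n + + j) →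
    evens (n ℕ.+ j) ≡ evens n * (-1ℤ ^ j * odds j) [mod p ]
  evens-reflect n zero _ = ≡-mod (trans (cong evens (ℕ.+-identityʳ n)) (sym (ℤ.*-identityʳ (evens n))))
  evens-reflect {p} n (suc j) eq = mod-trans (≡-mod (cong evens (ℕ.+-suc n j)))
    (mod-trans (evens-reflect (suc n) j (trans eq (reindex (+ n) (+ j))))
      (mod-trans (mod-* {c = -1ℤ ^ j * odds j} (mod-*ˡ (evens n) reflect) mod-refl)
        (≡-mod (lemma (evens n) (+ j) (-1ℤ ^ j) (odds j)))))
    where
    reindex : ∀ n j → 1ℤ + + 2 * (n + (1ℤ + j)) ≡ 1ℤ + + 2 * ((1ℤ + n) + j)
    reindex = solve-∀
    reflect : + 2 * + suc n ≡ -1ℤ * (1ℤ + + 2 * + j) [mod p ]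
    reflect = congruent (subst (+ p ∣_) (trans eq (twice (+ n) (+ j))) ∣-refl)
      where twice : ∀ n j → 1ℤ + + 2 * (n + (1ℤ + j)) ≡ + 2 * (1ℤ + n) - -1ℤ * (1ℤ + + 2 * j)
            twice = solve-∀
    lemma : ∀ e j s o → e * (-1ℤ * (1ℤ + + 2 * j)) * (s * o) ≡ e * (-1ℤ * s * (o * (1ℤ + + 2 * j)))
    lemma = solve-∀

  [-1]^2m≡1 : ∀ m → -1ℤ ^ (m ℕ.+ m) ≡ 1ℤ
  [-1]^2m≡1 m = trans (ℤ.^-distribˡ-+-* -1ℤ m m) (square m)
    where square : ∀ m → -1ℤ ^ m * -1ℤ ^ m ≡ 1ℤ
          square zero    = refl
          square (suc m) = trans (lemma (-1ℤ ^ m)) (square m)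
            where lemma : ∀ x → (-1ℤ * x) * (-1ℤ * x) ≡ x * x
                  lemma = solve-∀

  factorial≢0 : ∀ {p} (pr : Prime p) n → n ℕ.< p → ¬ + (n !) ≡ 0ℤ [mod p ]
  factorial≢0 pr zero    _   = positive⇒≢0 (s≤s z≤n) (ℕ.nonTrivial⇒n>1 _ {{prime⇒nonTrivial pr}})
  factorial≢0 pr (suc n) n<p h
    with mod-integral pr (+ suc n) (+ (n !)) (mod-trans (≡-mod (sym (factorial n))) h)
  ... | inj₁ h′ = positive⇒≢0 (s≤s z≤n) n<p h′
  ... | inj₂ h′ = factorial≢0 pr n (ℕ.<-trans ℕ.≤-refl n<p) h′

  -- Put j = m + m and h = n + j = (p - 1)/2. Then 2ʰ h! = `evens h` ≡ `evens n * odds j`, the sign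
  -- of the reflection being 1 because j is even. By hypothesis the right side is h! again, and h!
  -- is invertible modulo p.
  2^[n+j]≡1 : ∀ {p} (pr : Prime p) n m → + p ≡ 1ℤ + + 2 * (+ n + + (m ℕ.+ m)) →
    evens n * odds (m ℕ.+ m) ≡ + ((n ℕ.+ (m ℕ.+ m)) !) → (+ 2) ^ (n ℕ.+ (m ℕ.+ m)) ≡ 1ℤ [mod p ]
  2^[n+j]≡1 {p} pr n m eq product≡ = mod-cancelˡ pr (+ (h !)) (factorial≢0 pr h h<p)
    (mod-trans (≡-mod (trans (ℤ.*-comm (+ (h !)) ((+ 2) ^ h)) (sym (evens≡2^n*n! h))))
      (mod-trans (evens-reflect n j eq)
        (≡-mod (trans (cong (λ s → evens n * (s * odds j)) ([-1]^2m≡1 m))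
          (trans (cong (evens n *_) (ℤ.*-identityˡ (odds j)))
            (trans product≡ (sym (ℤ.*-identityʳ (+ (h !))))))))))
    where
    j = m ℕ.+ m
    h = n ℕ.+ j
    p≡ : p ≡ suc (2 ℕ.* h)
    p≡ = ℤ.+-injective (trans eq (cong (_+_ 1ℤ) (sym (ℤ.pos-* 2 h))))
    h<p : h ℕ.< p
    h<p = subst (h ℕ.<_) (sym p≡) (s≤s (ℕ.m≤m+n h (h ℕ.+ 0)))

  -- The second supplementary law

  -- The even primitive character modulo 8, which the rest of this part identifies with (2/·).
  χ₈-table : ℕ → ℤ
  χ₈-table 1 = 1ℤ
  χ₈-table 3 = -1ℤ
  χ₈-table 5 = -1ℤ
  χ₈-table 7 = 1ℤ
  χ₈-table _ = 0ℤ

  χ₈ : ℕ → ℤ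
  χ₈ n = χ₈-table (n % 8)

  -- Transfers a decision over `Fin m` to residues below `m`, so that identities modulo 8 are
  -- settled by evaluating a finite table.
  below : ∀ {m} {P : ℕ → Set} → (∀ (i : Fin m) → P (toℕ i)) → ∀ {n} → n ℕ.< m → P n
  below {P = P} f n<m = subst P (toℕ-fromℕ< n<m) (f (fromℕ< n<m))

  χ₈-* : ∀ m n → χ₈ (m ℕ.* n) ≡ χ₈ m * χ₈ n
  χ₈-* m n = trans (cong χ₈-table (%-distribˡ-* m n 8))
    (below {P = λ r → χ₈-table ((m % 8 ℕ.* r) % 8) ≡ χ₈ m * χ₈-table r}
      (λ j → below {P = λ r → χ₈-table ((r ℕ.* toℕ j) % 8) ≡ χ₈-table r * χ₈-table (toℕ j)}
        (λ i → table i j) (m%n<n m 8))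
      (m%n<n n 8))
    where
    table : ∀ (i j : Fin 8) →
      χ₈-table ((toℕ i ℕ.* toℕ j) % 8) ≡ χ₈-table (toℕ i) * χ₈-table (toℕ j)
    table = from-yes (all? λ (i : Fin 8) → all? λ (j : Fin 8) →
      χ₈-table ((toℕ i ℕ.* toℕ j) % 8) ℤ.≟ χ₈-table (toℕ i) * χ₈-table (toℕ j))

  χ₈-even : ∀ w → χ₈ (w ℕ.+ w) ≡ 0ℤ
  χ₈-even w = trans (cong χ₈-table (%-distribˡ-+ w w 8))
    (below {P = λ r → χ₈-table ((r ℕ.+ r) % 8) ≡ 0ℤ} table (m%n<n w 8))
    where
    table : ∀ (i : Fin 8) → χ₈-table ((toℕ i ℕ.+ toℕ i) % 8) ≡ 0ℤ
    table = from-yes (all? λ (i : Fin 8) → χ₈-table ((toℕ i ℕ.+ toℕ i) % 8) ℤ.≟ 0ℤ)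

  χ₈-odd : ∀ w → χ₈ (suc (w ℕ.+ w)) ≡ 1ℤ ⊎ χ₈ (suc (w ℕ.+ w)) ≡ -1ℤ
  χ₈-odd w = subst (λ r → χ₈-table r ≡ 1ℤ ⊎ χ₈-table r ≡ -1ℤ)
    (sym (trans (%-distribˡ-+ 1 (w ℕ.+ w) 8) (cong (λ r → (1 ℕ.+ r) % 8) (%-distribˡ-+ w w 8))))
    (below {P = λ r → χ₈-table ((1 ℕ.+ (r ℕ.+ r) % 8) % 8) ≡ 1ℤ ⊎ χ₈-table ((1 ℕ.+ (r ℕ.+ r) % 8) % 8) ≡ -1ℤ}
      table (m%n<n w 8))
    where
    table : ∀ (i : Fin 8) → χ₈-table ((1 ℕ.+ (toℕ i ℕ.+ toℕ i) % 8) % 8) ≡ 1ℤ ⊎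
                            χ₈-table ((1 ℕ.+ (toℕ i ℕ.+ toℕ i) % 8) % 8) ≡ -1ℤ
    table = from-yes (all? λ (i : Fin 8) →
      (χ₈-table ((1 ℕ.+ (toℕ i ℕ.+ toℕ i) % 8) % 8) ℤ.≟ 1ℤ) ⊎-dec
      (χ₈-table ((1 ℕ.+ (toℕ i ℕ.+ toℕ i) % 8) % 8) ℤ.≟ -1ℤ))

  even⊎odd : ∀ n → (∃[ w ] n ≡ w ℕ.+ w) ⊎ (∃[ w ] n ≡ suc (w ℕ.+ w))
  even⊎odd zero = inj₁ (0 , refl)
  even⊎odd (suc n) with even⊎odd n
  ... | inj₁ (w , refl) = inj₂ (w , refl)
  ... | inj₂ (w , refl) = inj₁ (suc w , cong suc (sym (ℕ.+-suc w w)))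

  -- Odd squares are 1 modulo 8, so `t` is 7 modulo 8. In the descent this makes the characters of
  -- the modulus and of its cofactor agree.
  odd-square-2 : ∀ w t → suc (w ℕ.+ w) ℕ.* suc (w ℕ.+ w) ≡ 2 ℕ.+ t → χ₈ t ≡ 1ℤ
  odd-square-2 w t eq = below
    {P = λ r → (2 ℕ.+ r) % 8 ≡ 1 → χ₈-table r ≡ 1ℤ} table (m%n<n t 8)
    (trans (sym (%-distribˡ-+ 2 t 8))
      (trans (sym (cong (_% 8) eq))
        (trans (%-distribˡ-* (suc (w ℕ.+ w)) (suc (w ℕ.+ w)) 8)
          (trans (cong (λ r → (r ℕ.* r) % 8)
            (trans (%-distribˡ-+ 1 (w ℕ.+ w) 8) (cong (λ r → (1 ℕ.+ r) % 8) (%-distribˡ-+ w w 8))))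
            (below {P = λ r → ((1 ℕ.+ (r ℕ.+ r) % 8) % 8 ℕ.* ((1 ℕ.+ (r ℕ.+ r) % 8) % 8)) % 8 ≡ 1}
              squares (m%n<n w 8))))))
    where
    table : ∀ (i : Fin 8) → (2 ℕ.+ toℕ i) % 8 ≡ 1 → χ₈-table (toℕ i) ≡ 1ℤ
    table = from-yes (all? λ (i : Fin 8) → ((2 ℕ.+ toℕ i) % 8 ℕ.≟ 1) →-dec (χ₈-table (toℕ i) ℤ.≟ 1ℤ))
    squares : ∀ (i : Fin 8) → ((1 ℕ.+ (toℕ i ℕ.+ toℕ i) % 8) % 8 ℕ.* ((1 ℕ.+ (toℕ i ℕ.+ toℕ i) % 8) % 8)) % 8 ≡ 1
    squares = from-yes (all? λ (i : Fin 8) →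
      ((1 ℕ.+ (toℕ i ℕ.+ toℕ i) % 8) % 8 ℕ.* ((1 ℕ.+ (toℕ i ℕ.+ toℕ i) % 8) % 8)) % 8 ℕ.≟ 1)

  χ₈≡1⇒±1 : ∀ n → χ₈ n ≡ 1ℤ → n % 8 ≡ 1 ⊎ n % 8 ≡ 7
  χ₈≡1⇒±1 n = below {P = λ r → χ₈-table r ≡ 1ℤ → r ≡ 1 ⊎ r ≡ 7} table (m%n<n n 8)
    where
    table : ∀ (i : Fin 8) → χ₈-table (toℕ i) ≡ 1ℤ → toℕ i ≡ 1 ⊎ toℕ i ≡ 7
    table = from-yes (all? λ (i : Fin 8) →
      (χ₈-table (toℕ i) ℤ.≟ 1ℤ) →-dec ((toℕ i ℕ.≟ 1) ⊎-dec (toℕ i ℕ.≟ 7)))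

  χ₈≡-1⇒odd : ∀ {n} → χ₈ n ≡ -1ℤ → ∃[ w ] n ≡ suc (w ℕ.+ w)
  χ₈≡-1⇒odd {n} χ with even⊎odd n
  ... | inj₂ odd = odd
  ... | inj₁ (w , refl) = contradiction (trans (sym χ) (χ₈-even w)) λ ()

  -- A modulus with nonzero character is odd, so exactly one of r and n - r is odd for r = x mod n,
  -- and both have the same square. The bound by `n` is what later makes the descent decrease.
  odd-root : ∀ {n} x → χ₈ n ≡ -1ℤ → x * x ≡ + 2 [mod n ] →
    ∃[ w ] suc (w ℕ.+ w) ℕ.≤ n × + suc (w ℕ.+ w) * + suc (w ℕ.+ w) ≡ + 2 [mod n ]
  odd-root {n@(suc n-1)} x χ root with even⊎odd (x %ℕ n) | n%ℕd<d x n | %ℕ-mod {n} x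
  ... | inj₂ (w , r≡) | r<n | r≡x =
    w , subst (ℕ._≤ n) r≡ (ℕ.<⇒≤ r<n) ,
    mod-trans (mod-* (mod-trans (≡-mod (cong +_ (sym r≡))) r≡x) (mod-trans (≡-mod (cong +_ (sym r≡))) r≡x)) root
  ... | inj₁ (w , r≡) | r<n | r≡x with l , n≡ ← χ₈≡-1⇒odd {n} χ
    with ℕ.m≤n⇒∃[o]m+o≡n {w} {l} (ℕ.≮⇒≥ λ l<w →
      ℕ.<⇒≱ (subst₂ ℕ._<_ r≡ n≡ r<n) (ℕ.+-mono-≤ l<w (ℕ.<⇒≤ l<w)))
  -- Here r = 2w and n = 2(w + o) + 1, so the odd root is n - r = 2o + 1.
  ... | o , refl = o ,
    subst (suc (o ℕ.+ o) ℕ.≤_) (sym n≡) (s≤s (ℕ.+-mono-≤ (ℕ.m≤n+m o w) (ℕ.m≤n+m o w))) ,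
    mod-trans (mod-* z≡-x z≡-x) (mod-trans (≡-mod (neg-square x)) root)
    where
    neg-square : ∀ x → - x * - x ≡ x * x
    neg-square = solve-∀
    z≡-x : + suc (o ℕ.+ o) ≡ - x [mod n ]
    z≡-x = mod-trans (mod-trans
      (congruent (divides 1ℤ (trans (lemma (+ w) (+ o)) (trans (cong +_ (sym n≡)) (sym (ℤ.*-identityˡ (+ n)))))))
      (mod-trans (≡-mod (lemma′ (+ w))) (mod-*ˡ -1ℤ r≡x′)))
      (≡-mod (ℤ.-1*i≡-i x))
      where
      lemma : ∀ w o → (1ℤ + (o + o)) - - (w + w) ≡ 1ℤ + ((w + o) + (w + o))
      lemma = solve-∀
      lemma′ : ∀ w → - (w + w) ≡ -1ℤ * (w + w)
      lemma′ = solve-∀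
      r≡x′ : + (w ℕ.+ w) ≡ x [mod n ]
      r≡x′ = mod-trans (≡-mod (cong +_ (sym r≡))) r≡x

  -- Descent: an odd root z ≤ n gives z² - 2 = n f with f < n and χ₈ f = χ₈ n.
  two-nonresidue : ∀ n → χ₈ n ≡ -1ℤ → ∀ x → ¬ x * x ≡ + 2 [mod n ]
  two-nonresidue = <-rec (λ n → χ₈ n ≡ -1ℤ → ∀ x → ¬ x * x ≡ + 2 [mod n ]) step
    where
    step : ∀ n → (∀ {m} → m ℕ.< n → χ₈ m ≡ -1ℤ → ∀ x → ¬ x * x ≡ + 2 [mod m ]) →
      χ₈ n ≡ -1ℤ → ∀ x → ¬ x * x ≡ + 2 [mod n ]
    step n rec χ x root with odd-root x χ root
    -- The root 1 is treated apart because z² - 2 would be negative: it gives n ∣ 1, while `χ₈ 1` is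
    -- 1. From z = 3 on, z² - 2 is the natural number `t` below.
    ... | zero , _ , h = contradiction (ℕ∣.∣1⇒≡1 (∣⇒∣ᵤ (difference h)))
      λ { refl → contradiction χ λ () }
    ... | suc w , bound , h = rec f<n χf (+ z) (congruent (divides (+ n)
        (trans (cong (_- + 2) (trans (sym (ℤ.pos-* z z)) (cong +_ eq)))
          (trans (lemma (+ (n ℕ.* f))) (ℤ.pos-* n f)))))
      where
      lemma : ∀ t → + 2 + t - + 2 ≡ t
      lemma = solve-∀
      z = suc (suc w ℕ.+ suc w)
      t = 7 ℕ.+ (12 ℕ.* w ℕ.+ 4 ℕ.* (w ℕ.* w))
      z² : z ℕ.* z ≡ 2 ℕ.+ t
      z² = square w
        where square : ∀ w → suc (suc w ℕ.+ suc w) ℕ.* suc (suc w ℕ.+ suc w) ≡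
                         2 ℕ.+ (7 ℕ.+ (12 ℕ.* w ℕ.+ 4 ℕ.* (w ℕ.* w)))
              square = ℕ-Solver.solve-∀
      n∣t : n ℕ∣.∣ t
      n∣t = ∣⇒∣ᵤ (subst (+ n ∣_)
        (trans (cong (_- + 2) (trans (sym (ℤ.pos-* z z)) (cong +_ z²))) (lemma (+ t)))
        (difference h))
      f = ℕ∣.quotient n∣t
      t≡ : t ≡ n ℕ.* f
      t≡ = ℕ∣.m∣n⇒n≡m*quotient n∣t
      eq : z ℕ.* z ≡ 2 ℕ.+ n ℕ.* f
      eq = trans z² (cong (2 ℕ.+_) t≡)
      f<n : f ℕ.< n
      -- nf < nf + 2 = z² ≤ n².
      f<n = ℕ.*-cancelˡ-< n f n (ℕ.≤-trans
        (subst (suc (n ℕ.* f) ℕ.≤_) (sym eq) (s≤s (ℕ.n≤1+n (n ℕ.* f))))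
        (ℕ.*-mono-≤ bound bound))
      χf : χ₈ f ≡ -1ℤ
      χf = trans (sym (ℤ.neg-involutive (χ₈ f)))
        (cong -_ (trans (sym (ℤ.-1*i≡-i (χ₈ f)))
          (trans (cong (_* χ₈ f) (sym χ)) (trans (sym (χ₈-* n f)) (odd-square-2 (suc w) (n ℕ.* f) eq)))))

  module _ {p} (pr : Prime p) where

    -- If 2 were a nonresidue, Euler's criterion would give 2^((p-1)/2) ≡ -1, whereas the double
    -- factorials give 1. The search for a root below `p` is decidable, so refuting its failure
    -- yields a root.
    χ₈≡1⇒root : χ₈ p ≡ 1ℤ → ∃[ x ] x ℕ.< p × + x * + x ≡ + 2 [mod p ]
    χ₈≡1⇒root χ = decidable-stable
      (ℕ.anyUpTo? (λ x → decide (+ x * + x)) p) λ none → nonresidue⇒⊥ λ x x<p root → none (x , x<p , root)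
      where
      decide : ∀ a → Dec (a ≡ + 2 [mod p ])
      decide a with + p ∣? a - + 2
      ... | yes h = yes (congruent h)
      ... | no ¬h = no (¬h ∘ difference)
      2≢0 : 2 ℕ.< p → ¬ + 2 ≡ 0ℤ [mod p ]
      2≢0 = positive⇒≢0 (s≤s z≤n)
      1≢-1 : 2 ℕ.< p → ¬ 1ℤ ≡ -1ℤ [mod p ]
      1≢-1 2<p h = 2≢0 2<p (∣⇒≡0 (difference h))
      conclude : ∀ h → p ≡ 3 ℕ.+ (h ℕ.+ h) → (+ 2) ^ suc h ≡ 1ℤ [mod p ] →
        ¬ (∀ x → x ℕ.< p → ¬ + x * + x ≡ + 2 [mod p ])
      conclude h p≡ 2^h≡1 none = 1≢-1 2<p (mod-trans (mod-sym 2^h≡1) (euler pr h p≡ (2≢0 2<p) none))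
        where 2<p = subst (2 ℕ.<_) (sym p≡) (s≤s (s≤s (s≤s z≤n)))
      nonresidue⇒⊥ : ¬ (∀ x → x ℕ.< p → ¬ + x * + x ≡ + 2 [mod p ])
      nonresidue⇒⊥ with p ℕ./ 8 | p % 8 | m≡m%n+[m/n]*n p 8 | χ₈≡1⇒±1 p χ
      ... | zero  | .1 | p≡1 | inj₁ refl =
        contradiction (subst Prime p≡1 pr) λ pr₁ → ℕ.<⇒≢ (ℕ.nonTrivial⇒n>1 1 {{prime⇒nonTrivial pr₁}}) refl
      -- Here p = 8(q + 1) + 1, so (p - 1)/2 = 4(q + 1) is split evenly as n = j = 2(q + 1).
      ... | suc q | .1 | p≡ | inj₁ refl = conclude (1 ℕ.+ q ℕ.+ q ℕ.+ (1 ℕ.+ q ℕ.+ suc q)) (trans p≡ (lemma₁ q))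
        (subst (λ h → (+ 2) ^ h ≡ 1ℤ [mod p ]) (lemma₃ q)
          (2^[n+j]≡1 pr (suc q ℕ.+ suc q) (suc q) (cong +_ (trans p≡ (lemma₂ q))) (evens*odds (suc q ℕ.+ suc q))))
        where
        lemma₁ : ∀ q → 1 ℕ.+ suc q ℕ.* 8 ≡
          3 ℕ.+ ((1 ℕ.+ q ℕ.+ q ℕ.+ (1 ℕ.+ q ℕ.+ suc q)) ℕ.+ (1 ℕ.+ q ℕ.+ q ℕ.+ (1 ℕ.+ q ℕ.+ suc q)))
        lemma₁ = ℕ-Solver.solve-∀
        lemma₂ : ∀ q → 1 ℕ.+ suc q ℕ.* 8 ≡ 1 ℕ.+ 2 ℕ.* (suc q ℕ.+ suc q ℕ.+ (suc q ℕ.+ suc q))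
        lemma₂ = ℕ-Solver.solve-∀
        lemma₃ : ∀ q → (suc q ℕ.+ suc q) ℕ.+ (suc q ℕ.+ suc q) ≡ suc (1 ℕ.+ q ℕ.+ q ℕ.+ (1 ℕ.+ q ℕ.+ suc q))
        lemma₃ = ℕ-Solver.solve-∀
      -- Here p = 8q + 7, so (p - 1)/2 = 4q + 3 is split as n = 2q + 1 and j = 2q + 2, which keeps j
      -- even.
      ... | q | .7 | p≡ | inj₂ refl = conclude (q ℕ.+ q ℕ.+ (suc q ℕ.+ suc q)) (trans p≡ (lemma₁ q))
        (2^[n+j]≡1 pr (suc (q ℕ.+ q)) (suc q) (cong +_ (trans p≡ (lemma₂ q)))
          (trans (cong (λ j → evens (suc (q ℕ.+ q)) * odds j) (lemma₃ q))
            (trans (evens*odds⁺ (suc (q ℕ.+ q))) (cong (λ n → + (n !)) (lemma₄ q)))))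
        where
        lemma₁ : ∀ q → 7 ℕ.+ q ℕ.* 8 ≡ 3 ℕ.+ ((q ℕ.+ q ℕ.+ (suc q ℕ.+ suc q)) ℕ.+ (q ℕ.+ q ℕ.+ (suc q ℕ.+ suc q)))
        lemma₁ = ℕ-Solver.solve-∀
        lemma₂ : ∀ q → 7 ℕ.+ q ℕ.* 8 ≡ 1 ℕ.+ 2 ℕ.* (suc (q ℕ.+ q) ℕ.+ (suc q ℕ.+ suc q))
        lemma₂ = ℕ-Solver.solve-∀
        lemma₃ : ∀ q → suc q ℕ.+ suc q ≡ suc (suc (q ℕ.+ q))
        lemma₃ = ℕ-Solver.solve-∀
        lemma₄ : ∀ q → suc (suc (q ℕ.+ q) ℕ.+ suc (q ℕ.+ q)) ≡ suc (q ℕ.+ q) ℕ.+ (suc q ℕ.+ suc q)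
        lemma₄ = ℕ-Solver.solve-∀

  -- Kronecker symbols

  ^-*-distrib : ∀ a b n → (a * b) ^ n ≡ a ^ n * b ^ n
  ^-*-distrib a b zero    = refl
  ^-*-distrib a b (suc n) = trans (cong ((a * b) *_) (^-*-distrib a b n)) (lemma a b (a ^ n) (b ^ n))
    where lemma : ∀ a b c d → (a * b) * (c * d) ≡ (a * c) * (b * d)
          lemma = solve-∀

  [2^n]ℤ : ∀ n → + (2 ℕ.^ n) ≡ (+ 2) ^ n
  [2^n]ℤ zero    = refl
  [2^n]ℤ (suc n) = trans (ℤ.pos-* 2 (2 ℕ.^ n)) (cong (+ 2 *_) ([2^n]ℤ n))

  prime∣2^n⇒≡2 : ∀ {p} → Prime p → ∀ n → p ℕ∣.∣ 2 ℕ.^ n → p ≡ 2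
  prime∣2^n⇒≡2 pr zero    p∣1 with ℕ∣.∣1⇒≡1 p∣1
  ... | refl = contradiction refl (ℕ.<⇒≢ (ℕ.nonTrivial⇒n>1 1 {{prime⇒nonTrivial pr}}))
  prime∣2^n⇒≡2 pr (suc n) p∣2^n with euclidsLemma 2 (2 ℕ.^ n) pr p∣2^n
  ... | inj₂ p∣2^n′ = prime∣2^n⇒≡2 pr n p∣2^n′
  ... | inj₁ p∣2 with prime⇒irreducible (from-yes (prime? 2)) p∣2
  ...   | inj₁ refl = contradiction refl (ℕ.<⇒≢ (ℕ.nonTrivial⇒n>1 1 {{prime⇒nonTrivial pr}}))
  ...   | inj₂ p≡2  = p≡2

  odd⇒2∤ : ∀ w → ¬ 2 ℕ∣.∣ suc (w ℕ.+ w)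
  odd⇒2∤ w 2∣ = contradiction (ℕ∣.∣1⇒≡1 (ℕ∣.∣m+n∣m⇒∣n (subst (2 ℕ∣.∣_) (ℕ.+-comm 1 (w ℕ.+ w)) 2∣)
    (subst (2 ℕ∣.∣_) (cong (w ℕ.+_) (ℕ.+-identityʳ w)) (ℕ∣.m∣m*n w)))) λ ()

  legendre : ∀ {p} (pr : Prime p) → p ≢ 2 → ∀ a →
    (¬ + p ∣ a → (∃[ x ] x * x ≡ a [mod p ]) → kroneckerAtPrime a p ≡ 1ℤ) ×
    (¬ + p ∣ a → (∀ x → ¬ x * x ≡ a [mod p ]) → kroneckerAtPrime a p ≡ -1ℤ)
  legendre {0} pr _ _ = contradiction (ℕ.nonTrivial⇒n>1 0 {{prime⇒nonTrivial pr}}) λ ()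
  legendre {1} pr _ _ = contradiction refl (ℕ.<⇒≢ (ℕ.nonTrivial⇒n>1 1 {{prime⇒nonTrivial pr}}))
  legendre {2} _ p≢2 _ = contradiction refl p≢2
  -- With 0, 1 and 2 excluded, `p` has the shape on which `kroneckerAtPrime` reduces to its clause
  -- for odd primes.
  legendre {p@(suc (suc (suc _)))} _ _ a = residue , nonresidue
    where
    root? : Dec (∃[ x ] + p ∣ + toℕ {p} x * + toℕ x - a)
    root? = any? λ x → + p ∣? + toℕ x * + toℕ x - a
    residue : ¬ + p ∣ a → (∃[ x ] x * x ≡ a [mod p ]) → kroneckerAtPrime a p ≡ 1ℤ
    residue p∤a (x , root) = value (fromℕ< x<p , difference root′)
      where
      x<p = n%ℕd<d x p
      r≡x : + toℕ (fromℕ< x<p) ≡ x [mod p ]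
      r≡x = mod-trans (≡-mod (cong +_ (toℕ-fromℕ< x<p))) (%ℕ-mod x)
      root′ : + toℕ (fromℕ< x<p) * + toℕ (fromℕ< x<p) ≡ a [mod p ]
      root′ = mod-trans (mod-* r≡x r≡x) root
      value : (∃[ x ] + p ∣ + toℕ {p} x * + toℕ x - a) → kroneckerAtPrime a p ≡ 1ℤ
      value root rewrite dec-false (+ p ∣? a) p∤a | dec-true root? root = refl
    nonresidue : ¬ + p ∣ a → (∀ x → ¬ x * x ≡ a [mod p ]) → kroneckerAtPrime a p ≡ -1ℤ
    nonresidue p∤a no-root
      rewrite dec-false (+ p ∣? a) p∤a
            | dec-false root? (λ { (x , h) → no-root (+ toℕ x) (congruent h) }) = refl

  -- For n = 2m the number 2ⁿ is the square of 2ᵐ. For n = 2m + 1, multiplying a root by 2ᵐ or by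
  -- its inverse modulo p passes between square roots of 2 and square roots of 2ⁿ, so the character
  -- is that of 2.
  legendre-2^n : ∀ {p} → Prime p → p ≢ 2 → ∀ n → kroneckerAtPrime (+ (2 ℕ.^ n)) p ≡ χ₈ p ^ n
  legendre-2^n {p} pr p≢2 n with even⊎odd p
  ... | inj₁ (w , refl) with prime⇒irreducible pr (subst (2 ℕ∣.∣_) (cong (w ℕ.+_) (ℕ.+-identityʳ w)) (ℕ∣.m∣m*n w))
  ...   | inj₂ 2≡p = contradiction (sym 2≡p) p≢2
  legendre-2^n {p} pr p≢2 n | inj₂ (w , refl) = cases (even⊎odd n)
    where
    -- As p = 2w + 1, the inverse of 2 is (p + 1)/2 = w + 1.
    1/2 : + 2 * + suc w ≡ 1ℤ [mod p ]
    1/2 = congruent (divides 1ℤ (trans (lemma (+ w)) (sym (ℤ.*-identityˡ (+ p)))))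
      where lemma : ∀ w → + 2 * (1ℤ + w) - 1ℤ ≡ 1ℤ + (w + w)
            lemma = solve-∀
    p∤2^n : ¬ + p ∣ + (2 ℕ.^ n)
    p∤2^n h = p≢2 (prime∣2^n⇒≡2 pr n (∣⇒∣ᵤ h))
    residue    = proj₁ (legendre pr p≢2 (+ (2 ℕ.^ n))) p∤2^n
    nonresidue = proj₂ (legendre pr p≢2 (+ (2 ℕ.^ n))) p∤2^n
    2^[m+m] : ∀ m → (+ 2) ^ m * (+ 2) ^ m ≡ (+ 2) ^ (m ℕ.+ m)
    2^[m+m] m = sym (ℤ.^-distribˡ-+-* (+ 2) m m)
    odd-power : ∀ {a : ℤ} m → a ≡ 1ℤ ⊎ a ≡ -1ℤ → a ^ suc (m ℕ.+ m) ≡ a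
    odd-power m (inj₁ refl) = 1^n≡1 (suc (m ℕ.+ m))
    odd-power m (inj₂ refl) = cong (-1ℤ *_) ([-1]^2m≡1 m)
    cases : (∃[ m ] n ≡ m ℕ.+ m) ⊎ (∃[ m ] n ≡ suc (m ℕ.+ m)) →
      kroneckerAtPrime (+ (2 ℕ.^ n)) p ≡ χ₈ p ^ n
    cases (inj₁ (m , refl)) = trans
      (residue ((+ 2) ^ m , ≡-mod (trans (2^[m+m] m) (sym ([2^n]ℤ (m ℕ.+ m))))))
      (sym (even-power (χ₈-odd w)))
      where
      even-power : ∀ {a : ℤ} → a ≡ 1ℤ ⊎ a ≡ -1ℤ → a ^ (m ℕ.+ m) ≡ 1ℤ
      even-power (inj₁ refl) = 1^n≡1 (m ℕ.+ m)
      even-power (inj₂ refl) = [-1]^2m≡1 m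
    cases (inj₂ (m , refl)) = trans (value (χ₈-odd w)) (sym (odd-power m (χ₈-odd w)))
      where
      rearrange : ∀ x a → x * a * (x * a) ≡ (a * a) * (x * x)
      rearrange = solve-∀
      value : χ₈ p ≡ 1ℤ ⊎ χ₈ p ≡ -1ℤ → kroneckerAtPrime (+ (2 ℕ.^ n)) p ≡ χ₈ p
      value (inj₁ χ) with x , _ , root ← χ₈≡1⇒root pr χ = trans
        (residue (+ x * (+ 2) ^ m ,
          mod-trans (≡-mod (trans (rearrange (+ x) ((+ 2) ^ m)) (cong (_* (+ x * + x)) (2^[m+m] m))))
            (mod-trans (mod-*ˡ ((+ 2) ^ (m ℕ.+ m)) root)
              (≡-mod (trans (ℤ.*-comm ((+ 2) ^ (m ℕ.+ m)) (+ 2)) (sym ([2^n]ℤ n)))))))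
        (sym χ)
      value (inj₂ χ) = trans
        (nonresidue λ x root → two-nonresidue p χ (x * (+ suc w) ^ m)
          (mod-trans (≡-mod (rearrange x ((+ suc w) ^ m)))
            (mod-trans (mod-*ˡ ((+ suc w) ^ m * (+ suc w) ^ m)
              (mod-trans root (≡-mod (trans ([2^n]ℤ n) (cong (+ 2 *_) (sym (2^[m+m] m)))))))
              (mod-trans (≡-mod (regroup ((+ suc w) ^ m) ((+ 2) ^ m)))
                (mod-*ˡ (+ 2) (mod-* inverse inverse))))))
        (sym χ)
        where
        regroup : ∀ u a → u * u * (+ 2 * (a * a)) ≡ + 2 * ((a * u) * (a * u))
        regroup = solve-∀
        inverse : (+ 2) ^ m * (+ suc w) ^ m ≡ 1ℤ [mod p ]
        inverse = mod-trans (≡-mod (sym (^-*-distrib (+ 2) (+ suc w) m)))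
          (mod-trans (mod-^ m 1/2) (≡-mod (1^n≡1 m)))

  foldr-kronecker : ∀ (P : ℤ → Set) → P 1ℤ → (∀ {x y} → P x → P y → P (x * y)) → ∀ a fs →
    All (P ∘ kroneckerAtPrime a) fs → P (foldr _*_ 1ℤ (map (kroneckerAtPrime a) fs))
  foldr-kronecker P P1 P* a []       []         = P1
  foldr-kronecker P P1 P* a (p ∷ fs) (h ∷ hs) = P* h (foldr-kronecker P P1 P* a fs hs)

  primes-divide : ∀ {fs} → All Prime fs → All (ℕ∣._∣ product fs) fs
  primes-divide []                  = []
  primes-divide {p ∷ fs} (_ ∷ prs) =
    ℕ∣.m∣m*n (product fs) ∷ All.map (λ q∣ → ℕ∣.∣-trans q∣ (ℕ∣.n∣m*n p)) (primes-divide prs)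

  module _ (n : ℕ) .{{_ : ℕ.NonZero n}} where

    open PrimeFactorisation (factorise n) using (isFactorisation; factorsPrime)

    prime-factors : All (λ p → Prime p × p ℕ∣.∣ n) (factors (factorise n))
    prime-factors = All.zip (factorsPrime ,
      All.map (subst (_ ℕ∣.∣_) (sym isFactorisation)) (primes-divide factorsPrime))

    kroneckerℕ-closed : ∀ (P : ℤ → Set) → P 1ℤ → (∀ {x y} → P x → P y → P (x * y)) → ∀ a →
      (∀ {p} → Prime p → p ℕ∣.∣ n → P (kroneckerAtPrime a p)) → P (kroneckerℕ a n)
    kroneckerℕ-closed P P1 P* a h =
      foldr-kronecker P P1 P* a _ (All.map (λ { (pr , p∣n) → h pr p∣n }) prime-factors)

    -- The symbol is a product over a computed list of primes. Comparing it with a completely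
    -- multiplicative function reduces everything to the prime divisors, without inspecting the
    -- list.
    kroneckerℕ-multiplicative : ∀ (f : ℕ → ℤ) → f 1 ≡ 1ℤ → (∀ i j → f (i ℕ.* j) ≡ f i * f j) → ∀ a →
      (∀ {p} → Prime p → p ℕ∣.∣ n → kroneckerAtPrime a p ≡ f p) → kroneckerℕ a n ≡ f n
    kroneckerℕ-multiplicative f f1 f* a h =
      trans (go _ (All.map (λ { (pr , p∣n) → h pr p∣n }) prime-factors)) (cong f (sym isFactorisation))
      where
      go : ∀ fs → All (λ p → kroneckerAtPrime a p ≡ f p) fs →
        foldr _*_ 1ℤ (map (kroneckerAtPrime a) fs) ≡ f (product fs)
      go []       []       = sym f1
      go (p ∷ fs) (e ∷ es) = trans (cong₂ _*_ e (go fs es)) (sym (f* p (product fs)))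

  ±1-* : ∀ {x y} → x ≡ 1ℤ ⊎ x ≡ -1ℤ → y ≡ 1ℤ ⊎ y ≡ -1ℤ → x * y ≡ 1ℤ ⊎ x * y ≡ -1ℤ
  ±1-* (inj₁ refl) (inj₁ refl) = inj₁ refl
  ±1-* (inj₁ refl) (inj₂ refl) = inj₂ refl
  ±1-* (inj₂ refl) (inj₁ refl) = inj₂ refl
  ±1-* (inj₂ refl) (inj₂ refl) = inj₁ refl

  -- Meant for ε, which enters the splitting as a numerator over -A₁A₂ = 2²ᵏ, where 1 and -1 both
  -- have symbol 1.
  kronecker[-1]-±1 : ∀ n → kronecker -1ℤ n ≡ 1ℤ ⊎ kronecker -1ℤ n ≡ -1ℤ
  kronecker[-1]-±1 n = kronecker-±1 n
    where
    atPrime : ∀ {p} → Prime p → kroneckerAtPrime -1ℤ p ≡ 1ℤ ⊎ kroneckerAtPrime -1ℤ p ≡ -1ℤ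
    atPrime {p} pr with p ℕ.≟ 2
    ... | yes refl = inj₁ refl
    ... | no p≢2 with ℕ.anyUpTo? (λ x → + p ∣? + x * + x - -1ℤ) p
    ...   | yes (x , _ , root) =
      inj₁ (proj₁ (legendre pr p≢2 -1ℤ) p∤-1 (+ x , congruent root))
      where p∤-1 : ¬ + p ∣ -1ℤ
            p∤-1 h = ℕ.<⇒≢ (ℕ.nonTrivial⇒n>1 p {{prime⇒nonTrivial pr}}) (sym (ℕ∣.∣1⇒≡1 (∣⇒∣ᵤ h)))
    ...   | no none = inj₂ (proj₂ (legendre pr p≢2 -1ℤ) p∤-1 λ x root →
        none (x %ℕ p , n%ℕd<d x p , difference (mod-trans (mod-* (%ℕ-mod x) (%ℕ-mod x)) root)))
      where instance _ = prime⇒nonZero pr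
            p∤-1 : ¬ + p ∣ -1ℤ
            p∤-1 h = ℕ.<⇒≢ (ℕ.nonTrivial⇒n>1 p {{prime⇒nonTrivial pr}}) (sym (ℕ∣.∣1⇒≡1 (∣⇒∣ᵤ h)))
    natural : ∀ n .{{_ : ℕ.NonZero n}} → kroneckerℕ -1ℤ n ≡ 1ℤ ⊎ kroneckerℕ -1ℤ n ≡ -1ℤ
    natural n = kroneckerℕ-closed n (λ x → x ≡ 1ℤ ⊎ x ≡ -1ℤ) (inj₁ refl) ±1-* -1ℤ (λ pr _ → atPrime pr)
    kronecker-±1 : ∀ n → kronecker -1ℤ n ≡ 1ℤ ⊎ kronecker -1ℤ n ≡ -1ℤ
    -- Denominator 0 occurs for B₁ = 0, where the convention (-1/0) = 1 applies.
    kronecker-±1 (+ 0)      = inj₁ refl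
    kronecker-±1 ℤ.+[1+ n ] = natural (suc n)
    kronecker-±1 -[1+ n ]   = ±1-* (inj₂ refl) (natural (suc n))

  kroneckerℕ[±1,2^n] : ∀ {a} → a ≡ 1ℤ ⊎ a ≡ -1ℤ → ∀ n {m} .{{_ : ℕ.NonZero m}} → m ≡ 2 ℕ.^ n → kroneckerℕ a m ≡ 1ℤ
  kroneckerℕ[±1,2^n] {a} a≡±1 n {m} refl =
    kroneckerℕ-multiplicative m (λ _ → 1ℤ) refl (λ _ _ → refl) a
      λ pr p∣ → at2 a≡±1 (prime∣2^n⇒≡2 pr n p∣)
    where
    at2 : ∀ {a p} → a ≡ 1ℤ ⊎ a ≡ -1ℤ → p ≡ 2 → kroneckerAtPrime a p ≡ 1ℤ
    at2 (inj₁ refl) refl = refl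
    at2 (inj₂ refl) refl = refl

  kroneckerℕ[2^n,odd] : ∀ n w → kroneckerℕ (+ (2 ℕ.^ n)) (suc (w ℕ.+ w)) ≡ χ₈ (suc (w ℕ.+ w)) ^ n
  kroneckerℕ[2^n,odd] n w =
    kroneckerℕ-multiplicative (suc (w ℕ.+ w)) (λ m → χ₈ m ^ n) (1^n≡1 n)
      (λ i j → trans (cong (_^ n) (χ₈-* i j)) (^-*-distrib (χ₈ i) (χ₈ j) n)) (+ (2 ℕ.^ n))
      λ pr p∣ → legendre-2^n pr (λ { refl → odd⇒2∤ w p∣ }) n

  kronecker[odd,4] : ∀ w → kronecker (+ suc (w ℕ.+ w)) (+ 4) ≡ 1ℤ
  -- The factorisation of 4 evaluates to the list 2, 2, so the symbol is the square of (x/2), which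
  -- is ±1 for odd x.
  kronecker[odd,4] w = square at2
    where
    square : ∀ {x} → x ≡ 1ℤ ⊎ x ≡ -1ℤ → x * (x * 1ℤ) ≡ 1ℤ
    square (inj₁ refl) = refl
    square (inj₂ refl) = refl
    at2 : kroneckerAtPrime (+ suc (w ℕ.+ w)) 2 ≡ 1ℤ ⊎ kroneckerAtPrime (+ suc (w ℕ.+ w)) 2 ≡ -1ℤ
    at2 rewrite dec-false (+ 2 ∣? + suc (w ℕ.+ w)) (odd⇒2∤ w ∘ ∣⇒∣ᵤ)
      with does (suc (w ℕ.+ w) % 8 ℕ.≟ 1) | does (suc (w ℕ.+ w) % 8 ℕ.≟ 7)
    ... | true  | _     = inj₁ refl
    ... | false | true  = inj₁ refl
    ... | false | false = inj₂ refl

  -- Plücker coordinates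

  mat-cong : ∀ {a b c d e f g h i a′ b′ c′ d′ e′ f′ g′ h′ i′} →
    a ≡ a′ → b ≡ b′ → c ≡ c′ → d ≡ d′ → e ≡ e′ → f ≡ f′ → g ≡ g′ → h ≡ h′ → i ≡ i′ →
    mat a b c d e f g h i ≡ mat a′ b′ c′ d′ e′ f′ g′ h′ i′
  mat-cong refl refl refl refl refl refl refl refl refl = refl

  I₃ : Matrix
  I₃ = mat 1ℤ 0ℤ 0ℤ 0ℤ 1ℤ 0ℤ 0ℤ 0ℤ 1ℤ

  ·-assoc : ∀ x y z → x · y · z ≡ x · (y · z)
  ·-assoc (mat a b c d e f g h i) (mat p q r s t u v w x) (mat a′ b′ c′ d′ e′ f′ g′ h′ i′) = mat-cong
    (entry a b c p q r s t u v w x a′ d′ g′)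
    (entry a b c p q r s t u v w x b′ e′ h′)
    (entry a b c p q r s t u v w x c′ f′ i′)
    (entry d e f p q r s t u v w x a′ d′ g′)
    (entry d e f p q r s t u v w x b′ e′ h′)
    (entry d e f p q r s t u v w x c′ f′ i′)
    (entry g h i p q r s t u v w x a′ d′ g′)
    (entry g h i p q r s t u v w x b′ e′ h′)
    (entry g h i p q r s t u v w x c′ f′ i′)
    where
    entry : ∀ a b c p q r s t u v w x l m n →
      (a * p + b * s + c * v) * l + (a * q + b * t + c * w) * m + (a * r + b * u + c * x) * n ≡
      a * (p * l + q * m + r * n) + b * (s * l + t * m + u * n) + c * (v * l + w * m + x * n)
    entry = solve-∀

  ·-identityʳ : ∀ x → x · I₃ ≡ x
  ·-identityʳ (mat a b c d e f g h i) = mat-cong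
    (e₁ a b c) (e₂ a b c) (e₃ a b c) (e₁ d e f) (e₂ d e f) (e₃ d e f) (e₁ g h i) (e₂ g h i) (e₃ g h i)
    where
    e₁ : ∀ x y z → x * 1ℤ + y * 0ℤ + z * 0ℤ ≡ x
    e₁ = solve-∀
    e₂ : ∀ x y z → x * 0ℤ + y * 1ℤ + z * 0ℤ ≡ y
    e₂ = solve-∀
    e₃ : ∀ x y z → x * 0ℤ + y * 0ℤ + z * 1ℤ ≡ z
    e₃ = solve-∀

  inv-inverseˡ : ∀ x → det x ≡ 1ℤ → inv x · x ≡ I₃
  inv-inverseˡ (mat a b c d e f g h i) det≡1 = mat-cong
    (trans (e₁₁ a b c d e f g h i) det≡1) (e₁₂ a b c d e f g h i) (e₁₃ a b c d e f g h i)
    (e₂₁ a b c d e f g h i) (trans (e₂₂ a b c d e f g h i) det≡1) (e₂₃ a b c d e f g h i)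
    (e₃₁ a b c d e f g h i) (e₃₂ a b c d e f g h i) (trans (e₃₃ a b c d e f g h i) det≡1)
    where
    e₁₁ : ∀ a b c d e f g h i → (e * i - f * h) * a + (c * h - b * i) * d + (b * f - c * e) * g ≡
      a * (e * i - f * h) - b * (d * i - f * g) + c * (d * h - e * g)
    e₁₁ = solve-∀
    e₁₂ : ∀ a b c d e f g h i → (e * i - f * h) * b + (c * h - b * i) * e + (b * f - c * e) * h ≡ 0ℤ
    e₁₂ = solve-∀
    e₁₃ : ∀ a b c d e f g h i → (e * i - f * h) * c + (c * h - b * i) * f + (b * f - c * e) * i ≡ 0ℤ
    e₁₃ = solve-∀
    e₂₁ : ∀ a b c d e f g h i → (f * g - d * i) * a + (a * i - c * g) * d + (c * d - a * f) * g ≡ 0ℤ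
    e₂₁ = solve-∀
    e₂₂ : ∀ a b c d e f g h i → (f * g - d * i) * b + (a * i - c * g) * e + (c * d - a * f) * h ≡
      a * (e * i - f * h) - b * (d * i - f * g) + c * (d * h - e * g)
    e₂₂ = solve-∀
    e₂₃ : ∀ a b c d e f g h i → (f * g - d * i) * c + (a * i - c * g) * f + (c * d - a * f) * i ≡ 0ℤ
    e₂₃ = solve-∀
    e₃₁ : ∀ a b c d e f g h i → (d * h - e * g) * a + (b * g - a * h) * d + (a * e - b * d) * g ≡ 0ℤ
    e₃₁ = solve-∀
    e₃₂ : ∀ a b c d e f g h i → (d * h - e * g) * b + (b * g - a * h) * e + (a * e - b * d) * h ≡ 0ℤ
    e₃₂ = solve-∀
    e₃₃ : ∀ a b c d e f g h i → (d * h - e * g) * c + (b * g - a * h) * f + (a * e - b * d) * i ≡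
      a * (e * i - f * h) - b * (d * i - f * g) + c * (d * h - e * g)
    e₃₃ = solve-∀

  -- The Plücker coordinates up to sign: the third row and the minors of the last two rows.
  record Plücker : Set where
    constructor ⟨_,_,_∣_,_,_⟩
    field
      row₁ row₂ row₃ minor₂₃ minor₁₃ minor₁₂ : ℤ

  plücker : Matrix → Plücker
  plücker (mat _ _ _ d e f g h i) = ⟨ g , h , i ∣ e * i - f * h , d * i - f * g , d * h - e * g ⟩

  plücker-cong : ∀ {g h i k l m g′ h′ i′ k′ l′ m′} →
    g ≡ g′ → h ≡ h′ → i ≡ i′ → k ≡ k′ → l ≡ l′ → m ≡ m′ →
    ⟨ g , h , i ∣ k , l , m ⟩ ≡ ⟨ g′ , h′ , i′ ∣ k′ , l′ , m′ ⟩
  plücker-cong refl refl refl refl refl refl = refl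

  unipotent : ℤ → ℤ → ℤ → Matrix
  unipotent x y z = mat 1ℤ x y 0ℤ 1ℤ z 0ℤ 0ℤ 1ℤ

  unipotent-Γ∞ : ∀ x y z → Γ∞ (unipotent x y z)
  unipotent-Γ∞ x y z = record { a≡1 = refl ; e≡1 = refl ; i≡1 = refl ; d≡0 = refl ; g≡0 = refl ; h≡0 = refl }

  Γ∞-unipotent : ∀ {v} → Γ∞ v → ∃[ x ] ∃[ y ] ∃[ z ] v ≡ unipotent x y z
  Γ∞-unipotent {mat _ x y _ _ z _ _ _}
    record { a≡1 = refl ; e≡1 = refl ; i≡1 = refl ; d≡0 = refl ; g≡0 = refl ; h≡0 = refl } = x , y , z , refl

  plücker-·ˡ : ∀ x y z γ → plücker (unipotent x y z · γ) ≡ plücker γ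
  plücker-·ˡ x y z (mat a b c d e f g h i) = plücker-cong
    (r a d g) (r b e h) (r c f i)
    (minor b e h c f i z) (minor a d g c f i z) (minor a d g b e h z)
    where
    r : ∀ a d g → 0ℤ * a + 0ℤ * d + 1ℤ * g ≡ g
    r = solve-∀
    minor : ∀ a d g b e h z →
      (0ℤ * a + 1ℤ * d + z * g) * (0ℤ * b + 0ℤ * e + 1ℤ * h) - (0ℤ * b + 1ℤ * e + z * h) * (0ℤ * a + 0ℤ * d + 1ℤ * g) ≡
      d * h - e * g
    minor = solve-∀

  -- The right action of `unipotent x y z` on Plücker vectors. Left multiplication by Γ∞ fixes these
  -- vectors, so double cosets become orbits of this action.
  translate : (x y z : ℤ) → Plücker → Plücker
  translate x y z ⟨ g , h , i ∣ k , l , m ⟩ =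
    ⟨ g , g * x + h , g * y + h * z + i ∣ k + x * l + (x * z - y) * m , l + z * m , m ⟩

  plücker-·ʳ : ∀ γ x y z → plücker (γ · unipotent x y z) ≡ translate x y z (plücker γ)
  plücker-·ʳ (mat a b c d e f g h i) x y z = plücker-cong
    (r₁ g h i) (r₂ g h i x) (r₃ g h i y z)
    (m₁ d e f g h i x y z) (m₂ d e f g h i y z) (m₃ d e f g h i x)
    where
    r₁ : ∀ g h i → g * 1ℤ + h * 0ℤ + i * 0ℤ ≡ g
    r₁ = solve-∀
    r₂ : ∀ g h i x → g * x + h * 1ℤ + i * 0ℤ ≡ g * x + h
    r₂ = solve-∀
    r₃ : ∀ g h i y z → g * y + h * z + i * 1ℤ ≡ g * y + h * z + i
    r₃ = solve-∀
    m₁ : ∀ d e f g h i x y z →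
      (d * x + e * 1ℤ + f * 0ℤ) * (g * y + h * z + i * 1ℤ) - (d * y + e * z + f * 1ℤ) * (g * x + h * 1ℤ + i * 0ℤ) ≡
      e * i - f * h + x * (d * i - f * g) + (x * z - y) * (d * h - e * g)
    m₁ = solve-∀
    m₂ : ∀ d e f g h i y z →
      (d * 1ℤ + e * 0ℤ + f * 0ℤ) * (g * y + h * z + i * 1ℤ) - (d * y + e * z + f * 1ℤ) * (g * 1ℤ + h * 0ℤ + i * 0ℤ) ≡
      d * i - f * g + z * (d * h - e * g)
    m₂ = solve-∀
    m₃ : ∀ d e f g h i x →
      (d * 1ℤ + e * 0ℤ + f * 0ℤ) * (g * x + h * 1ℤ + i * 0ℤ) - (d * x + e * 1ℤ + f * 0ℤ) * (g * 1ℤ + h * 0ℤ + i * 0ℤ) ≡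
      d * h - e * g
    m₃ = solve-∀

  -- The first column of the adjugate of `γ′` consists of signed minors that `γ` shares, so the rows
  -- of `γ` pair with it to det γ, 0 and 0. The same equality of minors turns the middle diagonal
  -- entry into det γ′; the other entries use only the common third row.
  plücker-injective : ∀ γ γ′ → det γ ≡ 1ℤ → det γ′ ≡ 1ℤ → plücker γ ≡ plücker γ′ → Γ∞ (γ · inv γ′)
  plücker-injective (mat a b c d e f g h i) (mat a′ b′ c′ d′ e′ f′ g′ h′ i′) det≡1 det′≡1 eq
    with refl ← cong Plücker.row₁ eq | refl ← cong Plücker.row₂ eq | refl ← cong Plücker.row₃ eq = record
    { a≡1 = trans (expand a b c d′ e′ f′ g h i) (trans (sym (along a b c)) det≡1)
    ; d≡0 = trans (expand d e f d′ e′ f′ g h i) (trans (sym (along d e f)) (zero₂ d e f g h i))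
    ; g≡0 = trans (expand g h i d′ e′ f′ g h i) (trans (sym (along g h i)) (zero₃ d e f g h i))
    ; e≡1 = trans (middle a′ b′ c′ d e f g h i) (trans (along a′ b′ c′) det′≡1)
    ; h≡0 = last₂ a′ b′ c′ g h i
    ; i≡1 = trans (last₃ a′ b′ c′ d′ e′ f′ g h i) det′≡1
    }
    where
    along : ∀ x y z →
      x * (e * i - f * h) - y * (d * i - f * g) + z * (d * h - e * g) ≡
      x * (e′ * i - f′ * h) - y * (d′ * i - f′ * g) + z * (d′ * h - e′ * g)
    along x y z rewrite cong Plücker.minor₂₃ eq | cong Plücker.minor₁₃ eq | cong Plücker.minor₁₂ eq = refl
    expand : ∀ x y z d e f g h i → x * (e * i - f * h) + y * (f * g - d * i) + z * (d * h - e * g) ≡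
      x * (e * i - f * h) - y * (d * i - f * g) + z * (d * h - e * g)
    expand = solve-∀
    zero₂ : ∀ d e f g h i → d * (e * i - f * h) - e * (d * i - f * g) + f * (d * h - e * g) ≡ 0ℤ
    zero₂ = solve-∀
    zero₃ : ∀ d e f g h i → g * (e * i - f * h) - h * (d * i - f * g) + i * (d * h - e * g) ≡ 0ℤ
    zero₃ = solve-∀
    middle : ∀ a b c d e f g h i → d * (c * h - b * i) + e * (a * i - c * g) + f * (b * g - a * h) ≡
      a * (e * i - f * h) - b * (d * i - f * g) + c * (d * h - e * g)
    middle = solve-∀
    last₂ : ∀ a b c g h i → g * (c * h - b * i) + h * (a * i - c * g) + i * (b * g - a * h) ≡ 0ℤ
    last₂ = solve-∀
    last₃ : ∀ a b c d e f g h i → g * (b * f - c * e) + h * (c * d - a * f) + i * (a * e - b * d) ≡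
      a * (e * i - f * h) - b * (d * i - f * g) + c * (d * h - e * g)
    last₃ = solve-∀

  det-·-unipotent : ∀ γ x y z → det (γ · unipotent x y z) ≡ det γ
  det-·-unipotent (mat a b c d e f g h i) x y z = lemma a b c d e f g h i x y z
    where
    lemma : ∀ a b c d e f g h i x y z →
      (a * 1ℤ + b * 0ℤ + c * 0ℤ) *
        ((d * x + e * 1ℤ + f * 0ℤ) * (g * y + h * z + i * 1ℤ) - (d * y + e * z + f * 1ℤ) * (g * x + h * 1ℤ + i * 0ℤ))
      - (a * x + b * 1ℤ + c * 0ℤ) *
        ((d * 1ℤ + e * 0ℤ + f * 0ℤ) * (g * y + h * z + i * 1ℤ) - (d * y + e * z + f * 1ℤ) * (g * 1ℤ + h * 0ℤ + i * 0ℤ))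
      + (a * y + b * z + c * 1ℤ) *
        ((d * 1ℤ + e * 0ℤ + f * 0ℤ) * (g * x + h * 1ℤ + i * 0ℤ) - (d * x + e * 1ℤ + f * 0ℤ) * (g * 1ℤ + h * 0ℤ + i * 0ℤ))
      ≡ a * (e * i - f * h) - b * (d * i - f * g) + c * (d * h - e * g)
    lemma = solve-∀

  -- Double coset equivalence as translation of Plücker vectors

  translate⇒∼ : ∀ {γ γ′} x y z → det γ ≡ 1ℤ → det γ′ ≡ 1ℤ → plücker γ′ ≡ translate x y z (plücker γ) → γ ∼ γ′
  translate⇒∼ {γ} {γ′} x y z det≡1 det′≡1 eq =
    u , v , plücker-injective γ′ (γ · v) det′≡1 detγv≡1 (trans eq (sym (plücker-·ʳ γ x y z))) ,
    unipotent-Γ∞ x y z ,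
    sym (trans (·-assoc u γ v)
      (trans (·-assoc γ′ (inv (γ · v)) (γ · v))
        (trans (cong (γ′ ·_) (inv-inverseˡ (γ · v) detγv≡1)) (·-identityʳ γ′))))
    where
    v = unipotent x y z
    u = γ′ · inv (γ · v)
    detγv≡1 = trans (det-·-unipotent γ x y z) det≡1

  ∼⇒translate : ∀ {γ γ′} → γ ∼ γ′ → ∃[ x ] ∃[ y ] ∃[ z ] plücker γ′ ≡ translate x y z (plücker γ)
  ∼⇒translate {γ} (u , v , u∈ , v∈ , refl)
    with p , q , r , refl ← Γ∞-unipotent u∈ | x , y , z , refl ← Γ∞-unipotent v∈ =
    x , y , z , trans (plücker-·ʳ (unipotent p q r · γ) x y z) (cong (translate x y z) (plücker-·ˡ p q r γ))

  -- Quotients and remainders under shifts by multiples of n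

  module _ (n : ℕ) .{{_ : ℕ.NonZero n}} where

    %ℕ-shift : ∀ a x → (a + + n * x) %ℕ n ≡ a %ℕ n
    %ℕ-shift a x = mod-injective (n%ℕd<d (a + + n * x) n) (n%ℕd<d a n)
      (mod-trans (%ℕ-mod (a + + n * x)) (mod-trans
        (congruent (divides x (lemma a (+ n) x))) (mod-sym (%ℕ-mod a))))
      where lemma : ∀ a n x → a + n * x - a ≡ x * n
            lemma = solve-∀

    /ℕ-shift : ∀ a x → (a + + n * x) /ℕ n ≡ a /ℕ n + x
    /ℕ-shift a x = ℤ.*-cancelʳ-≡ _ _ (+ n) (+-cancelˡ (+ (a %ℕ n)) _ _ (trans
      (trans (cong (λ r → + r + (a + + n * x) /ℕ n * + n) (sym (%ℕ-shift a x)))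
        (sym (a≡a%ℕn+[a/ℕn]*n (a + + n * x) n)))
      (trans (cong (_+ + n * x) (a≡a%ℕn+[a/ℕn]*n a n)) (lemma (+ (a %ℕ n)) (a /ℕ n) (+ n) x))))
      where lemma : ∀ r q n x → r + q * n + n * x ≡ r + (q + x) * n
            lemma = solve-∀

    small-%ℕ : ∀ {a} → a ℕ.< n → (+ a) %ℕ n ≡ a
    small-%ℕ {a} a<n = mod-injective (n%ℕd<d (+ a) n) a<n (%ℕ-mod (+ a))

    small-/ℕ : ∀ {a} → a ℕ.< n → (+ a) /ℕ n ≡ 0ℤ
    small-/ℕ {a} a<n = ℤ.*-cancelʳ-≡ _ _ (+ n) (+-cancelˡ (+ a) _ _
      (trans (cong (λ r → + r + (+ a) /ℕ n * + n) (sym (small-%ℕ a<n)))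
        (trans (sym (a≡a%ℕn+[a/ℕn]*n (+ a) n)) (lemma (+ a) (+ n)))))
      where lemma : ∀ a n → a ≡ a + 0ℤ * n
            lemma = solve-∀

  4*/ℕ4 : ∀ x → (+ 4 * x) /ℕ 4 ≡ x
  4*/ℕ4 x = trans (cong (_/ℕ 4) (sym (ℤ.+-identityˡ (+ 4 * x)))) (trans (/ℕ-shift 4 0ℤ x) (ℤ.+-identityˡ x))

  4∣⇒≡4*/ℕ4 : ∀ {x} → + 4 ∣ x → x ≡ + 4 * (x /ℕ 4)
  4∣⇒≡4*/ℕ4 (divides q refl) =
    trans (ℤ.*-comm q (+ 4)) (cong (+ 4 *_) (sym (trans (cong (_/ℕ 4) (ℤ.*-comm q (+ 4))) (4*/ℕ4 q))))

  -- Unipotent matrices form a Heisenberg group, and the translation in question is by v⁻¹v′; y′ - y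
  -- - x(z′ - z) is its upper right entry.
  translate-difference : ∀ x y z x′ y′ z′ p →
    translate x′ y′ z′ p ≡ translate (x′ - x) (y′ - y - x * (z′ - z)) (z′ - z) (translate x y z p)
  translate-difference x y z x′ y′ z′ ⟨ g , h , i ∣ k , l , m ⟩ = plücker-cong
    refl (e₂ g h x x′) (e₃ g h i x y z y′ z′) (e₄ k l m x y z x′ y′ z′) (e₅ l m z z′) refl
    where
    e₂ : ∀ g h x x′ → g * x′ + h ≡ g * (x′ - x) + (g * x + h)
    e₂ = solve-∀
    e₃ : ∀ g h i x y z y′ z′ → g * y′ + h * z′ + i ≡
      g * (y′ - y - x * (z′ - z)) + (g * x + h) * (z′ - z) + (g * y + h * z + i)
    e₃ = solve-∀
    e₄ : ∀ k l m x y z x′ y′ z′ → k + x′ * l + (x′ * z′ - y′) * m ≡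
      k + x * l + (x * z - y) * m + (x′ - x) * (l + z * m) + ((x′ - x) * (z′ - z) - (y′ - y - x * (z′ - z))) * m
    e₄ = solve-∀
    e₅ : ∀ l m z z′ → l + z′ * m ≡ l + z * m + (z′ - z) * m
    e₅ = solve-∀

  -- The coordinates with A₁ = - A₂ = n, C₁ = 4c - 1 and C₂ = 4(c - q) - 1; the Plücker
  -- relation becomes b₁b₂ = nq.
  coordinates : (n b₁ b₂ c q : ℤ) → Plücker
  coordinates n b₁ b₂ c q =
    ⟨ - (+ 4 * n) , - (+ 4 * b₁) , 1ℤ - + 4 * c ∣ 1ℤ - + 4 * (c - q) , + 4 * b₂ , + 4 * n ⟩

  -- The new q is forced by (b₁ + nx)(b₂ + nz) = nq′. The summand b₁z in the third parameter is why
  -- C₁ modulo 4n is not invariant by itself.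
  translate-coordinates : ∀ x y z n b₁ b₂ c q → translate x y z (coordinates n b₁ b₂ c q) ≡
    coordinates n (b₁ + n * x) (b₂ + n * z) (c + n * y + b₁ * z) (q + x * b₂ + b₁ * z + n * (x * z))
  translate-coordinates x y z n b₁ b₂ c q = plücker-cong
    refl (e₂ x n b₁) (e₃ y z n b₁ c) (e₄ x y z n b₁ b₂ c q) (e₅ z n b₂) refl
    where
    e₂ : ∀ x n b → - (+ 4 * n) * x + - (+ 4 * b) ≡ - (+ 4 * (b + n * x))
    e₂ = solve-∀
    e₃ : ∀ y z n b c → - (+ 4 * n) * y + - (+ 4 * b) * z + (1ℤ - + 4 * c) ≡ 1ℤ - + 4 * (c + n * y + b * z)
    e₃ = solve-∀
    e₄ : ∀ x y z n b₁ b₂ c q →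
      1ℤ - + 4 * (c - q) + x * (+ 4 * b₂) + (x * z - y) * (+ 4 * n) ≡
      1ℤ - + 4 * (c + n * y + b₁ * z - (q + x * b₂ + b₁ * z + n * (x * z)))
    e₄ = solve-∀
    e₅ : ∀ z n b → + 4 * b + z * (+ 4 * n) ≡ + 4 * (b + n * z)
    e₅ = solve-∀

  -- The c of C₁ = 4c - 1, as C₁ = -i.
  C-parameter : Matrix → ℤ
  C-parameter γ = (1ℤ - Matrix.i γ) /ℕ 4

  record HasCoordinates (n b₁ b₂ c q : ℤ) (γ : Matrix) : Set where
    field
      A₁≡ : A₁ γ ≡ n
      B₁≡ : B₁ γ ≡ b₁
      C₁≡ : C₁ γ ≡ + 4 * c - 1ℤ
      A₂≡ : A₂ γ ≡ - n
      B₂≡ : B₂ γ ≡ b₂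
      C₂≡ : C₂ γ ≡ + 4 * (c - q) - 1ℤ
      c≡  : C-parameter γ ≡ c

  hasCoordinates : ∀ γ n b₁ b₂ c q → plücker γ ≡ coordinates n b₁ b₂ c q → HasCoordinates n b₁ b₂ c q γ
  hasCoordinates (mat _ _ _ d e f g h i) n b₁ b₂ c q eq = record
    { A₁≡ = quarter (cong (λ p → - Plücker.row₁ p) eq) (neg-neg (+ 4) n)
    ; B₁≡ = quarter (cong (λ p → - Plücker.row₂ p) eq) (neg-neg (+ 4) b₁)
    ; C₁≡ = trans (cong (λ p → - Plücker.row₃ p) eq) (flip c)
    ; A₂≡ = quarter (cong (λ p → - Plücker.minor₁₂ p) eq) (neg (+ 4) n)
    ; B₂≡ = quarter (cong Plücker.minor₁₃ eq) refl
    ; C₂≡ = trans (cong (λ p → - Plücker.minor₂₃ p) eq) (flip (c - q))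
    ; c≡  = quarter (cong (λ p → 1ℤ - Plücker.row₃ p) eq) (one-minus c)
    }
    where
    quarter : ∀ {x y z} → x ≡ y → y ≡ + 4 * z → x /ℕ 4 ≡ z
    quarter {z = z} refl refl = 4*/ℕ4 z
    neg-neg : ∀ k n → - - (k * n) ≡ k * n
    neg-neg = solve-∀
    neg : ∀ k n → - (k * n) ≡ k * - n
    neg = solve-∀
    flip : ∀ c → - (1ℤ - + 4 * c) ≡ + 4 * c - 1ℤ
    flip = solve-∀
    one-minus : ∀ c → 1ℤ - (1ℤ - + 4 * c) ≡ + 4 * c
    one-minus = solve-∀

  abstract

    -- The third row is orthogonal to the vector of its signed minors. Writing C₁ = 4x - 1 and C₂ =
    -- 4y - 1, this Plücker relation is 16 times b₁b₂ = n(x - y), which determines q.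
    𝕊⇒coordinates : ∀ {n γ} .{{_ : ℤ.NonZero n}} → 𝕊 n (- n) γ → ∃[ q ]
      plücker γ ≡ coordinates n (B₁ γ) (B₂ γ) (C-parameter γ) q × B₁ γ * B₂ γ ≡ n * q
    𝕊⇒coordinates {n} {γ@(mat a b c d e f g h i)} s = x - y ,
      plücker-cong g≡ h≡ i≡ (trans k≡ (cong (λ z → 1ℤ - + 4 * z) (sym (sub-sub x y)))) l≡ m≡ ,
      ℤ.*-cancelˡ-≡ (+ 16) _ _ (trans (regroup (B₁ γ) (B₂ γ) n x y)
        (trans (cong (_+ + 16 * (n * (x - y))) relation) (ℤ.+-identityˡ _)))
      where
      open 𝕊 s
      open Γ γ∈Γ
      x y : ℤ
      x = C-parameter γ
      y = (1ℤ - (e * i - f * h)) /ℕ 4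
      neg-move : ∀ {x y} → - x ≡ y → x ≡ - y
      neg-move {x} eq = trans (sym (ℤ.neg-involutive x)) (cong -_ eq)
      one-move : ∀ {x y} → 1ℤ - x ≡ y → x ≡ 1ℤ - y
      one-move {x} refl = lemma x
        where lemma : ∀ x → x ≡ 1ℤ - (1ℤ - x)
              lemma = solve-∀
      sub-sub : ∀ x y → x - (x - y) ≡ y
      sub-sub = solve-∀
      g≡ : g ≡ - (+ 4 * n)
      g≡ = neg-move (trans (4∣⇒≡4*/ℕ4 (∣m⇒∣-m g≡0[4])) (cong (+ 4 *_) A₁≡a₁))
      h≡ : h ≡ - (+ 4 * B₁ γ)
      h≡ = neg-move (4∣⇒≡4*/ℕ4 (∣m⇒∣-m h≡0[4]))
      i≡ : i ≡ 1ℤ - + 4 * x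
      i≡ = one-move (4∣⇒≡4*/ℕ4 (subst (+ 4 ∣_) (lemma i) (∣m⇒∣-m i≡1[4])))
        where lemma : ∀ i → - (i - 1ℤ) ≡ 1ℤ - i
              lemma = solve-∀
      k≡ : e * i - f * h ≡ 1ℤ - + 4 * y
      k≡ = one-move (4∣⇒≡4*/ℕ4 (subst (+ 4 ∣_) (lemma e f h i)
        (∣m∣n⇒∣m+n (∣m∣n⇒∣m+n (∣n⇒∣m*n (- i) e≡1[4]) (∣m⇒∣-m i≡1[4])) (∣n⇒∣m*n f h≡0[4]))))
        where lemma : ∀ e f h i → - i * (e - 1ℤ) + - (i - 1ℤ) + f * h ≡ 1ℤ - (e * i - f * h)
              lemma = solve-∀
      l≡ : d * i - f * g ≡ + 4 * B₂ γ
      l≡ = 4∣⇒≡4*/ℕ4 (∣m∣n⇒∣m-n (∣m⇒∣m*n i d≡0[4]) (∣n⇒∣m*n f g≡0[4]))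
      m≡ : d * h - e * g ≡ + 4 * n
      m≡ = trans (neg-move (trans (4∣⇒≡4*/ℕ4 (∣m⇒∣-m (∣m∣n⇒∣m-n (∣m⇒∣m*n h d≡0[4]) (∣n⇒∣m*n e g≡0[4]))))
        (cong (+ 4 *_) A₂≡a₂))) (lemma n)
        where lemma : ∀ n → - (+ 4 * - n) ≡ + 4 * n
              lemma = solve-∀
      relation : (- (+ 4 * n)) * (1ℤ - + 4 * y) - (- (+ 4 * B₁ γ)) * (+ 4 * B₂ γ) + (1ℤ - + 4 * x) * (+ 4 * n) ≡ 0ℤ
      relation = trans (sym (cong₂ _+_ (cong₂ _-_ (cong₂ _*_ g≡ k≡) (cong₂ _*_ h≡ l≡)) (cong₂ _*_ i≡ m≡)))
        (lemma d e f g h i)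
        where lemma : ∀ d e f g h i → g * (e * i - f * h) - h * (d * i - f * g) + i * (d * h - e * g) ≡ 0ℤ
              lemma = solve-∀
      regroup : ∀ u v n x y → + 16 * (u * v) ≡
        (- (+ 4 * n)) * (1ℤ - + 4 * y) - (- (+ 4 * u)) * (+ 4 * v) + (1ℤ - + 4 * x) * (+ 4 * n) + + 16 * (n * (x - y))
      regroup = solve-∀

  -- Passing from k to k + 1 squares the error term of the inverse.
  1-4c-inverse : ∀ k c → ∃[ w ] ∃[ t ] (1ℤ - + 4 * c) * w + + 4 * + (2 ℕ.^ k) * t ≡ 1ℤ
  1-4c-inverse zero c = 1ℤ , c , lemma c
    where lemma : ∀ c → (1ℤ - + 4 * c) * 1ℤ + + 4 * 1ℤ * c ≡ 1ℤ
          lemma = solve-∀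
  1-4c-inverse (suc k) c with w , t , eq ← 1-4c-inverse k c =
    w * (1ℤ + + 4 * n * t) , + 2 * n * t * t ,
    trans (cong (λ z → (1ℤ - + 4 * c) * (w * (1ℤ + + 4 * n * t)) + + 4 * z * (+ 2 * n * t * t)) (ℤ.pos-* 2 (2 ℕ.^ k)))
      (trans (lemma (1ℤ - + 4 * c) w n t)
        (trans (cong (λ z → z * (1ℤ + + 4 * n * t) - + 4 * n * t) eq) (finish (+ 4 * n * t))))
    where
    n = + (2 ℕ.^ k)
    lemma : ∀ m w n t → m * (w * (1ℤ + + 4 * n * t)) + + 4 * (+ 2 * n) * (+ 2 * n * t * t) ≡
      (m * w + + 4 * n * t) * (1ℤ + + 4 * n * t) - + 4 * n * t
    lemma = solve-∀
    finish : ∀ e → 1ℤ * (1ℤ + e) - e ≡ 1ℤ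
    finish = solve-∀

  -- Let R be the prescribed third row and M the vector of signed minors; R·M = 0 by b₁b₂ = nq.
  -- Since 1 - 4c is invertible modulo 4n, v = (-u, 0, w) satisfies v·R = 1. The second row is v ×
  -- M, because (v × M) × R = (v·R)M - (R·M)v = M. The first row (r, 0, t) is likewise chosen with
  -- product 1 against M, so the determinant is 1.
  build : ∀ k b₁ b₂ c q → b₁ * b₂ ≡ + (2 ℕ.^ k) * q →
    ∃[ γ ] Γ γ × plücker γ ≡ coordinates (+ (2 ℕ.^ k)) b₁ b₂ c q
  build k b₁ b₂ c q b₁b₂≡nq
    with w , u , wu≡1 ← 1-4c-inverse k c | r , t , rt≡1 ← 1-4c-inverse k (c - q) =
    mat r 0ℤ t (+ 4 * w * b₂) (w * (1ℤ - + 4 * (c - q)) + + 4 * n * u) (+ 4 * u * b₂)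
      (- (+ 4 * n)) (- (+ 4 * b₁)) (1ℤ - + 4 * c) ,
    record
      { det≡1  = trans (cong₂ (λ x y → r * x - 0ℤ * (d * i - f * g) + t * y) minor₂₃≡ minor₁₂≡)
                   (trans (det-lemma r t n (c - q) (d * i - f * g)) rt≡1)
      ; a≡1[4] = divides ((c - q) * r - n * t) (trans (cong (λ z → r - z) (sym rt≡1)) (a-lemma r t n (c - q)))
      ; e≡1[4] = divides (c * w - w * (c - q)) (trans (cong (λ z → e - z) (sym wu≡1)) (e-lemma w u n c (c - q)))
      ; i≡1[4] = divides (- c) (i-lemma c)
      ; d≡0[4] = divides (w * b₂) (d-lemma (+ 4) w b₂)
      ; g≡0[4] = divides (- n) (g-lemma (+ 4) n)
      ; h≡0[4] = divides (- b₁) (g-lemma (+ 4) b₁)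
      } ,
    plücker-cong refl refl refl minor₂₃≡ minor₁₃≡ minor₁₂≡
    where
    n = + (2 ℕ.^ k)
    d = + 4 * w * b₂
    e = w * (1ℤ - + 4 * (c - q)) + + 4 * n * u
    f = + 4 * u * b₂
    g = - (+ 4 * n)
    h = - (+ 4 * b₁)
    i = 1ℤ - + 4 * c
    H₁ H₂ : ℤ
    H₁ = (1ℤ - + 4 * c) * w + + 4 * n * u - 1ℤ
    H₂ = b₁ * b₂ - n * q
    H₁≡0 : H₁ ≡ 0ℤ
    H₁≡0 = cong (_- 1ℤ) wu≡1
    H₂≡0 : H₂ ≡ 0ℤ
    H₂≡0 = trans (cong (_- n * q) b₁b₂≡nq) (ℤ.+-inverseʳ (n * q))
    -- Each minor equals its prescribed value up to explicit multiples of `H₁` and `H₂`, so only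
    -- polynomial identities remain for the ring solver.
    reduce : ∀ {l} m x y → l ≡ m + x * H₁ + y * H₂ → l ≡ m
    reduce m x y eq = trans eq (trans (cong₂ (λ z z′ → m + x * z + y * z′) H₁≡0 H₂≡0) (lemma m x y))
      where lemma : ∀ m x y → m + x * 0ℤ + y * 0ℤ ≡ m
            lemma = solve-∀
    minor₂₃≡ : e * i - f * h ≡ 1ℤ - + 4 * (c - q)
    minor₂₃≡ = reduce _ (1ℤ - + 4 * (c - q)) (+ 16 * u) (lemma w u n c q b₁ b₂)
      where lemma : ∀ w u n c q b₁ b₂ →
              (w * (1ℤ - + 4 * (c - q)) + + 4 * n * u) * (1ℤ - + 4 * c) - + 4 * u * b₂ * (- (+ 4 * b₁)) ≡
              1ℤ - + 4 * (c - q) + (1ℤ - + 4 * (c - q)) * ((1ℤ - + 4 * c) * w + + 4 * n * u - 1ℤ)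
                + + 16 * u * (b₁ * b₂ - n * q)
            lemma = solve-∀
    minor₁₃≡ : d * i - f * g ≡ + 4 * b₂
    minor₁₃≡ = reduce _ (+ 4 * b₂) 0ℤ (lemma w u n c q b₁ b₂)
      where lemma : ∀ w u n c q b₁ b₂ →
              + 4 * w * b₂ * (1ℤ - + 4 * c) - + 4 * u * b₂ * (- (+ 4 * n)) ≡
              + 4 * b₂ + + 4 * b₂ * ((1ℤ - + 4 * c) * w + + 4 * n * u - 1ℤ) + 0ℤ * (b₁ * b₂ - n * q)
            lemma = solve-∀
    minor₁₂≡ : d * h - e * g ≡ + 4 * n
    minor₁₂≡ = reduce _ (+ 4 * n) (- (+ 16 * w)) (lemma w u n c q b₁ b₂)
      where lemma : ∀ w u n c q b₁ b₂ →
              + 4 * w * b₂ * (- (+ 4 * b₁)) - (w * (1ℤ - + 4 * (c - q)) + + 4 * n * u) * (- (+ 4 * n)) ≡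
              + 4 * n + + 4 * n * ((1ℤ - + 4 * c) * w + + 4 * n * u - 1ℤ) + - (+ 16 * w) * (b₁ * b₂ - n * q)
            lemma = solve-∀
    det-lemma : ∀ r t n x y → r * (1ℤ - + 4 * x) - 0ℤ * y + t * (+ 4 * n) ≡ (1ℤ - + 4 * x) * r + + 4 * n * t
    det-lemma = solve-∀
    a-lemma : ∀ r t n x → r - ((1ℤ - + 4 * x) * r + + 4 * n * t) ≡ (x * r - n * t) * + 4
    a-lemma = solve-∀
    e-lemma : ∀ w u n c x → w * (1ℤ - + 4 * x) + + 4 * n * u - ((1ℤ - + 4 * c) * w + + 4 * n * u) ≡
      (c * w - w * x) * + 4
    e-lemma = solve-∀
    i-lemma : ∀ c → 1ℤ - + 4 * c - 1ℤ ≡ - c * + 4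
    i-lemma = solve-∀
    d-lemma : ∀ k w b → k * w * b ≡ w * b * k
    d-lemma = solve-∀
    g-lemma : ∀ k n → - (k * n) ≡ - n * k
    g-lemma = solve-∀

  -- Double cosets

  Key : Set
  Key = ℕ × ℕ × ℕ

  module _ (k : ℕ) where

    private
      n : ℕ
      n = 2 ℕ.^ k

      instance
        n≢0 : ℕ.NonZero n
        n≢0 = 2^n≢0 k

        n≢0ℤ : ℤ.NonZero (+ n)
        n≢0ℤ = ℤ.≢-nonZero λ eq → ℕ.≢-nonZero⁻¹ n (ℤ.+-injective eq)

    -- B₁, B₂ mod n are invariants of the double coset; the translation of B₂ by nz moves
    -- the parameter of C₁ by B₁z, which the last component compensates.
    key : Matrix → Key
    key γ = B₁ γ %ℕ n , B₂ γ %ℕ n , (C-parameter γ - B₁ γ * (B₂ γ /ℕ n)) %ℕ n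

    Admissible : Key → Set
    Admissible (b₁ , b₂ , _) = n ℕ∣.∣ b₁ ℕ.* b₂

    admissible? : ∀ κ → Dec (Admissible κ)
    admissible? (b₁ , b₂ , _) = n ℕ∣.∣? b₁ ℕ.* b₂

    keys : List Key
    keys = filter admissible? (cartesianProduct (upTo n) (cartesianProduct (upTo n) (upTo n)))

    keys-unique : Unique keys
    keys-unique = Unique.filter⁺ admissible?
      (Unique.cartesianProduct⁺ (Unique.upTo⁺ n) (Unique.cartesianProduct⁺ (Unique.upTo⁺ n) (Unique.upTo⁺ n)))

    record IsKey (κ : Key) : Set where
      field
        b₁<n : proj₁ κ ℕ.< n
        b₂<n : proj₁ (proj₂ κ) ℕ.< n
        c<n  : proj₂ (proj₂ κ) ℕ.< n
        admissible : Admissible κ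

    ∈-keys⁺ : ∀ {κ} → IsKey κ → κ ∈ keys
    ∈-keys⁺ κ = ∈-filter⁺ admissible?
      (∈-cartesianProduct⁺ (∈-upTo⁺ b₁<n) (∈-cartesianProduct⁺ (∈-upTo⁺ b₂<n) (∈-upTo⁺ c<n))) admissible
      where open IsKey κ

    ∈-keys⁻ : ∀ {κ} → κ ∈ keys → IsKey κ
    ∈-keys⁻ {κ} κ∈ with ∈-filter⁻ admissible? {xs = cartesianProduct (upTo n) (cartesianProduct (upTo n) (upTo n))} κ∈
    ... | κ∈′ , adm with ∈-cartesianProduct⁻ (upTo n) (cartesianProduct (upTo n) (upTo n)) κ∈′
    ... | b₁∈ , κ∈″ with ∈-cartesianProduct⁻ (upTo n) (upTo n) κ∈″
    ... | b₂∈ , c∈ = record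
      { b₁<n = ∈-upTo⁻ b₁∈ ; b₂<n = ∈-upTo⁻ b₂∈ ; c<n = ∈-upTo⁻ c∈ ; admissible = adm }

    𝕊ₖ : Matrix → Set
    𝕊ₖ = 𝕊 (+ n) (- (+ n))

    record Translated (b₁ b₂ c : ℤ) (γ : Matrix) : Set where
      field
        q x y z : ℤ
        relation : b₁ * b₂ ≡ + n * q
        plücker≡ : plücker γ ≡ translate x y z (coordinates (+ n) b₁ b₂ c q)

      hasCoordinates′ : HasCoordinates (+ n) (b₁ + + n * x) (b₂ + + n * z)
        (c + + n * y + b₁ * z) (q + x * b₂ + b₁ * z + + n * (x * z)) γ
      hasCoordinates′ = hasCoordinates _ _ (b₁ + + n * x) (b₂ + + n * z)
        (c + + n * y + b₁ * z) (q + x * b₂ + b₁ * z + + n * (x * z))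
        (trans plücker≡ (translate-coordinates x y z (+ n) b₁ b₂ c q))

    NormalForm : Key → Matrix → Set
    NormalForm (b₁ , b₂ , c) = Translated (+ b₁) (+ b₂) (+ c)

    normalForm : ∀ {γ} → 𝕊ₖ γ → NormalForm (key γ) γ
    normalForm {γ} γ∈ with q , plücker≡ , relation ← 𝕊⇒coordinates γ∈ = record
      -- The key divides c - B₁z by n, whereas `translate-coordinates` uses the reduced b₁ = B₁ -
      -- nx. The difference nxz accounts for the xz in the translation.
      { q = q₀ ; x = x ; y = y + x * z ; z = z
      ; relation = ℤ-cancel (trans (sym (expand b₁ b₂ (+ n) x z)) (trans (sym (cong₂ _*_ B₁≡ B₂≡)) relation))
      ; plücker≡ = trans plücker≡ (trans
          (coordinates-cong B₁≡ B₂≡ c≡ (q-lemma q x b₂ b₁ z (+ n)))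
          (sym (translate-coordinates x (y + x * z) z (+ n) b₁ b₂ c q₀)))
      }
      where
      x = B₁ γ /ℕ n
      z = B₂ γ /ℕ n
      y = (C-parameter γ - B₁ γ * z) /ℕ n
      b₁ = + (B₁ γ %ℕ n)
      b₂ = + (B₂ γ %ℕ n)
      c = + ((C-parameter γ - B₁ γ * z) %ℕ n)
      q₀ = q - x * b₂ - b₁ * z - + n * (x * z)
      divide : ∀ a → a ≡ + (a %ℕ n) + + n * (a /ℕ n)
      divide a = trans (a≡a%ℕn+[a/ℕn]*n a n) (cong (_+_ (+ (a %ℕ n))) (ℤ.*-comm (a /ℕ n) (+ n)))
      B₁≡ : B₁ γ ≡ b₁ + + n * x
      B₁≡ = divide (B₁ γ)
      B₂≡ : B₂ γ ≡ b₂ + + n * z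
      B₂≡ = divide (B₂ γ)
      c≡ : C-parameter γ ≡ c + + n * (y + x * z) + b₁ * z
      c≡ = trans (move (C-parameter γ) (B₁ γ * z))
        (trans (cong₂ _+_ (divide (C-parameter γ - B₁ γ * z)) (cong (_* z) B₁≡)) (lemma c (+ n) x y z b₁))
        where
        move : ∀ c t → c ≡ c - t + t
        move = solve-∀
        lemma : ∀ c n x y z b → c + n * y + (b + n * x) * z ≡ c + n * (y + x * z) + b * z
        lemma = solve-∀
      coordinates-cong : ∀ {a a′ b b′ c c′ q q′} → a ≡ a′ → b ≡ b′ → c ≡ c′ → q ≡ q′ →
        coordinates (+ n) a b c q ≡ coordinates (+ n) a′ b′ c′ q′
      coordinates-cong refl refl refl refl = refl
      q-lemma : ∀ q x b₂ b₁ z n → q ≡ (q - x * b₂ - b₁ * z - n * (x * z)) + x * b₂ + b₁ * z + n * (x * z)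
      q-lemma = solve-∀
      expand : ∀ b₁ b₂ n x z → (b₁ + n * x) * (b₂ + n * z) ≡ b₁ * b₂ + n * (x * b₂ + b₁ * z + n * (x * z))
      expand = solve-∀
      ℤ-cancel : b₁ * b₂ + + n * (x * b₂ + b₁ * z + + n * (x * z)) ≡ + n * q → b₁ * b₂ ≡ + n * q₀
      ℤ-cancel eq = trans (add-sub (b₁ * b₂) (+ n * (x * b₂ + b₁ * z + + n * (x * z))))
        (trans (cong (_- + n * (x * b₂ + b₁ * z + + n * (x * z))) eq) (lemma (+ n) q x b₂ b₁ z))
        where
        add-sub : ∀ a b → a ≡ a + b - b
        add-sub = solve-∀
        lemma : ∀ n q x b₂ b₁ z → n * q - n * (x * b₂ + b₁ * z + n * (x * z)) ≡
          n * (q - x * b₂ - b₁ * z - n * (x * z))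
        lemma = solve-∀

    isKey : ∀ {γ} → 𝕊ₖ γ → IsKey (key γ)
    isKey {γ} γ∈ = record
      { b₁<n = n%ℕd<d (B₁ γ) n
      ; b₂<n = n%ℕd<d (B₂ γ) n
      ; c<n  = n%ℕd<d (C-parameter γ - B₁ γ * (B₂ γ /ℕ n)) n
      ; admissible = ∣⇒∣ᵤ (divides q (trans (ℤ.pos-* (B₁ γ %ℕ n) (B₂ γ %ℕ n)) (trans relation (ℤ.*-comm (+ n) q))))
      }
      where open Translated (normalForm γ∈)

    -- Both matrices are translates of one base point: its q is determined by b₁b₂ = nq with n ≠ 0.
    -- Hence each is a translate of the other.
    translated⇒∼ : ∀ {b₁ b₂ c γ γ′} → 𝕊ₖ γ → 𝕊ₖ γ′ → Translated b₁ b₂ c γ → Translated b₁ b₂ c γ′ → γ ∼ γ′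
    translated⇒∼ {b₁} {b₂} {c} {γ} {γ′} γ∈ γ′∈ ν ν′ =
      translate⇒∼ _ _ _ (Γ.det≡1 (𝕊.γ∈Γ γ∈)) (Γ.det≡1 (𝕊.γ∈Γ γ′∈))
        (trans ν′.plücker≡ (trans (cong (translate ν′.x ν′.y ν′.z ∘ coordinates (+ n) b₁ b₂ c) q′≡q)
          (trans (translate-difference ν.x ν.y ν.z ν′.x ν′.y ν′.z (coordinates (+ n) b₁ b₂ c ν.q))
            (cong (translate (ν′.x - ν.x) (ν′.y - ν.y - ν.x * (ν′.z - ν.z)) (ν′.z - ν.z)) (sym ν.plücker≡)))))
      where
      module ν = Translated ν
      module ν′ = Translated ν′
      q′≡q : ν′.q ≡ ν.q
      q′≡q = ℤ.*-cancelˡ-≡ (+ n) _ _ (trans (sym ν′.relation) ν.relation)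

    key≡⇒∼ : ∀ {γ γ′} → 𝕊ₖ γ → 𝕊ₖ γ′ → key γ ≡ key γ′ → γ ∼ γ′
    key≡⇒∼ γ∈ γ′∈ eq =
      translated⇒∼ γ∈ γ′∈ (normalForm γ∈) (subst (λ κ → NormalForm κ _) (sym eq) (normalForm γ′∈))

    ∼⇒key≡ : ∀ {γ γ′} → 𝕊ₖ γ → γ ∼ γ′ → key γ ≡ key γ′
    ∼⇒key≡ {γ} {γ′} γ∈ γ∼γ′ with x , y , z , translate≡ ← ∼⇒translate γ∼γ′ | q , plücker≡ , _ ← 𝕊⇒coordinates γ∈ =
      cong₂ _,_ (sym B₁′≡) (cong₂ _,_ (sym B₂′≡) (sym c′≡))
      where
      open HasCoordinates (hasCoordinates γ′ (+ n) (B₁ γ + + n * x) (B₂ γ + + n * z)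
        (C-parameter γ + + n * y + B₁ γ * z) (q + x * B₂ γ + B₁ γ * z + + n * (x * z))
        (trans translate≡ (trans (cong (translate x y z) plücker≡)
        (translate-coordinates x y z (+ n) (B₁ γ) (B₂ γ) (C-parameter γ) q))))
      B₁′≡ : B₁ γ′ %ℕ n ≡ B₁ γ %ℕ n
      B₁′≡ = trans (cong (_%ℕ n) B₁≡) (%ℕ-shift n (B₁ γ) x)
      B₂′≡ : B₂ γ′ %ℕ n ≡ B₂ γ %ℕ n
      B₂′≡ = trans (cong (_%ℕ n) B₂≡) (%ℕ-shift n (B₂ γ) z)
      c′≡ : (C-parameter γ′ - B₁ γ′ * (B₂ γ′ /ℕ n)) %ℕ n ≡ (C-parameter γ - B₁ γ * (B₂ γ /ℕ n)) %ℕ n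
      c′≡ = trans (cong (_%ℕ n) (trans
          (cong₂ _-_ c≡ (cong₂ _*_ B₁≡ (trans (cong (_/ℕ n) B₂≡) (/ℕ-shift n (B₂ γ) z))))
          (lemma (C-parameter γ) (B₁ γ) (B₂ γ /ℕ n) (+ n) x y z)))
        (%ℕ-shift n (C-parameter γ - B₁ γ * (B₂ γ /ℕ n)) (y - x * (B₂ γ /ℕ n + z)))
        where
        lemma : ∀ c b w n x y z → c + n * y + b * z - (b + n * x) * (w + z) ≡ c - b * w + n * (y - x * (w + z))
        lemma = solve-∀

    relation⁺ : ∀ b₁ b₂ (n∣ : n ℕ∣.∣ b₁ ℕ.* b₂) → + b₁ * + b₂ ≡ + n * + ℕ∣.quotient n∣
    relation⁺ b₁ b₂ n∣ = trans (sym (ℤ.pos-* b₁ b₂))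
      (trans (cong +_ (ℕ∣.m∣n⇒n≡m*quotient n∣)) (ℤ.pos-* n (ℕ∣.quotient n∣)))

    representative : Key → Matrix
    representative κ@(b₁ , b₂ , c) with admissible? κ
    ... | yes n∣ = proj₁ (build k (+ b₁) (+ b₂) (+ c) (+ ℕ∣.quotient n∣) (relation⁺ b₁ b₂ n∣))
    -- A default for triples that violate the Plücker relation; the list `keys` contains none.
    ... | no _   = I₃

    representative-coordinates : ∀ {b₁ b₂ c} → IsKey (b₁ , b₂ , c) → Γ (representative (b₁ , b₂ , c)) ×
      ∃[ q ] plücker (representative (b₁ , b₂ , c)) ≡ coordinates (+ n) (+ b₁) (+ b₂) (+ c) q
    representative-coordinates {b₁} {b₂} {c} κ with admissible? (b₁ , b₂ , c)
    ... | yes n∣ =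
      let γ∈Γ , plücker≡ = proj₂ (build k (+ b₁) (+ b₂) (+ c) (+ ℕ∣.quotient n∣) (relation⁺ b₁ b₂ n∣))
      in γ∈Γ , + ℕ∣.quotient n∣ , plücker≡
    ... | no ¬adm = contradiction (IsKey.admissible κ) ¬adm

    module _ {κ} (isKey : IsKey κ) where

      private
        coords : HasCoordinates (+ n) (+ proj₁ κ) (+ proj₁ (proj₂ κ)) (+ proj₂ (proj₂ κ))
          (proj₁ (proj₂ (representative-coordinates isKey))) (representative κ)
        coords = hasCoordinates (representative κ) _ _ _ _ _ (proj₂ (proj₂ (representative-coordinates isKey)))

      open IsKey isKey
      open HasCoordinates coords

      representative∈𝕊 : 𝕊ₖ (representative κ)
      representative∈𝕊 = record
        { γ∈Γ = proj₁ (representative-coordinates isKey) ; A₁≡a₁ = A₁≡ ; A₂≡a₂ = A₂≡ }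

      key-representative : key (representative κ) ≡ κ
      key-representative = cong₂ _,_ (trans (cong (_%ℕ n) B₁≡) (small-%ℕ n b₁<n))
        (cong₂ _,_ (trans (cong (_%ℕ n) B₂≡) (small-%ℕ n b₂<n))
          (trans (cong (_%ℕ n) (trans
            (cong₂ _-_ c≡ (trans (cong (B₁ (representative κ) *_) (trans (cong (_/ℕ n) B₂≡) (small-/ℕ n b₂<n)))
              (ℤ.*-zeroʳ (B₁ (representative κ)))))
            (ℤ.+-identityʳ (+ proj₂ (proj₂ κ))))) (small-%ℕ n c<n)))

    representatives : Representatives (+ n) (- (+ n)) (map representative keys)
    representatives = record
      { sound = All.map⁺ (All.tabulate (representative∈𝕊 ∘ ∈-keys⁻))
      ; complete = λ γ γ∈ → Any.map⁺ (lose (∈-keys⁺ (isKey γ∈))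
          (key≡⇒∼ (representative∈𝕊 (isKey γ∈)) γ∈ (key-representative (isKey γ∈))))
      ; irredundant = AllPairs.map⁺ (irredundant keys keys-unique (All.tabulate ∈-keys⁻))
      }
      where
      irredundant : ∀ κs → Unique κs → All IsKey κs →
        AllPairs (λ κ κ′ → ¬ representative κ ∼ representative κ′) κs
      irredundant []       []       []       = []
      irredundant (κ ∷ κs) (u ∷ us) (i ∷ is) =
        All.zipWith (λ { {κ′} (κ≢κ′ , i′) r∼r′ → κ≢κ′
          (trans (sym (key-representative i)) (trans (∼⇒key≡ (representative∈𝕊 i) r∼r′) (key-representative i′))) })
          (u , is)
        ∷ irredundant κs us is

    module _ {γs} (r : Representatives (+ n) (- (+ n)) γs) where

      open Representatives r

      key-unique : ∀ {γs} → All 𝕊ₖ γs → AllPairs (λ γ γ′ → ¬ γ ∼ γ′) γs → Unique (map key γs)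
      key-unique []       []       = []
      key-unique (s ∷ ss) (p ∷ ps) =
        All.map⁺ (All.zipWith (λ { (s′ , ¬∼) eq → ¬∼ (key≡⇒∼ s s′ eq) }) (ss , p)) ∷ key-unique ss ps

      -- This yields independence of the choice of representatives: both lists are free of
      -- repetitions and have the same elements, by irredundancy and completeness.
      map-key↭keys : map key γs ↭ keys
      map-key↭keys = ∼bag⇒↭ (unique∧set⇒bag (key-unique sound irredundant) keys-unique λ {κ} → mk⇔ to from)
        where
        to : ∀ {κ} → κ ∈ map key γs → κ ∈ keys
        to κ∈ with γ , γ∈γs , refl ← ∈-map⁻ key κ∈ = ∈-keys⁺ (isKey (All.lookup sound γ∈γs))
        from : ∀ {κ} → κ ∈ keys → κ ∈ map key γs
        from {κ} κ∈ with γ , γ∈γs , γ∼ ← find (complete (representative κ) (representative∈𝕊 (∈-keys⁻ κ∈))) =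
          subst (_∈ map key γs) (trans (∼⇒key≡ (All.lookup sound γ∈γs) γ∼) (key-representative (∈-keys⁻ κ∈)))
            (∈-map⁺ key γ∈γs)

  -- The splitting

  sgn : ℤ → ℤ
  sgn c = -1ℤ ^ ∣ c ∣

  parity : ∀ c → (∃[ q ] c ≡ q + q) ⊎ (∃[ q ] c ≡ 1ℤ + (q + q))
  parity (+ n) with even⊎odd n
  ... | inj₁ (w , refl) = inj₁ (+ w , refl)
  ... | inj₂ (w , refl) = inj₂ (+ w , refl)
  parity -[1+ n ] with even⊎odd n
  ... | inj₁ (w , refl) = inj₂ (- + suc w , lemma (+ w))
    where lemma : ∀ w → - (1ℤ + (w + w)) ≡ 1ℤ + (- (1ℤ + w) + - (1ℤ + w))
          lemma = solve-∀
  ... | inj₂ (w , refl) = inj₁ (- + suc w , lemma (+ w))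
    where lemma : ∀ w → - (1ℤ + (1ℤ + (w + w))) ≡ - (1ℤ + w) + - (1ℤ + w)
          lemma = solve-∀

  sgn-even : ∀ q → sgn (q + q) ≡ 1ℤ
  sgn-even (+ n)    = [-1]^2m≡1 n
  sgn-even -[1+ n ] = trans (cong (λ m → -1ℤ ^ suc m) (sym (ℕ.+-suc n n))) ([-1]^2m≡1 (suc n))

  sgn-odd : ∀ q → sgn (1ℤ + (q + q)) ≡ -1ℤ
  sgn-odd (+ n)    = cong (-1ℤ *_) ([-1]^2m≡1 n)
  sgn-odd -[1+ n ] = cong (-1ℤ *_) ([-1]^2m≡1 n)

  sgn-±1 : ∀ c → sgn c ≡ 1ℤ ⊎ sgn c ≡ -1ℤ
  sgn-±1 c with parity c
  ... | inj₁ (q , refl) = inj₁ (sgn-even q)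
  ... | inj₂ (q , refl) = inj₂ (sgn-odd q)

  sgn-+-even : ∀ c {d} → + 2 ∣ d → sgn (c + d) ≡ sgn c
  sgn-+-even c (divides q refl) with parity c
  ... | inj₁ (r , refl) = trans (cong sgn (lemma r q)) (trans (sgn-even (r + q)) (sym (sgn-even r)))
    where lemma : ∀ r q → r + r + q * + 2 ≡ (r + q) + (r + q)
          lemma = solve-∀
  ... | inj₂ (r , refl) = trans (cong sgn (lemma r q)) (trans (sgn-odd (r + q)) (sym (sgn-odd r)))
    where lemma : ∀ r q → 1ℤ + (r + r) + q * + 2 ≡ 1ℤ + ((r + q) + (r + q))
          lemma = solve-∀

  sgn-- : ∀ c d → sgn (c - d) ≡ sgn c * sgn d
  sgn-- c d with parity d
  ... | inj₁ (q , refl) = trans (sgn-+-even c (divides (- q) (lemma q)))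
    (sym (trans (cong (sgn c *_) (sgn-even q)) (ℤ.*-identityʳ (sgn c))))
    where lemma : ∀ q → - (q + q) ≡ - q * + 2
          lemma = solve-∀
  ... | inj₂ (q , refl) with parity c
  ...   | inj₁ (r , refl) = trans (cong sgn (lemma r q)) (trans (sgn-odd (r - q - 1ℤ))
            (sym (cong₂ _*_ (sgn-even r) (sgn-odd q))))
    where lemma : ∀ r q → r + r - (1ℤ + (q + q)) ≡ 1ℤ + ((r - q - 1ℤ) + (r - q - 1ℤ))
          lemma = solve-∀
  ...   | inj₂ (r , refl) = trans (cong sgn (lemma r q)) (trans (sgn-even (r - q))
            (sym (cong₂ _*_ (sgn-odd r) (sgn-odd q))))
    where lemma : ∀ r q → 1ℤ + (r + r) - (1ℤ + (q + q)) ≡ (r - q) + (r - q)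
          lemma = solve-∀

  χ₈-period : ∀ n → χ₈ (n ℕ.+ 8) ≡ χ₈ n
  χ₈-period n = cong χ₈-table ([m+n]%n≡m%n n 8)

  -- Raising m by 2 adds 8 to the argument, a full period. The argument is written as 2w + 1 with w
  -- = m + m, the form expected by `kroneckerℕ[2^n,odd]`.
  χ₈[1+4m] : ∀ m → χ₈ (suc ((m ℕ.+ m) ℕ.+ (m ℕ.+ m))) ≡ -1ℤ ^ m
  χ₈[1+4m] zero          = refl
  χ₈[1+4m] (suc zero)    = refl
  χ₈[1+4m] (suc (suc m)) = trans (cong χ₈ (lemma m))
    (trans (χ₈-period (suc ((m ℕ.+ m) ℕ.+ (m ℕ.+ m)))) (trans (χ₈[1+4m] m) (twice (-1ℤ ^ m))))
    where
    lemma : ∀ m → suc ((suc (suc m) ℕ.+ suc (suc m)) ℕ.+ (suc (suc m) ℕ.+ suc (suc m))) ≡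
      suc ((m ℕ.+ m) ℕ.+ (m ℕ.+ m)) ℕ.+ 8
    lemma = ℕ-Solver.solve-∀
    twice : ∀ x → x ≡ -1ℤ * (-1ℤ * x)
    twice = solve-∀

  χ₈[3+4m] : ∀ m → χ₈ (suc (suc (m ℕ.+ m) ℕ.+ suc (m ℕ.+ m))) ≡ -1ℤ ^ suc m
  χ₈[3+4m] zero          = refl
  χ₈[3+4m] (suc zero)    = refl
  χ₈[3+4m] (suc (suc m)) = trans (cong χ₈ (lemma m))
    (trans (χ₈-period (suc (suc (m ℕ.+ m) ℕ.+ suc (m ℕ.+ m)))) (trans (χ₈[3+4m] m) (twice (-1ℤ ^ suc m))))
    where
    lemma : ∀ m → suc (suc (suc (suc m) ℕ.+ suc (suc m)) ℕ.+ suc (suc (suc m) ℕ.+ suc (suc m))) ≡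
      suc (suc (m ℕ.+ m) ℕ.+ suc (m ℕ.+ m)) ℕ.+ 8
    lemma = ℕ-Solver.solve-∀
    twice : ∀ x → x ≡ -1ℤ * (-1ℤ * x)
    twice = solve-∀

  -- For c = m + 1 > 0 the denominator is 4m + 3, and for c = -m ≤ 0 it is -(4m + 1), where the sign
  -- contributes (2ʲ/-1) = 1. In both cases the character modulo 8 is the parity of c.
  kronecker[2^j,4c-1] : ∀ j c → kronecker (+ (2 ℕ.^ j)) (+ 4 * c - 1ℤ) ≡ sgn c ^ j
  kronecker[2^j,4c-1] j c = cases c
    where
    positive : ∀ m → kronecker (+ (2 ℕ.^ j)) (+ 4 * + suc m - 1ℤ) ≡ sgn (+ suc m) ^ j
    positive m = trans (cong (kronecker (+ (2 ℕ.^ j))) (lemma (+ m)))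
      (trans (kroneckerℕ[2^n,odd] j (suc (m ℕ.+ m))) (cong (_^ j) (χ₈[3+4m] m)))
      where lemma : ∀ m → + 4 * (1ℤ + m) - 1ℤ ≡ 1ℤ + ((1ℤ + (m + m)) + (1ℤ + (m + m)))
            lemma = solve-∀
    at-1 : ∀ x → kroneckerAt-1 (+ x) ≡ 1ℤ
    at-1 x rewrite dec-false (+ x ℤ.<? 0ℤ) (λ { (ℤ.+<+ ()) }) = refl
    nonpositive : ∀ m → kronecker (+ (2 ℕ.^ j)) (+ 4 * - + m - 1ℤ) ≡ sgn (- + m) ^ j
    nonpositive m = trans (cong (kronecker (+ (2 ℕ.^ j))) (lemma (+ m)))
      (trans (cong₂ _*_ (at-1 (2 ℕ.^ j)) (kroneckerℕ[2^n,odd] j (m ℕ.+ m)))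
        (trans (ℤ.*-identityˡ _) (cong (_^ j) (trans (χ₈[1+4m] m) (cong (-1ℤ ^_) (sym (ℤ.∣-i∣≡∣i∣ (+ m))))))))
      where lemma : ∀ m → + 4 * - m - 1ℤ ≡ - (1ℤ + ((m + m) + (m + m)))
            lemma = solve-∀
    cases : ∀ c → kronecker (+ (2 ℕ.^ j)) (+ 4 * c - 1ℤ) ≡ sgn c ^ j
    cases ℤ.+[1+ m ] = positive m
    cases (+ 0)      = nonpositive 0
    cases -[1+ m ]   = nonpositive (suc m)

  odd⇒coprime-2 : ∀ w → Coprime (suc (w ℕ.+ w)) 2
  odd⇒coprime-2 w (i∣odd , i∣2) with prime⇒irreducible (from-yes (prime? 2)) i∣2
  ... | inj₁ i≡1  = i≡1
  ... | inj₂ refl = contradiction i∣odd (odd⇒2∤ w)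

  ∣2^k⇒≡2^a : ∀ k {d} → d ℕ∣.∣ 2 ℕ.^ k → ∃[ a ] a ℕ.≤ k × d ≡ 2 ℕ.^ a
  ∣2^k⇒≡2^a zero    d∣ = 0 , z≤n , ℕ∣.∣1⇒≡1 d∣
  ∣2^k⇒≡2^a (suc k) {d} d∣ with even⊎odd d
  ... | inj₁ (w , refl) with a , a≤k , refl ← ∣2^k⇒≡2^a k {w}
          (ℕ∣.*-cancelˡ-∣ 2 (subst (ℕ∣._∣ 2 ℕ.* 2 ℕ.^ k) (cong (w ℕ.+_) (sym (ℕ.+-identityʳ w))) d∣)) =
    suc a , s≤s a≤k , cong (2 ℕ.^ a ℕ.+_) (sym (ℕ.+-identityʳ (2 ℕ.^ a)))
  ... | inj₂ (w , refl) with a , a≤k , eq ← ∣2^k⇒≡2^a k (coprime-divisor (odd⇒coprime-2 w) d∣) =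
    a , ℕ.m≤n⇒m≤1+n a≤k , eq

  2^-injective : ∀ {i j} → 2 ℕ.^ i ≡ 2 ℕ.^ j → i ≡ j
  2^-injective {i} {j} eq with ℕ.<-cmp i j
  ... | tri< i<j _ _ = contradiction eq (ℕ.<⇒≢ (ℕ.^-monoʳ-< 2 (s≤s (s≤s z≤n)) i<j))
  ... | tri≈ _ i≡j _ = i≡j
  ... | tri> _ _ j<i = contradiction (sym eq) (ℕ.<⇒≢ (ℕ.^-monoʳ-< 2 (s≤s (s≤s z≤n)) j<i))

  gcd[2^k,odd] : ∀ k w → ℕ.gcd (2 ℕ.^ k) (suc (w ℕ.+ w)) ≡ 1
  gcd[2^k,odd] k w with ∣2^k⇒≡2^a k (ℕ.gcd[m,n]∣m (2 ℕ.^ k) (suc (w ℕ.+ w)))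
  ... | zero  , _ , eq = eq
  ... | suc a , _ , eq = contradiction
    (ℕ∣.∣-trans (subst (2 ℕ∣.∣_) (sym eq) (ℕ∣.m∣m*n (2 ℕ.^ a))) (ℕ.gcd[m,n]∣n (2 ℕ.^ k) (suc (w ℕ.+ w)))) (odd⇒2∤ w)

  module _ (n : ℕ) .{{_ : ℕ.NonZero n}} where

    gcd-shift : ∀ b x → ℕ.gcd n ∣ + b + + n * x ∣ ≡ ℕ.gcd n b
    gcd-shift b x = ℕ∣.∣-antisym
      (ℕ.gcd-greatest (ℕ.gcd[m,n]∣m n ∣ b′ ∣)
        (∣⇒∣ᵤ (∣m+n∣n⇒∣m {m = + b} {n = + n * x} (∣ᵤ⇒∣ (ℕ.gcd[m,n]∣n n ∣ b′ ∣))
          (∣m⇒∣m*n x (∣ᵤ⇒∣ {+ ℕ.gcd n ∣ b′ ∣} {+ n} (ℕ.gcd[m,n]∣m n ∣ b′ ∣))))))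
      (ℕ.gcd-greatest (ℕ.gcd[m,n]∣m n b)
        (∣⇒∣ᵤ (∣m∣n⇒∣m+n {m = + b} {n = + n * x} (∣ᵤ⇒∣ (ℕ.gcd[m,n]∣n n b))
          (∣m⇒∣m*n x (∣ᵤ⇒∣ {+ ℕ.gcd n b} {+ n} (ℕ.gcd[m,n]∣m n b))))))
      where b′ = + b + + n * x

    quot-exact : ∀ x → (x * + n) quot (+ n) ≡ x
    quot-exact x = trans (quot≡/ℕ n (x * + n)) (trans (cong (_/ℕ n) (lemma x (+ n)))
      (trans (/ℕ-shift n 0ℤ x) (trans (cong (_+ x) (small-/ℕ n (ℕ.>-nonZero⁻¹ n))) (ℤ.+-identityˡ x))))
      where
      lemma : ∀ x n → x * n ≡ 0ℤ + n * x
      lemma = solve-∀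
      quot≡/ℕ : ∀ n .{{_ : ℕ.NonZero n}} y → y quot (+ n) ≡ y /ℕ n
      quot≡/ℕ (suc n) y = div-pos-is-/ℕ y (suc n)

  kronecker-pos : ∀ a n .{{_ : ℕ.NonZero n}} → kronecker a (+ n) ≡ kroneckerℕ a n
  kronecker-pos a (suc n) = refl

  if-true : ∀ {b} {x y : ℤ} → b ≡ true → (if b then x else y) ≡ x
  if-true refl = refl

  if-false : ∀ {b} {x y : ℤ} → b ≡ false → (if b then x else y) ≡ y
  if-false refl = refl

  -- The splitting formula with the coordinates as variables, so that their known values can be
  -- substituted by matching on equalities. At the coordinates of `γ` it unfolds to `s-formula γ`.
  s-formula-of-coordinates : (A₁ B₁ C₁ A₂ B₂ C₂ : ℤ) → ℤ
  s-formula-of-coordinates A₁ B₁ C₁ A₂ B₂ C₂ =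
      kronecker (kronecker -1ℤ (B₁ quot D₁)) (- (A₁ * A₂))
    * kronecker (A₁ quot D) (A₂ quot D)
    * kronecker (B₁ quot D₁) (A₁ quot D)
    * kronecker ((+ 4 * B₂) quot D₂) (+ ∣ A₂ ∣ quot D)
    * kronecker D₁ C₁
    * kronecker D₂ C₂
    where
    D D₁ D₂ : ℤ
    D  = gcd A₁ A₂
    D₁ = gcd D B₁
    D₂ = D quot D₁

  module _ (k : ℕ) where

    private
      n : ℕ
      n = 2 ℕ.^ k

      instance
        n≢0 : ℕ.NonZero n
        n≢0 = 2^n≢0 k

    n-quot-n : + n quot + n ≡ 1ℤ
    n-quot-n = trans (cong (_quot + n) (sym (ℤ.*-identityˡ (+ n)))) (quot-exact n 1ℤ)

    -n-quot-n : (- (+ n)) quot + n ≡ -1ℤ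
    -n-quot-n = trans (cong (_quot + n) (sym (ℤ.-1*i≡-i (+ n)))) (quot-exact n -1ℤ)

    gcd[n,-n] : gcd (+ n) (- (+ n)) ≡ + n
    gcd[n,-n] = cong +_ (trans (cong (ℕ.gcd n) (ℤ.∣-i∣≡∣i∣ (+ n))) (ℕ∣.∣-antisym
      (ℕ.gcd[m,n]∣m n n) (ℕ.gcd-greatest ℕ∣.∣-refl ℕ∣.∣-refl)))

    -- Here D = n, so -A₁A₂ = 2²ᵏ, A₁/D = |A₂|/D = 1 and A₂/D = -1, which makes the first four
    -- symbols 1. The other two have numerators D₁ = 2ᵃ and D₂ = 2ᵏ⁻ᵃ.
    s-formula-value : ∀ {A₁ C₁ A₂ C₂ c₁ c₂ a} B₁ B₂ →
      A₁ ≡ + n → C₁ ≡ + 4 * c₁ - 1ℤ → A₂ ≡ - (+ n) → C₂ ≡ + 4 * c₂ - 1ℤ →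
      a ℕ.≤ k → ℕ.gcd n ∣ B₁ ∣ ≡ 2 ℕ.^ a →
      s-formula-of-coordinates A₁ B₁ C₁ A₂ B₂ C₂ ≡ sgn c₁ ^ a * sgn c₂ ^ (k ℕ.∸ a)
    s-formula-value {c₁ = c₁} {c₂} {a} B₁ B₂ refl refl refl refl a≤k gcd≡ =
      product≡ (kroneckerε (kronecker[-1]-±1 (B₁ quot D₁))) second third fourth fifth sixth
      where
      D  = gcd (+ n) (- (+ n))
      D₁ = gcd D B₁
      D₂ = D quot D₁
      D₁≡ : D₁ ≡ + (2 ℕ.^ a)
      D₁≡ = trans (cong (λ D → gcd D B₁) gcd[n,-n]) (cong +_ gcd≡)
      D₂≡ : D₂ ≡ + (2 ℕ.^ (k ℕ.∸ a))
      D₂≡ = trans (cong₂ _quot_ (trans gcd[n,-n] n≡) D₁≡) (quot-exact (2 ℕ.^ a) {{2^n≢0 a}} (+ (2 ℕ.^ (k ℕ.∸ a))))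
        where n≡ : + n ≡ + (2 ℕ.^ (k ℕ.∸ a)) * + (2 ℕ.^ a)
              n≡ = trans (cong +_ (trans (cong (2 ℕ.^_) (sym (ℕ.m∸n+n≡m a≤k))) (ℕ.^-distribˡ-+-* 2 (k ℕ.∸ a) a)))
                (ℤ.pos-* (2 ℕ.^ (k ℕ.∸ a)) (2 ℕ.^ a))
      kroneckerε : ∀ {ε} → ε ≡ 1ℤ ⊎ ε ≡ -1ℤ → kronecker ε (- (+ n * - (+ n))) ≡ 1ℤ
      kroneckerε {ε} ε≡±1 = trans (cong (kronecker ε) n²≡)
        (trans (kronecker-pos ε (2 ℕ.^ (k ℕ.+ k)) {{2^n≢0 (k ℕ.+ k)}})
          (kroneckerℕ[±1,2^n] ε≡±1 (k ℕ.+ k) {{2^n≢0 (k ℕ.+ k)}} refl))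
        where
        lemma : ∀ n → - (n * - n) ≡ n * n
        lemma = solve-∀
        n²≡ : - (+ n * - (+ n)) ≡ + (2 ℕ.^ (k ℕ.+ k))
        n²≡ = trans (lemma (+ n)) (trans (sym (ℤ.pos-* n n)) (cong +_ (sym (ℕ.^-distribˡ-+-* 2 k k))))
      second : kronecker (+ n quot D) ((- (+ n)) quot D) ≡ 1ℤ
      second = cong₂ kronecker (trans (cong (+ n quot_) gcd[n,-n]) n-quot-n)
        (trans (cong ((- (+ n)) quot_) gcd[n,-n]) -n-quot-n)
      third : kronecker (B₁ quot D₁) (+ n quot D) ≡ 1ℤ
      third = cong (kronecker (B₁ quot D₁)) (trans (cong (+ n quot_) gcd[n,-n]) n-quot-n)
      fourth : kronecker ((+ 4 * B₂) quot D₂) (+ ∣ - (+ n) ∣ quot D) ≡ 1ℤ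
      fourth = cong (kronecker ((+ 4 * B₂) quot D₂))
        (trans (cong₂ _quot_ (cong +_ (ℤ.∣-i∣≡∣i∣ (+ n))) gcd[n,-n]) n-quot-n)
      fifth : kronecker D₁ (+ 4 * c₁ - 1ℤ) ≡ sgn c₁ ^ a
      fifth = trans (cong (λ D → kronecker D (+ 4 * c₁ - 1ℤ)) D₁≡) (kronecker[2^j,4c-1] a c₁)
      sixth : kronecker D₂ (+ 4 * c₂ - 1ℤ) ≡ sgn c₂ ^ (k ℕ.∸ a)
      sixth = trans (cong (λ D → kronecker D (+ 4 * c₂ - 1ℤ)) D₂≡) (kronecker[2^j,4c-1] (k ℕ.∸ a) c₂)
      product≡ : ∀ {u v w x y z y′ z′} → u ≡ 1ℤ → v ≡ 1ℤ → w ≡ 1ℤ → x ≡ 1ℤ → y ≡ y′ → z ≡ z′ →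
        u * v * w * x * y * z ≡ y′ * z′
      product≡ {y = y} {z} refl refl refl refl refl refl = cong (_* z) (ℤ.*-identityˡ y)

    s-value : ∀ {b₁ b₂ c q a γ} → HasCoordinates (+ n) b₁ b₂ c q γ → a ℕ.≤ k → ℕ.gcd n ∣ b₁ ∣ ≡ 2 ℕ.^ a →
      s γ ≡ sgn c ^ a * sgn (c - q) ^ (k ℕ.∸ a)
    s-value {b₁} {b₂} {c} {q} {a} {γ} coords a≤k gcd≡ = trans s≡s-odd (trans s-odd≡s-formula
      (s-formula-value {c₁ = c} {c₂ = c - q} (B₁ γ) (B₂ γ) A₁≡ C₁≡ A₂≡ C₂≡ a≤k
        (trans (cong (λ b → ℕ.gcd n ∣ b ∣) B₁≡) gcd≡)))
      where
      open HasCoordinates coords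
      -- An odd quotient selects `s-odd` in the parity test of `s`, and A₁ = n > 0 then selects the
      -- unconjugated formula.
      A₂/D≡-1 : A₂ γ quot gcd (A₁ γ) (A₂ γ) ≡ -1ℤ
      A₂/D≡-1 = trans (cong₂ (λ x y → x quot gcd y x) A₂≡ A₁≡)
        (trans (cong ((- (+ n)) quot_) gcd[n,-n]) -n-quot-n)
      s≡s-odd : s γ ≡ s-odd γ
      s≡s-odd = if-false (cong (λ z → does (+ 2 ∣? z)) A₂/D≡-1)
      s-odd≡s-formula : s-odd γ ≡ s-formula γ
      s-odd≡s-formula = if-true (dec-true (0ℤ ℤ.<? A₁ γ)
        (subst (0ℤ ℤ.<_) (sym A₁≡) (ℤ.+<+ (ℕ.>-nonZero⁻¹ n))))

    2-adic : ∀ b → ∃[ a ] a ℕ.≤ k × ℕ.gcd n b ≡ 2 ℕ.^ a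
    2-adic b = ∣2^k⇒≡2^a k (ℕ.gcd[m,n]∣m n b)

    -- min(v₂(b), k)
    ν : ℕ → ℕ
    ν b = proj₁ (2-adic b)

    sign-of-key : Key → ℤ
    sign-of-key (b₁ , b₂ , c) = sgn (+ c) ^ ν b₁ * sgn (+ c - + (b₁ ℕ.* b₂ ℕ./ n)) ^ (k ℕ.∸ ν b₁)

    -- Passing from γ to its reduced parameters changes c by ny + b₁z and c - q by n(y - xz) - xb₂,
    -- where n is even because k > 0. These changes may be odd, but only when the exponent of the
    -- sign concerned is 0, so parities are compared for positive exponents only.
    s-key : .{{_ : ℕ.NonZero k}} → ∀ {γ} → 𝕊ₖ k γ → s γ ≡ sign-of-key (key k γ)
    s-key {γ} γ∈ = trans
      (s-value hasCoordinates′ a≤k (trans (gcd-shift n b₁ x) gcd≡))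
      (cong₂ _*_ (^-cong-positive a λ 0<a → first 0<a) (^-cong-positive (k ℕ.∸ a) λ 0<k-a → second 0<k-a))
      where
      open Translated (normalForm k γ∈)
      open IsKey (isKey k γ∈)
      b₁ = proj₁ (key k γ)
      b₂ = proj₁ (proj₂ (key k γ))
      c = + proj₂ (proj₂ (key k γ))
      a = ν b₁
      a≤k = proj₁ (proj₂ (2-adic b₁))
      gcd≡ = proj₂ (proj₂ (2-adic b₁))
      ^-cong-positive : ∀ {x y : ℤ} j → (0 ℕ.< j → x ≡ y) → x ^ j ≡ y ^ j
      ^-cong-positive zero    h = refl
      ^-cong-positive (suc j) h = cong (_^ suc j) (h (s≤s z≤n))
      2∣n : + 2 ∣ + n
      2∣n = even k
        where even : ∀ k .{{_ : ℕ.NonZero k}} → + 2 ∣ + (2 ℕ.^ k)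
              even (suc k) = ∣ᵤ⇒∣ (ℕ∣.m∣m*n (2 ℕ.^ k))
      first : 0 ℕ.< a → sgn (c + + n * y + + b₁ * z) ≡ sgn c
      first 0<a = trans (sgn-+-even (c + + n * y) (∣m⇒∣m*n z 2∣b₁)) (sgn-+-even c (∣m⇒∣m*n y 2∣n))
        where
        2∣2^a : ∀ {a} → 0 ℕ.< a → 2 ℕ∣.∣ 2 ℕ.^ a
        2∣2^a {suc a} _ = ℕ∣.m∣m*n (2 ℕ.^ a)
        2∣b₁ : + 2 ∣ + b₁
        2∣b₁ = ∣ᵤ⇒∣ (ℕ∣.∣-trans (subst (2 ℕ∣.∣_) (sym gcd≡) (2∣2^a 0<a)) (ℕ.gcd[m,n]∣n n b₁))
      q≡ : q ≡ + (b₁ ℕ.* b₂ ℕ./ n)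
      q≡ = ℤ.*-cancelˡ-≡ (+ n) _ _ {{ℤ.≢-nonZero λ eq → ℕ.≢-nonZero⁻¹ n (ℤ.+-injective eq)}}
        (trans (sym relation) (trans (sym (ℤ.pos-* b₁ b₂))
          (trans (cong +_ (sym (m*[n/m]≡n admissible))) (ℤ.pos-* n (b₁ ℕ.* b₂ ℕ./ n)))))
      second : 0 ℕ.< k ℕ.∸ a → sgn (c + + n * y + + b₁ * z - (q + x * + b₂ + + b₁ * z + + n * (x * z))) ≡
        sgn (c - + (b₁ ℕ.* b₂ ℕ./ n))
      second 0<k-a = trans (cong sgn (lemma c (+ n) y (+ b₁) z q x (+ b₂)))
        (trans (sgn-+-even (c - q + + n * (y - x * z)) (∣n⇒∣m*n (- x) 2∣b₂))
          (trans (sgn-+-even (c - q) (∣m⇒∣m*n (y - x * z) 2∣n)) (cong (λ q → sgn (c - q)) q≡)))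
        where
        lemma : ∀ c n y b₁ z q x b₂ → c + n * y + b₁ * z - (q + x * b₂ + b₁ * z + n * (x * z)) ≡
          c - q + n * (y - x * z) + - x * b₂
        lemma = solve-∀
        2∣b₂ : + 2 ∣ + b₂
        2∣b₂ with even⊎odd b₂
        ... | inj₁ (w , eq) = ∣ᵤ⇒∣ (subst (2 ℕ∣.∣_) (trans (cong (w ℕ.+_) (ℕ.+-identityʳ w)) (sym eq)) (ℕ∣.m∣m*n w))
        -- An odd b₂ makes n divide b₁, hence a = k, against k - a > 0.
        ... | inj₂ (w , eq) = contradiction a≡k (ℕ.<⇒≢ (ℕ.m∸n≢0⇒n<m (ℕ.>⇒≢ 0<k-a)))
          where
          n∣b₁ : n ℕ∣.∣ b₁
          n∣b₁ = coprime-divisor {o = b₁} (Coprimality.gcd≡1⇒coprime (gcd[2^k,odd] k w))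
            (subst (n ℕ∣.∣_) (trans (ℕ.*-comm b₁ b₂) (cong (ℕ._* b₁) eq)) admissible)
          a≡k : a ≡ k
          a≡k = 2^-injective (trans (sym gcd≡) (ℕ∣.∣-antisym (ℕ.gcd[m,n]∣m n b₁) (ℕ.gcd-greatest ℕ∣.∣-refl n∣b₁)))

module Summation where

  open import Algebra.Bundles using (CommutativeRing)
  open import Data.Bool.Base using (true; false; if_then_else_)
  open import Data.Integer.Base as ℤ using (ℤ; +_; -[1+_]; 0ℤ; 1ℤ; -1ℤ)
  open import Data.Integer.Divisibility.Signed using (_∣_; _∣?_; divides; ∣ᵤ⇒∣; ∣⇒∣ᵤ; ∣m⇒∣-m)
  open import Data.Integer.Tactic.RingSolver using (solve-∀)
  open import Data.List.Base using (List; []; _∷_; _++_; map; filter; foldr; applyUpTo; upTo; cartesianProduct)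
  open import Data.List.Relation.Binary.Permutation.Propositional as Permutation using (_↭_)
  open import Data.List.Relation.Unary.All as All using (All; []; _∷_)
  open import Data.Nat.Base as ℕ using (ℕ; zero; suc; _^_; _∸_; z≤n; s≤s)
  open import Data.Nat.Coprimality as Coprimality using (Coprime; coprime?; coprime-divisor; gcd≡1⇒coprime)
  import Data.Nat.Divisibility as ℕ∣
  open import Data.Nat.DivMod using (m*n/n≡m)
  import Data.Nat.GCD as ℕ
  import Data.Nat.Tactic.RingSolver as ℕ-Solver
  open import Data.Product.Base using (∃-syntax; _×_; _,_; proj₁; proj₂)
  open import Data.Rational.Base as ℚ using (ℚ; 0ℚ; 1ℚ)
  import Data.Rational.Properties as ℚ
  open import Data.Rational.Unnormalised.Base using (mkℚᵘ; *≡*)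
  import Data.Rational.Unnormalised.Properties as ℚᵘ
  open import Data.Sum.Base using (_⊎_; inj₁; inj₂)
  open import Defs
  open import Function.Base using (_∘_; id)
  open import Function.Bundles using (mk⇔; _⇔_)
  open import Relation.Binary.PropositionalEquality as ≡ using (_≡_; cong; cong₂; subst)
  open import Relation.Nullary.Decidable using (Dec; yes; no; does; dec-true; dec-false; does-⇔)
  open import Relation.Nullary.Negation using (¬_; contradiction)
  open Arithmetic

  -- Finite sums

  /-≡ : ∀ a b m n .{{_ : ℕ.NonZero m}} .{{_ : ℕ.NonZero n}} → a ℤ.* + n ≡ b ℤ.* + m → a ℚ./ m ≡ b ℚ./ n
  /-≡ a b (suc m) (suc n) eq = ℚ.fromℚᵘ-cong {mkℚᵘ a m} {mkℚᵘ b n} (*≡* eq)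

  /-+ : ∀ a b n .{{_ : ℕ.NonZero n}} → (a ℤ.+ b) ℚ./ n ≡ a ℚ./ n ℚ.+ b ℚ./ n
  /-+ a b n@(suc n-1) = ℚ.toℚᵘ-injective (ℚᵘ.≃-trans (ℚ.toℚᵘ-fromℚᵘ (mkℚᵘ (a ℤ.+ b) n-1))
    (ℚᵘ.≃-trans (*≡* (lemma a b (+ n)))
      (ℚᵘ.≃-trans (ℚᵘ.+-cong (ℚᵘ.≃-sym (ℚ.toℚᵘ-fromℚᵘ (mkℚᵘ a n-1))) (ℚᵘ.≃-sym (ℚ.toℚᵘ-fromℚᵘ (mkℚᵘ b n-1))))
        (ℚᵘ.≃-sym (ℚ.toℚᵘ-homo-+ (a ℚ./ n) (b ℚ./ n))))))
    where
    lemma : ∀ a b n → (a ℤ.+ b) ℤ.* (n ℤ.* n) ≡ (a ℤ.* n ℤ.+ b ℤ.* n) ℤ.* n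
    lemma = solve-∀

  integer-*-/ : ∀ a b n .{{_ : ℕ.NonZero n}} → a ℚ./ 1 ℚ.* (b ℚ./ n) ≡ (a ℤ.* b) ℚ./ n
  integer-*-/ a b n@(suc n-1) = ℚ.toℚᵘ-injective (ℚᵘ.≃-trans (ℚ.toℚᵘ-homo-* (a ℚ./ 1) (b ℚ./ n))
    (ℚᵘ.≃-trans (ℚᵘ.*-cong (ℚ.toℚᵘ-fromℚᵘ (mkℚᵘ a 0)) (ℚ.toℚᵘ-fromℚᵘ (mkℚᵘ b n-1)))
      (ℚᵘ.≃-trans (*≡* (lemma a b (+ n))) (ℚᵘ.≃-sym (ℚ.toℚᵘ-fromℚᵘ (mkℚᵘ (a ℤ.* b) n-1))))))
    where
    lemma : ∀ a b n → (a ℤ.* b) ℤ.* n ≡ (a ℤ.* b) ℤ.* (1ℤ ℤ.* n)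
    lemma = solve-∀

  ÷-positive : ∀ x n .{{_ : ℕ.NonZero n}} .{{_ : ℤ.NonZero (+ n)}} → x ÷ (+ n) ≡ x ℚ./ n
  ÷-positive x (suc n) = cong (λ y → y ℚ./ suc n) (ℤ.*-identityˡ x)

  ÷-negative : ∀ x n .{{_ : ℕ.NonZero n}} .{{_ : ℤ.NonZero (ℤ.- (+ n))}} → x ÷ (ℤ.- (+ n)) ≡ (ℤ.- x) ℚ./ n
  ÷-negative x (suc n) = cong (λ y → y ℚ./ suc n) (ℤ.-1*i≡-i x)

  module Sums {c ℓ} (R : CommutativeRing c ℓ) where

    open CommutativeRing R
    open import Relation.Binary.Reasoning.Setoid setoid

    ∑ : ℕ → (ℕ → Carrier) → Carrier
    ∑ zero    f = 0#
    ∑ (suc n) f = f 0 + ∑ n (f ∘ suc)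

    interchange : ∀ a b c d → (a + b) + (c + d) ≈ (a + c) + (b + d)
    interchange a b c d = begin
      (a + b) + (c + d) ≈⟨ +-assoc a b (c + d) ⟩
      a + (b + (c + d)) ≈⟨ +-congˡ (+-assoc b c d) ⟨
      a + ((b + c) + d) ≈⟨ +-congˡ (+-congʳ (+-comm b c)) ⟩
      a + ((c + b) + d) ≈⟨ +-congˡ (+-assoc c b d) ⟩
      a + (c + (b + d)) ≈⟨ +-assoc a c (b + d) ⟨
      (a + c) + (b + d) ∎

    ∑-cong< : ∀ n {f g} → (∀ i → i ℕ.< n → f i ≈ g i) → ∑ n f ≈ ∑ n g
    ∑-cong< zero    h = refl
    ∑-cong< (suc n) h = +-cong (h 0 (s≤s z≤n)) (∑-cong< n λ i i<n → h (suc i) (s≤s i<n))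

    ∑-cong : ∀ n {f g} → (∀ i → f i ≈ g i) → ∑ n f ≈ ∑ n g
    ∑-cong n h = ∑-cong< n λ i _ → h i

    ∑-0 : ∀ n → ∑ n (λ _ → 0#) ≈ 0#
    ∑-0 zero    = refl
    ∑-0 (suc n) = trans (+-identityˡ _) (∑-0 n)

    ∑-+ : ∀ n f g → ∑ n (λ i → f i + g i) ≈ ∑ n f + ∑ n g
    ∑-+ zero    f g = sym (+-identityˡ 0#)
    ∑-+ (suc n) f g = trans (+-congˡ (∑-+ n (f ∘ suc) (g ∘ suc)))
      (interchange (f 0) (g 0) (∑ n (f ∘ suc)) (∑ n (g ∘ suc)))

    ∑-*ˡ : ∀ n x f → ∑ n (λ i → x * f i) ≈ x * ∑ n f
    ∑-*ˡ zero    x f = sym (zeroʳ x)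
    ∑-*ˡ (suc n) x f = trans (+-congˡ (∑-*ˡ n x (f ∘ suc))) (sym (distribˡ x (f 0) (∑ n (f ∘ suc))))

    ∑-*ʳ : ∀ n x f → ∑ n (λ i → f i * x) ≈ ∑ n f * x
    ∑-*ʳ n x f = trans (∑-cong n λ i → *-comm (f i) x) (trans (∑-*ˡ n x f) (*-comm x (∑ n f)))

    ∑-pairs : ∀ n f → ∑ (n ℕ.+ n) f ≈ ∑ n (λ i → f (i ℕ.+ i)) + ∑ n (λ i → f (suc (i ℕ.+ i)))
    ∑-pairs zero    f = sym (+-identityˡ 0#)
    ∑-pairs (suc n) f = begin
      f 0 + ∑ (n ℕ.+ suc n) (f ∘ suc)
        ≡⟨ cong (λ m → f 0 + ∑ m (f ∘ suc)) (ℕ.+-suc n n) ⟩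
      f 0 + (f 1 + ∑ (n ℕ.+ n) (f ∘ suc ∘ suc))
        ≈⟨ +-assoc (f 0) (f 1) _ ⟨
      (f 0 + f 1) + ∑ (n ℕ.+ n) (f ∘ suc ∘ suc)
        ≈⟨ +-congˡ (∑-pairs n (f ∘ suc ∘ suc)) ⟩
      (f 0 + f 1) + (∑ n (λ i → f (suc (suc (i ℕ.+ i)))) + ∑ n (λ i → f (suc (suc (suc (i ℕ.+ i))))))
        ≈⟨ interchange (f 0) (f 1) _ _ ⟩
      (f 0 + ∑ n (λ i → f (suc (suc (i ℕ.+ i))))) + (f 1 + ∑ n (λ i → f (suc (suc (suc (i ℕ.+ i))))))
        ≈⟨ +-cong (+-congˡ (∑-cong n λ i → reflexive (cong (f ∘ suc) (≡.sym (ℕ.+-suc i i)))))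
                  (+-congˡ (∑-cong n λ i → reflexive (cong (f ∘ suc ∘ suc) (≡.sym (ℕ.+-suc i i))))) ⟩
      (f 0 + ∑ n (λ i → f (suc i ℕ.+ suc i))) + (f 1 + ∑ n (λ i → f (suc (suc i ℕ.+ suc i)))) ∎

    ∑-2^suc : ∀ k f → ∑ (2 ^ suc k) f ≈ ∑ (2 ^ k) (λ i → f (i ℕ.+ i)) + ∑ (2 ^ k) (λ i → f (suc (i ℕ.+ i)))
    ∑-2^suc k f = trans (reflexive (cong (λ m → ∑ (2 ^ k ℕ.+ m) f) (ℕ.+-identityʳ (2 ^ k)))) (∑-pairs (2 ^ k) f)

    -- Every 0 < b < 2ᵏ is uniquely of the form 2ᵃ(2i + 1).
    ∑-dyadic : ∀ k f →
      ∑ (2 ^ k) f ≈ f 0 + ∑ k (λ a → ∑ (2 ^ (k ∸ suc a)) (λ i → f (2 ^ a ℕ.* suc (i ℕ.+ i))))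
    ∑-dyadic zero    f = refl
    ∑-dyadic (suc k) f = begin
      ∑ (2 ^ suc k) f
        ≈⟨ ∑-2^suc k f ⟩
      ∑ (2 ^ k) (λ i → f (i ℕ.+ i)) + odd
        ≈⟨ +-congʳ (∑-dyadic k (λ i → f (i ℕ.+ i))) ⟩
      (f 0 + ∑ k (λ a → ∑ (2 ^ (k ∸ suc a)) (λ i → f (2 ^ a ℕ.* suc (i ℕ.+ i) ℕ.+ 2 ^ a ℕ.* suc (i ℕ.+ i))))) + odd
        ≈⟨ +-cong (+-congˡ (∑-cong k λ a → ∑-cong (2 ^ (k ∸ suc a)) λ i →
                      reflexive (cong f (double (2 ^ a) (suc (i ℕ.+ i))))))
                  (∑-cong (2 ^ k) λ i → reflexive (cong f (≡.sym (ℕ.*-identityˡ (suc (i ℕ.+ i)))))) ⟩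
      (f 0 + rest) + ∑ (2 ^ k) (λ i → f (1 ℕ.* suc (i ℕ.+ i)))
        ≈⟨ +-assoc (f 0) rest _ ⟩
      f 0 + (rest + ∑ (2 ^ k) (λ i → f (1 ℕ.* suc (i ℕ.+ i))))
        ≈⟨ +-congˡ (+-comm rest _) ⟩
      f 0 + (∑ (2 ^ k) (λ i → f (1 ℕ.* suc (i ℕ.+ i))) + rest) ∎
      where
      odd = ∑ (2 ^ k) (λ i → f (suc (i ℕ.+ i)))
      rest = ∑ k (λ a → ∑ (2 ^ (k ∸ suc a)) (λ i → f (2 ^ suc a ℕ.* suc (i ℕ.+ i))))
      double : ∀ x y → x ℕ.* y ℕ.+ x ℕ.* y ≡ 2 ℕ.* x ℕ.* y
      double x y = ≡.trans (cong (x ℕ.* y ℕ.+_) (≡.sym (ℕ.+-identityʳ (x ℕ.* y)))) (≡.sym (ℕ.*-assoc 2 x y))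

    -- Sums restricted by a divisibility condition

    when : ∀ {p} {P : Set p} → Dec P → Carrier → Carrier
    when P? x = if does P? then x else 0#

    when-⇔ : ∀ {p q} {P : Set p} {Q : Set q} (P? : Dec P) (Q? : Dec Q) x → P ⇔ Q → when P? x ≈ when Q? x
    when-⇔ P? Q? x P⇔Q = reflexive (cong (λ b → if b then x else 0#) (does-⇔ P⇔Q P? Q?))

    when-*ˡ : ∀ {p} {P : Set p} (P? : Dec P) x y → when P? (x * y) ≈ x * when P? y
    when-*ˡ P? x y with does P?
    ... | true  = refl
    ... | false = sym (zeroʳ x)

    when-true : ∀ {p} {P : Set p} (P? : Dec P) x → P → when P? x ≈ x
    when-true P? x p = reflexive (cong (λ b → if b then x else 0#) (dec-true P? p))

    when-false : ∀ {p} {P : Set p} (P? : Dec P) x → ¬ P → when P? x ≈ 0#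
    when-false P? x ¬p = reflexive (cong (λ b → if b then x else 0#) (dec-false P? ¬p))

    odd-multiple : ∀ j i → ¬ 2 ^ suc j ℕ∣.∣ suc (i ℕ.+ i)
    odd-multiple j i h = odd⇒2∤ i (ℕ∣.∣-trans (ℕ∣.m∣m*n (2 ^ j)) h)

    -- Split by parity: an odd index is no multiple of 2ʲ⁺¹, and 2i is one exactly when 2ʲ divides
    -- i.
    ∑-multiples : ∀ j a f →
      ∑ (2 ^ (j ℕ.+ a)) (λ i → when (2 ^ j ℕ∣.∣? i) (f i)) ≈ ∑ (2 ^ a) (λ i → f (2 ^ j ℕ.* i))
    ∑-multiples zero    a f = ∑-cong (2 ^ a) λ i →
      trans (when-true (1 ℕ∣.∣? i) (f i) (ℕ∣.1∣ i)) (reflexive (cong f (≡.sym (ℕ.*-identityˡ i))))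
    ∑-multiples (suc j) a f = begin
      ∑ (2 ^ suc (j ℕ.+ a)) (λ i → when (2 ^ suc j ℕ∣.∣? i) (f i))
        ≈⟨ ∑-2^suc (j ℕ.+ a) _ ⟩
      ∑ N (λ i → when (2 ^ suc j ℕ∣.∣? i ℕ.+ i) (f (i ℕ.+ i))) +
      ∑ N (λ i → when (2 ^ suc j ℕ∣.∣? suc (i ℕ.+ i)) (f (suc (i ℕ.+ i))))
        ≈⟨ +-cong
            (∑-cong N λ i → when-⇔ (2 ^ suc j ℕ∣.∣? i ℕ.+ i) (2 ^ j ℕ∣.∣? i) (f (i ℕ.+ i)) (halve i))
            (trans (∑-cong N λ i → when-false (2 ^ suc j ℕ∣.∣? suc (i ℕ.+ i)) _ (odd-multiple j i)) (∑-0 N)) ⟩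
      ∑ N (λ i → when (2 ^ j ℕ∣.∣? i) (f (i ℕ.+ i))) + 0#
        ≈⟨ +-identityʳ _ ⟩
      ∑ N (λ i → when (2 ^ j ℕ∣.∣? i) (f (i ℕ.+ i)))
        ≈⟨ ∑-multiples j a (λ i → f (i ℕ.+ i)) ⟩
      ∑ (2 ^ a) (λ i → f (2 ^ j ℕ.* i ℕ.+ 2 ^ j ℕ.* i))
        ≈⟨ ∑-cong (2 ^ a) (λ i → reflexive (cong f
           (≡.trans (≡.sym (twice (2 ^ j ℕ.* i))) (≡.sym (ℕ.*-assoc 2 (2 ^ j) i))))) ⟩
      ∑ (2 ^ a) (λ i → f (2 ^ suc j ℕ.* i)) ∎
      where
      N = 2 ^ (j ℕ.+ a)
      twice : ∀ i → 2 ℕ.* i ≡ i ℕ.+ i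
      twice i = cong (i ℕ.+_) (ℕ.+-identityʳ i)
      halve : ∀ i → 2 ^ suc j ℕ∣.∣ i ℕ.+ i ⇔ 2 ^ j ℕ∣.∣ i
      halve i = mk⇔ (λ h → ℕ∣.*-cancelˡ-∣ 2 (subst (2 ^ suc j ℕ∣.∣_) (≡.sym (twice i)) h))
                    (λ h → subst (2 ^ suc j ℕ∣.∣_) (twice i) (ℕ∣.*-monoʳ-∣ 2 h))

    -- Sums over lists

    sumOver : ∀ {a} {A : Set a} → List A → (A → Carrier) → Carrier
    sumOver xs f = foldr _+_ 0# (map f xs)

    module _ {a} {A : Set a} where

      sumOver-cong : ∀ {xs : List A} {f g} → All (λ x → f x ≈ g x) xs → sumOver xs f ≈ sumOver xs g
      sumOver-cong []       = refl
      sumOver-cong (h ∷ hs) = +-cong h (sumOver-cong hs)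

      sumOver-↭ : ∀ {xs ys : List A} (f : A → Carrier) → xs ↭ ys → sumOver xs f ≈ sumOver ys f
      sumOver-↭ f Permutation.refl           = refl
      sumOver-↭ f (Permutation.prep x p)     = +-congˡ (sumOver-↭ f p)
      sumOver-↭ f (Permutation.swap x y p)   = trans (sym (+-assoc (f x) (f y) _))
        (trans (+-cong (+-comm (f x) (f y)) (sumOver-↭ f p)) (+-assoc (f y) (f x) _))
      sumOver-↭ f (Permutation.trans p q)    = trans (sumOver-↭ f p) (sumOver-↭ f q)

      sumOver-filter : ∀ {p} {P : A → Set p} (P? : ∀ x → Dec (P x)) (f : A → Carrier) xs →
        sumOver (filter P? xs) f ≈ sumOver xs (λ x → when (P? x) (f x))
      sumOver-filter P? f []       = refl
      sumOver-filter P? f (x ∷ xs) with does (P? x)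
      ... | true  = +-congˡ (sumOver-filter P? f xs)
      ... | false = trans (sumOver-filter P? f xs) (sym (+-identityˡ _))

      sumOver-++ : ∀ xs ys (f : A → Carrier) → sumOver (xs ++ ys) f ≈ sumOver xs f + sumOver ys f
      sumOver-++ []       ys f = sym (+-identityˡ _)
      sumOver-++ (x ∷ xs) ys f = trans (+-congˡ (sumOver-++ xs ys f)) (sym (+-assoc (f x) _ _))

      sumOver-applyUpTo : ∀ (g : ℕ → A) n f → sumOver (applyUpTo g n) f ≈ ∑ n (f ∘ g)
      sumOver-applyUpTo g zero    f = refl
      sumOver-applyUpTo g (suc n) f = +-congˡ (sumOver-applyUpTo (g ∘ suc) n f)

    module _ {a b} {A : Set a} {B : Set b} where

      sumOver-map : ∀ (g : A → B) xs f → sumOver (map g xs) f ≈ sumOver xs (f ∘ g)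
      sumOver-map g []       f = refl
      sumOver-map g (x ∷ xs) f = +-congˡ (sumOver-map g xs f)

    module _ {a b} {A : Set a} {B : Set b} where

      sumOver-cartesianProduct : ∀ (xs : List A) (ys : List B) (f : A × B → Carrier) →
        sumOver (cartesianProduct xs ys) f ≈ sumOver xs (λ x → sumOver ys (λ y → f (x , y)))
      sumOver-cartesianProduct []       ys f = refl
      sumOver-cartesianProduct (x ∷ xs) ys f = trans (sumOver-++ (map (λ y → x , y) ys) (cartesianProduct xs ys) f)
        (+-cong (sumOver-map (λ y → x , y) ys f) (sumOver-cartesianProduct xs ys f))

  -- Exponential sums over ℤ/2ʲℤ

  module Exponentials {c ℓ} (R : CommutativeRing c ℓ) (E : Exponential R) where

    open CommutativeRing R
    open Sums R
    open ExponentialSums E hiding (sumOver)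
    open Exponential E
    open import Algebra.Properties.Ring ring using (-1*x≈-x; -‿involutive)
    open import Relation.Binary.Reasoning.Setoid setoid

    ι-1 : ι 1ℤ ≈ 1#
    ι-1 = +-identityʳ 1#

    ι-[-1] : ι -1ℤ ≈ - 1#
    ι-[-1] = -‿cong ι-1

    ι-∑ : ∀ n → ∑ n (λ _ → 1#) ≈ ι (+ n)
    ι-∑ zero    = refl
    ι-∑ (suc n) = +-congˡ (ι-∑ n)

    -1*-1≈1 : - 1# * - 1# ≈ 1#
    -1*-1≈1 = trans (-1*x≈-x (- 1#)) (-‿involutive 1#)

    ι-* : ∀ {x y} → x ≡ 1ℤ ⊎ x ≡ -1ℤ → y ≡ 1ℤ ⊎ y ≡ -1ℤ → ι (x ℤ.* y) ≈ ι x * ι y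
    ι-* {y = y} (inj₁ ≡.refl) _ =
      trans (reflexive (cong ι (ℤ.*-identityˡ y))) (sym (trans (*-congʳ ι-1) (*-identityˡ (ι y))))
    ι-* {x} (inj₂ ≡.refl) (inj₁ ≡.refl) = sym (trans (*-congˡ ι-1) (*-identityʳ (ι -1ℤ)))
    ι-* (inj₂ ≡.refl) (inj₂ ≡.refl) =
      trans ι-1 (sym (trans (*-cong ι-[-1] ι-[-1]) -1*-1≈1))

    e-0 : e 0ℚ ≈ 1#
    e-0 = trans (sym (*-identityʳ (e 0ℚ))) (trans (*-congˡ (sym e-1))
      (trans (sym (e-+ 0ℚ 1ℚ)) (trans (reflexive (cong e (ℚ.+-identityˡ 1ℚ))) e-1)))

    e-ℕ : ∀ n → e (+ n ℚ./ 1) ≈ 1#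
    e-ℕ zero    = e-0
    e-ℕ (suc n) = trans (reflexive (cong e (/-+ 1ℤ (+ n) 1)))
      (trans (e-+ 1ℚ (+ n ℚ./ 1)) (trans (*-cong e-1 (e-ℕ n)) (*-identityˡ 1#)))

    e-ℤ : ∀ a → e (a ℚ./ 1) ≈ 1#
    e-ℤ (+ n)    = e-ℕ n
    e-ℤ -[1+ n ] = begin
      e (-[1+ n ] ℚ./ 1)                          ≈⟨ *-identityʳ _ ⟨
      e (-[1+ n ] ℚ./ 1) * 1#                     ≈⟨ *-congˡ (e-ℕ (suc n)) ⟨
      e (-[1+ n ] ℚ./ 1) * e (+ suc n ℚ./ 1)      ≈⟨ e-+ (-[1+ n ] ℚ./ 1) (+ suc n ℚ./ 1) ⟨
      e (-[1+ n ] ℚ./ 1 ℚ.+ + suc n ℚ./ 1)        ≡⟨ cong e (/-+ -[1+ n ] (+ suc n) 1) ⟨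
      e ((-[1+ n ] ℤ.+ + suc n) ℚ./ 1)            ≡⟨ cong (λ z → e (z ℚ./ 1)) (ℤ.+-inverseˡ (+ suc n)) ⟩
      e 0ℚ                                        ≈⟨ e-0 ⟩
      1#                                          ∎

    W : ℕ → ℤ → Carrier
    W j a = e (ℚ._/_ a (2 ^ j) {{2^n≢0 j}})

    W-+ : ∀ j a b → W j (a ℤ.+ b) ≈ W j a * W j b
    W-+ j a b = trans (reflexive (cong e (/-+ a b (2 ^ j) {{2^n≢0 j}}))) (e-+ _ _)

    W-scale : ∀ i j a → W (i ℕ.+ j) (+ (2 ^ i) ℤ.* a) ≈ W j a
    W-scale i j a = reflexive (cong e (/-≡ (+ (2 ^ i) ℤ.* a) a (2 ^ (i ℕ.+ j)) (2 ^ j) {{2^n≢0 (i ℕ.+ j)}} {{2^n≢0 j}}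
      (≡.trans (lemma (+ (2 ^ i)) a (+ (2 ^ j))) (cong (a ℤ.*_)
        (≡.trans (≡.sym (ℤ.pos-* (2 ^ i) (2 ^ j))) (cong +_ (≡.sym (ℕ.^-distribˡ-+-* 2 i j))))))))
      where
      lemma : ∀ x a y → x ℤ.* a ℤ.* y ≡ a ℤ.* (x ℤ.* y)
      lemma = solve-∀

    W-double : ∀ j a → W (suc j) (a ℤ.+ a) ≈ W j a
    W-double j a = trans (reflexive (cong (W (suc j)) (lemma a))) (W-scale 1 j a)
      where
      lemma : ∀ a → a ℤ.+ a ≡ + 2 ℤ.* a
      lemma = solve-∀

    W-period : ∀ j a → W j (+ (2 ^ j) ℤ.* a) ≈ 1#
    W-period j a = trans (reflexive (cong (λ i → W i (+ (2 ^ j) ℤ.* a)) (≡.sym (ℕ.+-identityʳ j))))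
      (trans (W-scale j 0 a) (e-ℤ a))

    -- The place where e(1/2) = -1 enters; the vanishing of complete sums rests on it.
    W-half : ∀ j → W (suc j) (+ (2 ^ j)) ≈ - 1#
    W-half j = trans (reflexive (cong e (/-≡ (+ (2 ^ j)) 1ℤ (2 ^ suc j) 2 {{2^n≢0 (suc j)}} half))) e-½
      where
      half : + (2 ^ j) ℤ.* + 2 ≡ 1ℤ ℤ.* + (2 ^ suc j)
      half = ≡.trans (ℤ.*-comm (+ (2 ^ j)) (+ 2))
        (≡.trans (≡.sym (ℤ.pos-* 2 (2 ^ j))) (≡.sym (ℤ.*-identityˡ (+ (2 ^ suc j)))))

    S : ℕ → ℤ → Carrier
    S j m = ∑ (2 ^ j) (λ t → W j (m ℤ.* + t))

    -- The Ramanujan sum modulo 2ʲ⁺¹, as the odd half of `S (suc j) m`.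
    S-odd : ℕ → ℤ → Carrier
    S-odd j m = ∑ (2 ^ j) (λ t → W (suc j) (m ℤ.* + suc (t ℕ.+ t)))

    W-even : ∀ j m t → W (suc j) (m ℤ.* + (t ℕ.+ t)) ≈ W j (m ℤ.* + t)
    W-even j m t = trans (reflexive (cong (W (suc j)) (ℤ.*-distribˡ-+ m (+ t) (+ t)))) (W-double j (m ℤ.* + t))

    S-suc : ∀ j m → S (suc j) m ≈ S j m + S-odd j m
    S-suc j m = trans (∑-2^suc j _) (+-congʳ (∑-cong (2 ^ j) (W-even j m)))

    S-odd-factor : ∀ j m → S-odd j m ≈ W (suc j) m * S j m
    S-odd-factor j m = trans (∑-cong (2 ^ j) λ t →
        trans (reflexive (cong (W (suc j)) (lemma m (+ t))))
          (trans (W-+ (suc j) m (m ℤ.* + (t ℕ.+ t))) (*-congˡ (W-even j m t))))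
      (∑-*ˡ (2 ^ j) (W (suc j) m) _)
      where
      lemma : ∀ m t → m ℤ.* (1ℤ ℤ.+ (t ℤ.+ t)) ≡ m ℤ.+ m ℤ.* (t ℤ.+ t)
      lemma = solve-∀

    S-divisible : ∀ j m → + (2 ^ j) ∣ m → S j m ≈ ι (+ (2 ^ j))
    S-divisible j m (divides q m≡) = trans (∑-cong (2 ^ j) λ t →
        trans (reflexive (cong (W j) (≡.trans (cong (ℤ._* + t) m≡) (lemma q (+ (2 ^ j)) (+ t))))) (W-period j (q ℤ.* + t)))
      (ι-∑ (2 ^ j))
      where
      lemma : ∀ q n t → q ℤ.* n ℤ.* t ≡ n ℤ.* (q ℤ.* t)
      lemma = solve-∀

    -- Both halves of `S (suc j) m` are multiples of `S j m`. If 2ʲ does not divide m, they vanish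
    -- by induction. Otherwise m is an odd multiple of 2ʲ, so the factor `W (suc j) m` of the odd
    -- half is -1 and the halves cancel.
    S-indivisible : ∀ j m → ¬ + (2 ^ j) ∣ m → S j m ≈ 0#
    S-indivisible zero    m ∤m = contradiction (divides m (≡.sym (ℤ.*-identityʳ m))) ∤m
    S-indivisible (suc j) m ∤m = trans (S-suc j m) (trans (+-congˡ (S-odd-factor j m)) (vanish (+ (2 ^ j) ∣? m)))
      where
      vanish : Dec (+ (2 ^ j) ∣ m) → S j m + W (suc j) m * S j m ≈ 0#
      vanish (no 2^j∤m) = trans (+-cong (S-indivisible j m 2^j∤m) (trans (*-congˡ (S-indivisible j m 2^j∤m)) (zeroʳ _)))
        (+-identityˡ 0#)
      vanish (yes (divides q m≡)) with parity q
      ... | inj₁ (r , q≡) = contradiction (divides r (≡.trans m≡ (≡.trans (cong (ℤ._* + (2 ^ j)) q≡)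
          (≡.trans (lemma r (+ (2 ^ j))) (cong (r ℤ.*_) (≡.sym (ℤ.pos-* 2 (2 ^ j)))))))) ∤m
        where
        lemma : ∀ r n → (r ℤ.+ r) ℤ.* n ≡ r ℤ.* (+ 2 ℤ.* n)
        lemma = solve-∀
      ... | inj₂ (r , q≡) = trans (+-congˡ (trans (*-congʳ W≈-1) (-1*x≈-x (S j m)))) (-‿inverseʳ (S j m))
        where
        lemma : ∀ r n → (1ℤ ℤ.+ (r ℤ.+ r)) ℤ.* n ≡ n ℤ.+ (+ 2 ℤ.* n) ℤ.* r
        lemma = solve-∀
        m≡′ : m ≡ + (2 ^ j) ℤ.+ + (2 ^ suc j) ℤ.* r
        m≡′ = ≡.trans m≡ (≡.trans (cong (ℤ._* + (2 ^ j)) q≡)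
          (≡.trans (lemma r (+ (2 ^ j))) (cong (λ n → + (2 ^ j) ℤ.+ n ℤ.* r) (≡.sym (ℤ.pos-* 2 (2 ^ j))))))
        W≈-1 : W (suc j) m ≈ - 1#
        W≈-1 = trans (reflexive (cong (W (suc j)) m≡′)) (trans (W-+ (suc j) (+ (2 ^ j)) (+ (2 ^ suc j) ℤ.* r))
          (trans (*-cong (W-half j) (W-period (suc j) r)) (*-identityʳ (- 1#))))

    δ-yes : ∀ {p} {P : Set p} (P? : Dec P) → P → δ P? ≈ 1#
    δ-yes P? p = when-true P? 1# p

    δ-no : ∀ {p} {P : Set p} (P? : Dec P) → ¬ P → δ P? ≈ 0#
    δ-no P? ¬p = when-false P? 1# ¬p

    S-value : ∀ j m → S j m ≈ δ (+ (2 ^ j) ∣? m) * ι (+ (2 ^ j))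
    S-value j m = go (+ (2 ^ j) ∣? m)
      where
      go : Dec (+ (2 ^ j) ∣ m) → S j m ≈ δ (+ (2 ^ j) ∣? m) * ι (+ (2 ^ j))
      go (yes ∣m) = trans (S-divisible j m ∣m) (sym (trans (*-congʳ (δ-yes (+ (2 ^ j) ∣? m) ∣m)) (*-identityˡ _)))
      go (no ∤m)  = trans (S-indivisible j m ∤m) (sym (trans (*-congʳ (δ-no (+ (2 ^ j) ∣? m) ∤m)) (zeroˡ _)))

    -- The value depends only on whether 2ʲ divides m. This absorbs the sign that A₂ = -2ᵏ attaches
    -- to m₂.
    S-neg : ∀ j m → S j (ℤ.- m) ≈ S j m
    S-neg j m = trans (S-value j (ℤ.- m)) (trans (*-congʳ
      (when-⇔ (+ (2 ^ j) ∣? ℤ.- m) (+ (2 ^ j) ∣? m) 1#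
        (mk⇔ (λ h → subst (+ (2 ^ j) ∣_) (ℤ.neg-involutive m) (∣m⇒∣-m h)) ∣m⇒∣-m)))
      (sym (S-value j m)))

    S-odd≈ : ∀ j m → S-odd j m ≈ S (suc j) m - S j m
    S-odd≈ j m = sym (begin
      S (suc j) m - S j m             ≈⟨ +-congʳ (S-suc j m) ⟩
      (S j m + S-odd j m) - S j m     ≈⟨ +-congʳ (+-comm (S j m) (S-odd j m)) ⟩
      (S-odd j m + S j m) - S j m     ≈⟨ +-assoc (S-odd j m) (S j m) (- S j m) ⟩
      S-odd j m + (S j m - S j m)     ≈⟨ +-congˡ (-‿inverseʳ (S j m)) ⟩
      S-odd j m + 0#                  ≈⟨ +-identityʳ (S-odd j m) ⟩
      S-odd j m                       ∎)

    S-odd-neg : ∀ j m → S-odd j (ℤ.- m) ≈ S-odd j m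
    S-odd-neg j m = trans (S-odd≈ j (ℤ.- m))
      (trans (+-cong (S-neg (suc j) m) (-‿cong (S-neg j m))) (sym (S-odd≈ j m)))

    -- The units modulo 2ʲ⁺¹ are the odd residues, and (x/4) = 1 on them.
    g₂≈S-odd : ∀ j m → g₂ m (suc j) ≈ S-odd j m
    g₂≈S-odd j m = begin
      g₂ m (suc j)
        ≈⟨ sumOver-filter (λ x → coprime? x (2 ^ suc j)) term (upTo (2 ^ suc j)) ⟩
      sumOver (upTo (2 ^ suc j)) (λ x → when (coprime? x (2 ^ suc j)) (term x))
        ≈⟨ sumOver-applyUpTo id (2 ^ suc j) _ ⟩
      ∑ (2 ^ suc j) (λ x → when (coprime? x (2 ^ suc j)) (term x))
        ≈⟨ ∑-2^suc j _ ⟩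
      ∑ (2 ^ j) (λ t → when (coprime? (t ℕ.+ t) (2 ^ suc j)) (term (t ℕ.+ t))) +
      ∑ (2 ^ j) (λ t → when (coprime? (suc (t ℕ.+ t)) (2 ^ suc j)) (term (suc (t ℕ.+ t))))
        ≈⟨ +-cong (trans (∑-cong (2 ^ j) λ t → when-false (coprime? (t ℕ.+ t) (2 ^ suc j)) _ (even t)) (∑-0 (2 ^ j)))
                  (∑-cong (2 ^ j) λ t → trans (when-true (coprime? (suc (t ℕ.+ t)) (2 ^ suc j)) _ (odd t)) (odd-term t)) ⟩
      0# + S-odd j m
        ≈⟨ +-identityˡ _ ⟩
      S-odd j m ∎
      where
      term : ℕ → Carrier
      term x = ι (kronecker (+ x) (+ 4)) * W (suc j) (m ℤ.* + x)
      even : ∀ t → ¬ Coprime (t ℕ.+ t) (2 ^ suc j)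
      even t coprime = contradiction
        (coprime (subst (2 ℕ∣.∣_) (cong (t ℕ.+_) (ℕ.+-identityʳ t)) (ℕ∣.m∣m*n t) , ℕ∣.m∣m*n (2 ^ j))) λ ()
      odd : ∀ t → Coprime (suc (t ℕ.+ t)) (2 ^ suc j)
      odd t = Coprimality.sym (gcd≡1⇒coprime (gcd[2^k,odd] (suc j) t))
      odd-term : ∀ t → term (suc (t ℕ.+ t)) ≈ W (suc j) (m ℤ.* + suc (t ℕ.+ t))
      odd-term t = trans (*-congʳ (trans (reflexive (cong ι (kronecker[odd,4] t))) ι-1)) (*-identityˡ _)

  -- Evaluation

  ±1-^ : ∀ {x} n → x ≡ 1ℤ ⊎ x ≡ -1ℤ → x ℤ.^ n ≡ 1ℤ ⊎ x ℤ.^ n ≡ -1ℤ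
  ±1-^ zero    _ = inj₁ ≡.refl
  ±1-^ (suc n) h = ±1-* h (±1-^ n h)

  ±1-even-power : ∀ {x} m → x ≡ 1ℤ ⊎ x ≡ -1ℤ → x ℤ.^ (m ℕ.+ m) ≡ 1ℤ
  ±1-even-power m (inj₁ ≡.refl) = 1^n≡1 (m ℕ.+ m)
  ±1-even-power m (inj₂ ≡.refl) = [-1]^2m≡1 m

  ±1-even-sum : ∀ {x} i j m → x ≡ 1ℤ ⊎ x ≡ -1ℤ → i ℕ.+ j ≡ m ℕ.+ m → x ℤ.^ i ≡ x ℤ.^ j
  ±1-even-sum {x} i j m x≡±1 eq = same (±1-^ i x≡±1) (±1-^ j x≡±1)
    (≡.trans (≡.sym (ℤ.^-distribˡ-+-* x i j)) (≡.trans (cong (x ℤ.^_) eq) (±1-even-power m x≡±1)))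
    where
    same : ∀ {x y} → x ≡ 1ℤ ⊎ x ≡ -1ℤ → y ≡ 1ℤ ⊎ y ≡ -1ℤ → x ℤ.* y ≡ 1ℤ → x ≡ y
    same (inj₁ ≡.refl) (inj₁ ≡.refl) _ = ≡.refl
    same (inj₂ ≡.refl) (inj₂ ≡.refl) _ = ≡.refl
    same (inj₁ ≡.refl) (inj₂ ≡.refl) ()
    same (inj₂ ≡.refl) (inj₁ ≡.refl) ()

  module _ (k : ℕ) where

    private instance
      n≢0 : ℕ.NonZero (2 ^ k)
      n≢0 = 2^n≢0 k

    exponent : ℕ → ℕ → ℕ
    exponent b₁ b₂ = b₁ ℕ.* b₂ ℕ./ 2 ^ k

    -- Since (-1)^(c - q) = (-1)^c (-1)^q, the powers a and k - a of (-1)^c combine to the exponent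
    -- k, which no longer involves b₁. As admissibility does not involve c either, the sum over c
    -- splits off as a factor.
    sign-of-key-split : ∀ b₁ b₂ c → sign-of-key k (b₁ , b₂ , c) ≡
      sgn (+ c) ℤ.^ k ℤ.* sgn (+ exponent b₁ b₂) ℤ.^ (k ∸ ν k b₁)
    sign-of-key-split b₁ b₂ c = ≡.trans
      (cong (λ z → x ℤ.^ a ℤ.* z ℤ.^ (k ∸ a)) (sgn-- (+ c) (+ exponent b₁ b₂)))
      (≡.trans (cong (x ℤ.^ a ℤ.*_) (^-*-distrib x y (k ∸ a)))
        (≡.trans (≡.sym (ℤ.*-assoc (x ℤ.^ a) (x ℤ.^ (k ∸ a)) (y ℤ.^ (k ∸ a))))
          (cong (ℤ._* y ℤ.^ (k ∸ a)) (≡.trans (≡.sym (ℤ.^-distribˡ-+-* x a (k ∸ a)))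
            (cong (x ℤ.^_) (ℕ.m+[n∸m]≡n (proj₁ (proj₂ (2-adic k b₁)))))))))
      where
      a = ν k b₁
      x = sgn (+ c)
      y = sgn (+ exponent b₁ b₂)

  ν-unique : ∀ k {a b} → ℕ.gcd (2 ^ k) b ≡ 2 ^ a → ν k b ≡ a
  ν-unique k {a} {b} eq = 2^-injective (≡.trans (≡.sym (proj₂ (proj₂ (2-adic k b)))) eq)

  ν-dyadic : ∀ j a i → ν (j ℕ.+ a) (2 ^ a ℕ.* suc (i ℕ.+ i)) ≡ a
  ν-dyadic j a i = ν-unique (j ℕ.+ a) (≡.trans (cong (λ m → ℕ.gcd m (2 ^ a ℕ.* suc (i ℕ.+ i))) (2^[j+a] j a))
    (≡.trans (≡.sym (ℕ.c*gcd[m,n]≡gcd[cm,cn] (2 ^ a) (2 ^ j) (suc (i ℕ.+ i))))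
      (≡.trans (cong (2 ^ a ℕ.*_) (gcd[2^k,odd] j i)) (ℕ.*-identityʳ (2 ^ a)))))
    where
    2^[j+a] : ∀ j a → 2 ^ (j ℕ.+ a) ≡ 2 ^ a ℕ.* 2 ^ j
    2^[j+a] j a = ≡.trans (ℕ.^-distribˡ-+-* 2 j a) (ℕ.*-comm (2 ^ j) (2 ^ a))

  module Evaluation {r ℓ} (R : CommutativeRing r ℓ) (E : Exponential R) (m₁ m₂ : ℤ) where

    open CommutativeRing R
    open Sums R
    open Exponentials R E
    open ExponentialSums E hiding (sumOver)
    open Exponential E
    open import Relation.Binary.Reasoning.Setoid setoid

    module _ (k : ℕ) where

      private instance
        n≢0 : ℕ.NonZero (2 ^ k)
        n≢0 = 2^n≢0 k

      coefficient : ℕ → ℕ → Carrier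
      coefficient b₁ b₂ = ι (sgn (+ exponent k b₁ b₂) ℤ.^ (k ∸ ν k b₁)) *
        (W k (m₁ ℤ.* + b₁) * W k (ℤ.- m₂ ℤ.* + b₂))

      U : ℕ → Carrier
      U b₁ = ∑ (2 ^ k) (λ b₂ → when (2 ^ k ℕ∣.∣? b₁ ℕ.* b₂) (coefficient b₁ b₂))

      key-term : Key → Carrier
      key-term (b₁ , b₂ , c) = ι (sgn (+ c) ℤ.^ k) * coefficient b₁ b₂

      term : Matrix → Carrier
      term = Σ-term (+ (2 ^ k)) (ℤ.- (+ (2 ^ k))) {{2^n≢0 k}} {{ -2^n≢0 k}} m₁ m₂

      phase : ∀ x y → e ((m₁ ℚ./ 1) ℚ.* (_÷_ x (+ (2 ^ k)) {{2^n≢0 k}}) ℚ.+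
                         (m₂ ℚ./ 1) ℚ.* (_÷_ y (ℤ.- (+ (2 ^ k))) {{ -2^n≢0 k}})) ≈
        W k (m₁ ℤ.* x) * W k (m₂ ℤ.* ℤ.- y)
      phase x y = trans (e-+ _ _) (reflexive (cong₂ (λ p q → e p * e q)
        (≡.trans (cong (m₁ ℚ./ 1 ℚ.*_) (÷-positive x (2 ^ k) {{2^n≢0 k}} {{2^n≢0 k}})) (integer-*-/ m₁ x (2 ^ k)))
        (≡.trans (cong (m₂ ℚ./ 1 ℚ.*_) (÷-negative y (2 ^ k) {{2^n≢0 k}} {{ -2^n≢0 k}}))
          (integer-*-/ m₂ (ℤ.- y) (2 ^ k)))))

      W-reduce : ∀ a x → W k (a ℤ.+ + (2 ^ k) ℤ.* x) ≈ W k a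
      W-reduce a x = trans (W-+ k a (+ (2 ^ k) ℤ.* x)) (trans (*-congˡ (W-period k x)) (*-identityʳ (W k a)))

      term-key : .{{_ : ℕ.NonZero k}} → ∀ {γ} → 𝕊ₖ k γ → term γ ≈ key-term (key k γ)
      term-key {γ} γ∈ = begin
        ι (s γ) * e _
          ≈⟨ *-cong (trans (reflexive (cong ι (≡.trans (s-key k γ∈) (sign-of-key-split k b₁ b₂ c))))
                      (ι-* (±1-^ k (sgn-±1 (+ c))) (±1-^ (k ∸ ν k b₁) (sgn-±1 (+ exponent k b₁ b₂)))))
                    (trans (phase (B₁ γ) (B₂ γ)) (*-cong
                      (trans (reflexive (cong (W k) (≡.trans (cong (m₁ ℤ.*_) B₁≡) (lemma₁ m₁ (+ b₁) (+ (2 ^ k)) x))))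
                        (W-reduce (m₁ ℤ.* + b₁) (m₁ ℤ.* x)))
                      (trans (reflexive (cong (W k) (≡.trans (cong (λ b → m₂ ℤ.* ℤ.- b) B₂≡)
                        (lemma₂ m₂ (+ b₂) (+ (2 ^ k)) z))))
                        (W-reduce (ℤ.- m₂ ℤ.* + b₂) (ℤ.- m₂ ℤ.* z))))) ⟩
        (ι (sgn (+ c) ℤ.^ k) * ι (sgn (+ exponent k b₁ b₂) ℤ.^ (k ∸ ν k b₁))) *
          (W k (m₁ ℤ.* + b₁) * W k (ℤ.- m₂ ℤ.* + b₂))
          ≈⟨ *-assoc _ _ _ ⟩
        key-term (key k γ) ∎
        where
        open Translated (normalForm k γ∈) using (x; z; hasCoordinates′)
        open HasCoordinates hasCoordinates′ using (B₁≡; B₂≡)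
        b₁ = proj₁ (key k γ)
        b₂ = proj₁ (proj₂ (key k γ))
        c = proj₂ (proj₂ (key k γ))
        lemma₁ : ∀ m b n x → m ℤ.* (b ℤ.+ n ℤ.* x) ≡ m ℤ.* b ℤ.+ n ℤ.* (m ℤ.* x)
        lemma₁ = solve-∀
        lemma₂ : ∀ m b n z → m ℤ.* ℤ.- (b ℤ.+ n ℤ.* z) ≡ ℤ.- m ℤ.* b ℤ.+ n ℤ.* (ℤ.- m ℤ.* z)
        lemma₂ = solve-∀

      C-sum : Carrier
      C-sum = ∑ (2 ^ k) (λ c → ι (sgn (+ c) ℤ.^ k))

      Σ≈C-sum*∑U : .{{_ : ℕ.NonZero k}} → ∀ γs → Representatives (+ (2 ^ k)) (ℤ.- (+ (2 ^ k))) γs →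
        sumOver γs term ≈ C-sum * ∑ (2 ^ k) U
      Σ≈C-sum*∑U γs r = begin
        sumOver γs term
          ≈⟨ sumOver-cong (All.map (term-key) (Representatives.sound r)) ⟩
        sumOver γs (key-term ∘ key k)
          ≈⟨ sumOver-map (key k) γs key-term ⟨
        sumOver (map (key k) γs) key-term
          ≈⟨ sumOver-↭ key-term (map-key↭keys k r) ⟩
        sumOver (keys k) key-term
          ≈⟨ sumOver-filter (admissible? k) key-term (cartesianProduct range (cartesianProduct range range)) ⟩
        sumOver (cartesianProduct range (cartesianProduct range range)) restricted
          ≈⟨ sumOver-cartesianProduct range (cartesianProduct range range) restricted ⟩
        sumOver range (λ b₁ → sumOver (cartesianProduct range range) (λ κ → restricted (b₁ , κ)))
          ≈⟨ sumOver-applyUpTo id n _ ⟩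
        ∑ n (λ b₁ → sumOver (cartesianProduct range range) (λ κ → restricted (b₁ , κ)))
          ≈⟨ ∑-cong n (λ b₁ → begin
            sumOver (cartesianProduct range range) (λ κ → restricted (b₁ , κ))
              ≈⟨ sumOver-cartesianProduct range range (λ κ → restricted (b₁ , κ)) ⟩
            sumOver range (λ b₂ → sumOver range (λ c → restricted (b₁ , b₂ , c)))
              ≈⟨ sumOver-applyUpTo id n _ ⟩
            ∑ n (λ b₂ → sumOver range (λ c → restricted (b₁ , b₂ , c)))
              ≈⟨ ∑-cong n (λ b₂ → begin
                sumOver range (λ c → restricted (b₁ , b₂ , c))
                  ≈⟨ sumOver-applyUpTo id n _ ⟩
                ∑ n (λ c → restricted (b₁ , b₂ , c))
                  ≈⟨ ∑-cong n (λ c → when-*ˡ (n ℕ∣.∣? b₁ ℕ.* b₂) (ι (sgn (+ c) ℤ.^ k)) (coefficient b₁ b₂)) ⟩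
                ∑ n (λ c → ι (sgn (+ c) ℤ.^ k) * when (n ℕ∣.∣? b₁ ℕ.* b₂) (coefficient b₁ b₂))
                  ≈⟨ ∑-*ʳ n _ _ ⟩
                C-sum * when (n ℕ∣.∣? b₁ ℕ.* b₂) (coefficient b₁ b₂) ∎) ⟩
            ∑ n (λ b₂ → C-sum * when (n ℕ∣.∣? b₁ ℕ.* b₂) (coefficient b₁ b₂))
              ≈⟨ ∑-*ˡ n C-sum _ ⟩
            C-sum * U b₁ ∎) ⟩
        ∑ n (λ b₁ → C-sum * U b₁)
          ≈⟨ ∑-*ˡ n C-sum U ⟩
        C-sum * ∑ n U ∎
        where
        n = 2 ^ k
        range = upTo n
        restricted : Key → Carrier
        restricted κ = when (admissible? k κ) (key-term κ)

      -- Every b₂ is admissible for b₁ = 0, and gcd(2ᵏ, 0) = 2ᵏ makes the exponent of the sign 0.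
      U-0 : U 0 ≈ S k m₂
      U-0 = trans (∑-cong (2 ^ k) λ b₂ → begin
          when (2 ^ k ℕ∣.∣? 0) (coefficient 0 b₂)
            ≈⟨ when-true (2 ^ k ℕ∣.∣? 0) _ ((2 ^ k) ℕ∣.∣0) ⟩
          coefficient 0 b₂
            ≈⟨ *-cong (trans (reflexive (cong (λ j → ι (sgn (+ exponent k 0 b₂) ℤ.^ j)) k∸ν≡0)) ι-1) (*-congʳ W≈1) ⟩
          1# * (1# * W k (ℤ.- m₂ ℤ.* + b₂))
            ≈⟨ trans (*-identityˡ _) (*-identityˡ _) ⟩
          W k (ℤ.- m₂ ℤ.* + b₂) ∎) (S-neg k m₂)
        where
        k∸ν≡0 : k ∸ ν k 0 ≡ 0
        k∸ν≡0 = ≡.trans (cong (k ∸_) (ν-unique k {k} (ℕ.gcd-identityʳ (2 ^ k)))) (ℕ.n∸n≡0 k)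
        W≈1 : W k (m₁ ℤ.* 0ℤ) ≈ 1#
        W≈1 = trans (reflexive (cong (W k) (≡.trans (ℤ.*-zeroʳ m₁) (≡.sym (ℤ.*-zeroʳ (+ (2 ^ k))))))) (W-period k 0ℤ)

    H : ℕ → ℕ → Carrier
    H j a = ∑ (2 ^ a) (λ t → ι (sgn (+ t) ℤ.^ j) * W a (ℤ.- m₂ ℤ.* + t))

    -- For b₁ = 2ᵃu and b₂ = 2ʲt the quotient b₁b₂/2ᵏ is ut, which has the parity of t as u is odd.
    -- The sign is thus independent of u, and the sums over u and t separate.
    U-dyadic : ∀ j a i → U (j ℕ.+ a) (2 ^ a ℕ.* suc (i ℕ.+ i)) ≈ W j (m₁ ℤ.* + suc (i ℕ.+ i)) * H j a
    U-dyadic j a i = begin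
      ∑ N (λ b₂ → when (N ℕ∣.∣? b₁ ℕ.* b₂) (coefficient k b₁ b₂))
        ≈⟨ ∑-cong N (λ b₂ → when-⇔ (N ℕ∣.∣? b₁ ℕ.* b₂) (2 ^ j ℕ∣.∣? b₂) _ (divisibility b₂)) ⟩
      ∑ N (λ b₂ → when (2 ^ j ℕ∣.∣? b₂) (coefficient k b₁ b₂))
        ≈⟨ ∑-multiples j a (coefficient k b₁) ⟩
      ∑ (2 ^ a) (λ t → coefficient k b₁ (2 ^ j ℕ.* t))
        ≈⟨ ∑-cong (2 ^ a) value ⟩
      ∑ (2 ^ a) (λ t → W j (m₁ ℤ.* + u) * (ι (sgn (+ t) ℤ.^ j) * W a (ℤ.- m₂ ℤ.* + t)))
        ≈⟨ ∑-*ˡ (2 ^ a) (W j (m₁ ℤ.* + u)) _ ⟩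
      W j (m₁ ℤ.* + u) * H j a ∎
      where
      k = j ℕ.+ a
      N = 2 ^ k
      u = suc (i ℕ.+ i)
      b₁ = 2 ^ a ℕ.* u
      instance
        N≢0 : ℕ.NonZero N
        N≢0 = 2^n≢0 k
        2^a≢0 : ℕ.NonZero (2 ^ a)
        2^a≢0 = 2^n≢0 a
      N≡ : N ≡ 2 ^ a ℕ.* 2 ^ j
      N≡ = ≡.trans (ℕ.^-distribˡ-+-* 2 j a) (ℕ.*-comm (2 ^ j) (2 ^ a))
      divisibility : ∀ b₂ → N ℕ∣.∣ b₁ ℕ.* b₂ ⇔ 2 ^ j ℕ∣.∣ b₂
      divisibility b₂ = mk⇔
        (λ h → coprime-divisor (gcd≡1⇒coprime (gcd[2^k,odd] j i))
          (ℕ∣.*-cancelˡ-∣ (2 ^ a) (≡.subst₂ ℕ∣._∣_ N≡ (ℕ.*-assoc (2 ^ a) u b₂) h)))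
        (λ h → ≡.subst₂ ℕ∣._∣_ (≡.sym N≡) (≡.sym (ℕ.*-assoc (2 ^ a) u b₂))
          (ℕ∣.*-monoʳ-∣ (2 ^ a) (ℕ∣.∣n⇒∣m*n u h)))
      exponent≡ : ∀ t → exponent k b₁ (2 ^ j ℕ.* t) ≡ u ℕ.* t
      exponent≡ t = ≡.trans (cong (ℕ._/ N) (≡.trans (lemma (2 ^ a) u (2 ^ j) t) (cong (u ℕ.* t ℕ.*_) (≡.sym N≡))))
        (m*n/n≡m (u ℕ.* t) N)
        where
        lemma : ∀ x u y t → x ℕ.* u ℕ.* (y ℕ.* t) ≡ u ℕ.* t ℕ.* (x ℕ.* y)
        lemma = ℕ-Solver.solve-∀
      sgn≡ : ∀ t → sgn (+ (u ℕ.* t)) ≡ sgn (+ t)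
      sgn≡ t = sgn-+-even (+ t) {+ ((i ℕ.+ i) ℕ.* t)}
        (divides (+ (i ℕ.* t)) (≡.trans (cong +_ (lemma i t)) (ℤ.pos-* (i ℕ.* t) 2)))
        where
        lemma : ∀ i t → (i ℕ.+ i) ℕ.* t ≡ i ℕ.* t ℕ.* 2
        lemma = ℕ-Solver.solve-∀
      value : ∀ t → coefficient k b₁ (2 ^ j ℕ.* t) ≈ W j (m₁ ℤ.* + u) * (ι (sgn (+ t) ℤ.^ j) * W a (ℤ.- m₂ ℤ.* + t))
      value t = begin
        coefficient k b₁ (2 ^ j ℕ.* t)
          ≈⟨ *-cong
              (reflexive (cong ι (cong₂ ℤ._^_ (≡.trans (cong (λ q → sgn (+ q)) (exponent≡ t)) (sgn≡ t))
                (≡.trans (cong (k ∸_) (ν-dyadic j a i)) (ℕ.m+n∸n≡m j a)))))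
              (*-cong
                (trans (reflexive (≡.cong₂ W (ℕ.+-comm j a)
                    (≡.trans (cong (m₁ ℤ.*_) (ℤ.pos-* (2 ^ a) u)) (lemma m₁ (+ (2 ^ a)) (+ u)))))
                  (W-scale a j (m₁ ℤ.* + u)))
                (trans (reflexive (cong (W k)
                    (≡.trans (cong (ℤ.- m₂ ℤ.*_) (ℤ.pos-* (2 ^ j) t)) (lemma (ℤ.- m₂) (+ (2 ^ j)) (+ t)))))
                  (W-scale j a (ℤ.- m₂ ℤ.* + t)))) ⟩
        ι (sgn (+ t) ℤ.^ j) * (W j (m₁ ℤ.* + u) * W a (ℤ.- m₂ ℤ.* + t))
          ≈⟨ *-assoc _ _ _ ⟨
        (ι (sgn (+ t) ℤ.^ j) * W j (m₁ ℤ.* + u)) * W a (ℤ.- m₂ ℤ.* + t)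
          ≈⟨ *-congʳ (*-comm _ _) ⟩
        (W j (m₁ ℤ.* + u) * ι (sgn (+ t) ℤ.^ j)) * W a (ℤ.- m₂ ℤ.* + t)
          ≈⟨ *-assoc _ _ _ ⟩
        W j (m₁ ℤ.* + u) * (ι (sgn (+ t) ℤ.^ j) * W a (ℤ.- m₂ ℤ.* + t)) ∎
        where
        lemma : ∀ m x y → m ℤ.* (x ℤ.* y) ≡ x ℤ.* (m ℤ.* y)
        lemma = solve-∀

    H-0 : ∀ j → H j 0 ≈ 1#
    H-0 j = trans (+-identityʳ _) (trans (*-cong (trans (reflexive (cong ι (1^n≡1 j))) ι-1) (e-ℤ (ℤ.- m₂ ℤ.* 0ℤ)))
      (*-identityˡ 1#))

    -- The even t form a complete sum whose modulus has dropped from 2ᵃ⁺¹ to 2ᵃ; with i = a + 1 this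
    -- is the 2ⁱ⁻¹ of the formula. The odd t form a sum over units with the constant sign (-1)ʲ.
    H-suc : ∀ j a → H j (suc a) ≈ S a m₂ + ι (-1ℤ ℤ.^ j) * S-odd a m₂
    H-suc j a = trans (∑-2^suc a _) (+-cong
      (trans (∑-cong (2 ^ a) λ t → trans (*-cong
          (trans (reflexive (cong ι (≡.trans (cong (ℤ._^ j) (sgn-even (+ t))) (1^n≡1 j)))) ι-1) (W-even a (ℤ.- m₂) t))
          (*-identityˡ _))
        (S-neg a m₂))
      (trans (∑-cong (2 ^ a) λ t → *-congʳ (reflexive (cong (λ x → ι (x ℤ.^ j)) (sgn-odd (+ t)))))
        (trans (∑-*ˡ (2 ^ a) (ι (-1ℤ ℤ.^ j)) _) (*-congˡ (S-odd-neg a m₂)))))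

    C-sum-even : ∀ m → C-sum (m ℕ.+ m) ≈ ι (+ (2 ^ (m ℕ.+ m)))
    C-sum-even m = trans (∑-cong (2 ^ (m ℕ.+ m)) λ c →
        trans (reflexive (cong ι (±1-even-power m (sgn-±1 (+ c))))) ι-1)
      (ι-∑ (2 ^ (m ℕ.+ m)))

    -- For an odd exponent the terms of 2c and 2c + 1 are 1 and -1.
    C-sum-odd : ∀ m → C-sum (suc (m ℕ.+ m)) ≈ 0#
    C-sum-odd m = begin
      C-sum (suc k)
        ≈⟨ ∑-2^suc k _ ⟩
      ∑ (2 ^ k) (λ c → ι (sgn (+ (c ℕ.+ c)) ℤ.^ suc k)) + ∑ (2 ^ k) (λ c → ι (sgn (+ suc (c ℕ.+ c)) ℤ.^ suc k))
        ≈⟨ ∑-+ (2 ^ k) _ _ ⟨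
      ∑ (2 ^ k) (λ c → ι (sgn (+ (c ℕ.+ c)) ℤ.^ suc k) + ι (sgn (+ suc (c ℕ.+ c)) ℤ.^ suc k))
        ≈⟨ ∑-cong (2 ^ k) (λ c → trans (+-cong
            (trans (reflexive (cong ι (≡.trans (cong (ℤ._^ suc k) (sgn-even (+ c))) (1^n≡1 (suc k))))) ι-1)
            (trans (reflexive (cong ι (≡.trans (cong (ℤ._^ suc k) (sgn-odd (+ c)))
              (cong (-1ℤ ℤ.*_) ([-1]^2m≡1 m))))) ι-[-1]))
            (-‿inverseʳ 1#)) ⟩
      ∑ (2 ^ k) (λ _ → 0#)
        ≈⟨ ∑-0 (2 ^ k) ⟩
      0# ∎
      where k = m ℕ.+ m

    ∑U : ∀ k → ∑ (2 ^ suc k) (U (suc k)) ≈ S (suc k) m₂ + ((S (suc k) m₁ - S k m₁) +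
      ∑ k (λ a → S-odd (k ∸ suc a) m₁ * (S a m₂ + ι (-1ℤ ℤ.^ suc (k ∸ suc a)) * S-odd a m₂)))
    ∑U k = trans (∑-dyadic (suc k) (U (suc k))) (+-cong (U-0 (suc k)) (+-cong first
      (∑-cong< k λ a a<k → trans (row (suc a) (s≤s a<k)) (*-congˡ (H-suc (suc (k ∸ suc a)) a)))))
      where
      row : ∀ a → a ℕ.< suc k → ∑ (2 ^ (k ∸ a)) (λ i → U (suc k) (2 ^ a ℕ.* suc (i ℕ.+ i))) ≈
        S-odd (k ∸ a) m₁ * H (suc (k ∸ a)) a
      row a (s≤s a≤k) = trans (∑-cong (2 ^ (k ∸ a)) λ i →
          trans (reflexive (cong (λ k → U k (2 ^ a ℕ.* suc (i ℕ.+ i))) (cong suc (≡.sym (ℕ.m∸n+n≡m a≤k)))))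
            (U-dyadic (suc (k ∸ a)) a i))
        (∑-*ʳ (2 ^ (k ∸ a)) (H (suc (k ∸ a)) a) _)
      -- For odd b₁ only b₂ = 0 is admissible, so the sum over t is 1. Writing the remaining sum
      -- over units as a difference of complete sums produces the negative summand of the formula.
      first : ∑ (2 ^ k) (λ i → U (suc k) (1 ℕ.* suc (i ℕ.+ i))) ≈ S (suc k) m₁ - S k m₁
      first = trans (row 0 (s≤s z≤n)) (trans (*-congˡ (H-0 (suc k))) (trans (*-identityʳ _) (S-odd≈ k m₁)))

  -- Assembling the formula

  module Value {r ℓ} (R : CommutativeRing r ℓ) (E : Exponential R) (m₁ m₂ : ℤ) where

    open CommutativeRing R
    open Sums R
    open Exponentials R E
    open Evaluation R E m₁ m₂
    open ExponentialSums E hiding (sumOver)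
    open import Relation.Binary.Reasoning.Setoid setoid

    ∑₁≈∑ : ∀ n f → ∑₁ n f ≈ ∑ n (f ∘ suc)
    ∑₁≈∑ n f = trans (sumOver-map suc (upTo n) f) (sumOver-applyUpTo id n (f ∘ suc))

    bracket : ℕ → Carrier
    bracket k =
      δ (+ (2 ^ k) ∣? m₁) * ι (+ (2 ^ k))
      + δ (+ (2 ^ k) ∣? m₂) * ι (+ (2 ^ k))
      - δ (+ (2 ^ (k ∸ 1)) ∣? m₁) * ι (+ (2 ^ (k ∸ 1)))
      + ∑₁ (k ∸ 1) (λ i → ι (-1ℤ ℤ.^ i) * g₂ m₁ (k ∸ i) * g₂ m₂ i)
      + ∑₁ (k ∸ 1) (λ i → δ (+ (2 ^ (i ∸ 1)) ∣? m₂) * ι (+ (2 ^ (i ∸ 1))) * g₂ m₁ (k ∸ i))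

    ∑U≈bracket : ∀ k m → suc k ≡ m ℕ.+ m → ∑ (2 ^ suc k) (U (suc k)) ≈ bracket (suc k)
    ∑U≈bracket k m even = begin
      ∑ (2 ^ suc k) (U (suc k))
        ≈⟨ ∑U k ⟩
      s₂ + ((s₁ - s₁′) + ∑ k (λ a → S-odd (k ∸ suc a) m₁ * (S a m₂ + ι (-1ℤ ℤ.^ suc (k ∸ suc a)) * S-odd a m₂)))
        ≈⟨ +-congˡ (+-congˡ (trans (∑-cong< k summand) (∑-+ k (X ∘ suc) (Y ∘ suc)))) ⟩
      s₂ + ((s₁ - s₁′) + (∑ k (X ∘ suc) + ∑ k (Y ∘ suc)))
        ≈⟨ +-congˡ (+-assoc (s₁ - s₁′) _ _) ⟨
      s₂ + (((s₁ - s₁′) + ∑ k (X ∘ suc)) + ∑ k (Y ∘ suc))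
        ≈⟨ +-assoc s₂ _ _ ⟨
      (s₂ + ((s₁ - s₁′) + ∑ k (X ∘ suc))) + ∑ k (Y ∘ suc)
        ≈⟨ +-congʳ (+-assoc s₂ _ _) ⟨
      ((s₂ + (s₁ - s₁′)) + ∑ k (X ∘ suc)) + ∑ k (Y ∘ suc)
        ≈⟨ +-congʳ (+-congʳ (trans (sym (+-assoc s₂ s₁ (- s₁′))) (+-congʳ (+-comm s₂ s₁)))) ⟩
      (((s₁ + s₂) - s₁′) + ∑ k (X ∘ suc)) + ∑ k (Y ∘ suc)
        ≈⟨ +-cong (+-cong (+-cong (+-cong (S-value (suc k) m₁) (S-value (suc k) m₂)) (-‿cong (S-value k m₁)))
             (sym (∑₁≈∑ k X))) (sym (∑₁≈∑ k Y)) ⟩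
      bracket (suc k) ∎
      where
      s₁ = S (suc k) m₁
      s₂ = S (suc k) m₂
      s₁′ = S k m₁
      X Y : ℕ → Carrier
      X i = ι (-1ℤ ℤ.^ i) * g₂ m₁ (suc k ∸ i) * g₂ m₂ i
      Y i = δ (+ (2 ^ (i ∸ 1)) ∣? m₂) * ι (+ (2 ^ (i ∸ 1))) * g₂ m₁ (suc k ∸ i)
      summand : ∀ a → a ℕ.< k →
        S-odd (k ∸ suc a) m₁ * (S a m₂ + ι (-1ℤ ℤ.^ suc (k ∸ suc a)) * S-odd a m₂) ≈ X (suc a) + Y (suc a)
      summand a a<k = begin
        o₁ * (S a m₂ + ι (-1ℤ ℤ.^ j) * o₂)
          ≈⟨ distribˡ o₁ _ _ ⟩
        o₁ * S a m₂ + o₁ * (ι (-1ℤ ℤ.^ j) * o₂)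
          ≈⟨ +-comm _ _ ⟩
        o₁ * (ι (-1ℤ ℤ.^ j) * o₂) + o₁ * S a m₂
          ≈⟨ +-cong (trans (sym (*-assoc o₁ _ o₂)) (*-congʳ (*-comm o₁ _))) (*-comm o₁ (S a m₂)) ⟩
        ι (-1ℤ ℤ.^ j) * o₁ * o₂ + S a m₂ * o₁
          ≈⟨ +-cong (*-cong (*-cong (reflexive (cong ι sign≡)) o₁≈g) (sym (g₂≈S-odd a m₂)))
               (*-cong (S-value a m₂) o₁≈g) ⟩
        X (suc a) + Y (suc a) ∎
        where
        j = suc (k ∸ suc a)
        o₁ = S-odd (k ∸ suc a) m₁
        o₂ = S-odd a m₂
        j≡ : j ≡ k ∸ a
        j≡ = ≡.sym (ℕ.+-∸-assoc 1 a<k)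
        -- With i = a + 1, the computation yields the sign (-1) to the power k + 1 - i and the
        -- formula has (-1)ⁱ; they agree because k + 1 is even here.
        sign≡ : -1ℤ ℤ.^ j ≡ -1ℤ ℤ.^ suc a
        sign≡ = ±1-even-sum j (suc a) m (inj₂ ≡.refl) (≡.trans (cong suc (ℕ.m∸n+n≡m a<k)) even)
        o₁≈g : o₁ ≈ g₂ m₁ (k ∸ a)
        o₁≈g = trans (sym (g₂≈S-odd (k ∸ suc a) m₁)) (reflexive (cong (g₂ m₁) j≡))

    value : ∀ k γs → Representatives (+ (2 ^ suc k)) (ℤ.- (+ (2 ^ suc k))) γs →
      sumOver γs (term (suc k)) ≈ ι (+ (2 ^ suc k)) * δ (+ 2 ∣? + suc k) * bracket (suc k)
    value k γs r = trans (Σ≈C-sum*∑U (suc k) γs r) (cases (even⊎odd (suc k)))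
      where
      cases : (∃[ m ] suc k ≡ m ℕ.+ m) ⊎ (∃[ m ] suc k ≡ suc (m ℕ.+ m)) →
        C-sum (suc k) * ∑ (2 ^ suc k) (U (suc k)) ≈ ι (+ (2 ^ suc k)) * δ (+ 2 ∣? + suc k) * bracket (suc k)
      cases (inj₁ (m , even)) = *-cong
        (trans (subst (λ k → C-sum k ≈ ι (+ (2 ^ k))) (≡.sym even) (C-sum-even m))
          (sym (trans (*-congˡ (δ-yes (+ 2 ∣? + suc k) 2∣)) (*-identityʳ _))))
        (∑U≈bracket k m even)
        where
        2∣ : + 2 ∣ + suc k
        2∣ = ∣ᵤ⇒∣ (subst (2 ℕ∣.∣_) (≡.trans (cong (m ℕ.+_) (ℕ.+-identityʳ m)) (≡.sym even)) (ℕ∣.m∣m*n m))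
      cases (inj₂ (m , odd)) = trans
        (trans (*-congʳ (subst (λ k → C-sum k ≈ 0#) (≡.sym odd) (C-sum-odd m))) (zeroˡ _))
        (sym (trans (*-congʳ (trans (*-congˡ (δ-no (+ 2 ∣? + suc k) 2∤)) (zeroʳ _))) (zeroˡ _)))
        where
        2∤ : ¬ + 2 ∣ + suc k
        2∤ h = odd⇒2∤ m (subst (2 ℕ∣.∣_) odd (∣⇒∣ᵤ h))

open import Algebra.Bundles using (CommutativeRing)
open import Data.Integer.Base using (ℤ; +_; -_; -1ℤ) renaming (_^_ to _^ℤ_)
open import Data.Integer.Divisibility.Signed using (_∣?_)
open import Data.Nat.Base using (ℕ; NonZero; _^_; _∸_)
open import Defs
open import Data.List.Base using (map)
open import Data.Nat.Base using (suc)
open import Data.Product.Base using (_,_)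
open Arithmetic using (keys; representative; representatives)
open Summation using (module Value)

proposition25 :
  ∀ {c ℓ} (R : CommutativeRing c ℓ) (E : Exponential R) →
  (k : ℕ) .{{_ : NonZero k}} (m₁ m₂ : ℤ) →
  let open CommutativeRing R hiding (-_)
      open ExponentialSums E
  in
  Σ-HasValue (+ (2 ^ k)) (- (+ (2 ^ k))) {{2^n≢0 k}} {{ -2^n≢0 k}} m₁ m₂
    (ι (+ (2 ^ k)) * δ (+ 2 ∣? + k) *
      ( δ (+ (2 ^ k) ∣? m₁) * ι (+ (2 ^ k))
      + δ (+ (2 ^ k) ∣? m₂) * ι (+ (2 ^ k))
      - δ (+ (2 ^ (k ∸ 1)) ∣? m₁) * ι (+ (2 ^ (k ∸ 1)))
      + ∑₁ (k ∸ 1) (λ i → ι (-1ℤ ^ℤ i) * g₂ m₁ (k ∸ i) * g₂ m₂ i)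
      + ∑₁ (k ∸ 1) (λ i → δ (+ (2 ^ (i ∸ 1)) ∣? m₂) * ι (+ (2 ^ (i ∸ 1))) * g₂ m₁ (k ∸ i))))
proposition25 R E (suc k) m₁ m₂ =
  (map (representative (suc k)) (keys (suc k)) , representatives (suc k)) , value k
  where open Value R E m₁ m₂
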